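{- Let $p\geq 2$ and let $G$ be a finite simple $\{pK_2, K_5-e\}$-free graph. Then $\chi(G)\leq f_p(\omega(G))$, where $f_p:\mathbb{N}\to\mathbb{N}$ ($p\geq2$) is defined as follows. First let $g_p$ ($p\geq2$) be given by $g_t(1)=1$ ($t\geq2$), $g_2(2)=3$, $g_2(m)=m$ ($m\geq3$), $g_p(2)=2p-2$ ($p\geq3$), $g_p(m)=g_{p-1}(m)+2m-2$ ($p,m\geq3$). Then $f_t(1)=1$ for $t\geq 2$; $f_2(2)=3$; $f_2(3)=4$; $f_2(4)=6$; $f_2(s)=s$ for $s\geq 5$; $f_p(2)=2p-2$ and $f_p(3)=2p^2-3p+4$ for $p\geq 3$; and $f_p(m)=f_{p-1}(m)+2g_{p-1}(m-1)+3m-6$ for $p\geq 3$, $m\geq 4$.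
   Context: $\chi(G)$ is the chromatic number and $\omega(G)$ the clique number of $G$. $pK_2$ is the disjoint union of $p$ edges; $K_5-e$ is the complete graph on five vertices minus one edge. A graph is $\mathcal{F}$-free if it has no induced subgraph isomorphic to a member of $\mathcal{F}$. -}

module Defs where

open import Data.Nat using (ℕ; zero; suc; _+_; _*_; _∸_)
open import Data.Bool using (Bool; true; false; _∧_; not)
open import Data.Fin using (Fin; toℕ)
open import Data.Fin.Properties using (_≟_)
open import Data.Product using (Σ; _×_; _,_; ∃)
open import Relation.Nullary using (¬_)
open import Relation.Nullary.Decidable using (⌊_⌋)
open import Relation.Binary.PropositionalEquality using (_≡_; _≢_)
open import Function.Definitions using (Injective)

record Graph (V : Set) : Set where
  field
    adj    : V → V → Bool
    sym    : ∀ x y → adj x y ≡ adj y x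
    irrefl : ∀ x → adj x x ≡ false
open Graph public

InducedSubgraph : {W V : Set} → Graph W → Graph V → Set
InducedSubgraph {W} {V} H G =
  Σ (W → V) λ φ → Injective _≡_ _≡_ φ × (∀ x y → adj H x y ≡ adj G (φ x) (φ y))

Free : {W V : Set} → Graph W → Graph V → Set
Free F G = ¬ InducedSubgraph F G

pK2 : (p : ℕ) → Graph (Fin p × Fin 2)
pK2 p = record { adj = a ; sym = s ; irrefl = ir }
  where
  a : Fin p × Fin 2 → Fin p × Fin 2 → Bool
  a (i , x) (j , y) = ⌊ i ≟ j ⌋ ∧ not ⌊ x ≟ y ⌋
  s : ∀ u v → a u v ≡ a v u
  s (i , Fin.zero) (j , Fin.zero) with i ≟ j | j ≟ i
  ... | Relation.Nullary.yes _ | Relation.Nullary.yes _ = _≡_.refl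
  ... | Relation.Nullary.yes e | Relation.Nullary.no n = Data.Empty.⊥-elim (n (Relation.Binary.PropositionalEquality.sym e))
    where import Data.Empty
  ... | Relation.Nullary.no n | Relation.Nullary.yes e = Data.Empty.⊥-elim (n (Relation.Binary.PropositionalEquality.sym e))
    where import Data.Empty
  ... | Relation.Nullary.no _ | Relation.Nullary.no _ = _≡_.refl
  s (i , Fin.zero) (j , Fin.suc Fin.zero) with i ≟ j | j ≟ i
  ... | Relation.Nullary.yes _ | Relation.Nullary.yes _ = _≡_.refl
  ... | Relation.Nullary.yes e | Relation.Nullary.no n = Data.Empty.⊥-elim (n (Relation.Binary.PropositionalEquality.sym e))
    where import Data.Empty
  ... | Relation.Nullary.no n | Relation.Nullary.yes e = Data.Empty.⊥-elim (n (Relation.Binary.PropositionalEquality.sym e))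
    where import Data.Empty
  ... | Relation.Nullary.no _ | Relation.Nullary.no _ = _≡_.refl
  s (i , Fin.suc Fin.zero) (j , Fin.zero) with i ≟ j | j ≟ i
  ... | Relation.Nullary.yes _ | Relation.Nullary.yes _ = _≡_.refl
  ... | Relation.Nullary.yes e | Relation.Nullary.no n = Data.Empty.⊥-elim (n (Relation.Binary.PropositionalEquality.sym e))
    where import Data.Empty
  ... | Relation.Nullary.no n | Relation.Nullary.yes e = Data.Empty.⊥-elim (n (Relation.Binary.PropositionalEquality.sym e))
    where import Data.Empty
  ... | Relation.Nullary.no _ | Relation.Nullary.no _ = _≡_.refl
  s (i , Fin.suc Fin.zero) (j , Fin.suc Fin.zero) with i ≟ j | j ≟ i
  ... | Relation.Nullary.yes _ | Relation.Nullary.yes _ = _≡_.refl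
  ... | Relation.Nullary.yes e | Relation.Nullary.no n = Data.Empty.⊥-elim (n (Relation.Binary.PropositionalEquality.sym e))
    where import Data.Empty
  ... | Relation.Nullary.no n | Relation.Nullary.yes e = Data.Empty.⊥-elim (n (Relation.Binary.PropositionalEquality.sym e))
    where import Data.Empty
  ... | Relation.Nullary.no _ | Relation.Nullary.no _ = _≡_.refl
  ir : ∀ u → a u u ≡ false
  ir (i , Fin.zero) with i ≟ i
  ... | Relation.Nullary.yes _ = _≡_.refl
  ... | Relation.Nullary.no _ = _≡_.refl
  ir (i , Fin.suc Fin.zero) with i ≟ i
  ... | Relation.Nullary.yes _ = _≡_.refl
  ... | Relation.Nullary.no _ = _≡_.refl

K5-e-adj : Fin 5 → Fin 5 → Bool
K5-e-adj Fin.zero Fin.zero = false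
K5-e-adj Fin.zero (Fin.suc Fin.zero) = false
K5-e-adj Fin.zero (Fin.suc (Fin.suc Fin.zero)) = true
K5-e-adj Fin.zero (Fin.suc (Fin.suc (Fin.suc Fin.zero))) = true
K5-e-adj Fin.zero (Fin.suc (Fin.suc (Fin.suc (Fin.suc Fin.zero)))) = true
K5-e-adj (Fin.suc Fin.zero) Fin.zero = false
K5-e-adj (Fin.suc Fin.zero) (Fin.suc Fin.zero) = false
K5-e-adj (Fin.suc Fin.zero) (Fin.suc (Fin.suc Fin.zero)) = true
K5-e-adj (Fin.suc Fin.zero) (Fin.suc (Fin.suc (Fin.suc Fin.zero))) = true
K5-e-adj (Fin.suc Fin.zero) (Fin.suc (Fin.suc (Fin.suc (Fin.suc Fin.zero)))) = true
K5-e-adj (Fin.suc (Fin.suc Fin.zero)) Fin.zero = true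
K5-e-adj (Fin.suc (Fin.suc Fin.zero)) (Fin.suc Fin.zero) = true
K5-e-adj (Fin.suc (Fin.suc Fin.zero)) (Fin.suc (Fin.suc Fin.zero)) = false
K5-e-adj (Fin.suc (Fin.suc Fin.zero)) (Fin.suc (Fin.suc (Fin.suc Fin.zero))) = true
K5-e-adj (Fin.suc (Fin.suc Fin.zero)) (Fin.suc (Fin.suc (Fin.suc (Fin.suc Fin.zero)))) = true
K5-e-adj (Fin.suc (Fin.suc (Fin.suc Fin.zero))) Fin.zero = true
K5-e-adj (Fin.suc (Fin.suc (Fin.suc Fin.zero))) (Fin.suc Fin.zero) = true
K5-e-adj (Fin.suc (Fin.suc (Fin.suc Fin.zero))) (Fin.suc (Fin.suc Fin.zero)) = true
K5-e-adj (Fin.suc (Fin.suc (Fin.suc Fin.zero))) (Fin.suc (Fin.suc (Fin.suc Fin.zero))) = false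
K5-e-adj (Fin.suc (Fin.suc (Fin.suc Fin.zero))) (Fin.suc (Fin.suc (Fin.suc (Fin.suc Fin.zero)))) = true
K5-e-adj (Fin.suc (Fin.suc (Fin.suc (Fin.suc Fin.zero)))) Fin.zero = true
K5-e-adj (Fin.suc (Fin.suc (Fin.suc (Fin.suc Fin.zero)))) (Fin.suc Fin.zero) = true
K5-e-adj (Fin.suc (Fin.suc (Fin.suc (Fin.suc Fin.zero)))) (Fin.suc (Fin.suc Fin.zero)) = true
K5-e-adj (Fin.suc (Fin.suc (Fin.suc (Fin.suc Fin.zero)))) (Fin.suc (Fin.suc (Fin.suc Fin.zero))) = true
K5-e-adj (Fin.suc (Fin.suc (Fin.suc (Fin.suc Fin.zero)))) (Fin.suc (Fin.suc (Fin.suc (Fin.suc Fin.zero)))) = false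

K5-e : Graph (Fin 5)
K5-e = record { adj = K5-e-adj ; sym = s ; irrefl = ir }
  where
  s : ∀ x y → K5-e-adj x y ≡ K5-e-adj y x
  s Fin.zero Fin.zero = _≡_.refl
  s Fin.zero (Fin.suc Fin.zero) = _≡_.refl
  s Fin.zero (Fin.suc (Fin.suc Fin.zero)) = _≡_.refl
  s Fin.zero (Fin.suc (Fin.suc (Fin.suc Fin.zero))) = _≡_.refl
  s Fin.zero (Fin.suc (Fin.suc (Fin.suc (Fin.suc Fin.zero)))) = _≡_.refl
  s (Fin.suc Fin.zero) Fin.zero = _≡_.refl
  s (Fin.suc Fin.zero) (Fin.suc Fin.zero) = _≡_.refl
  s (Fin.suc Fin.zero) (Fin.suc (Fin.suc Fin.zero)) = _≡_.refl
  s (Fin.suc Fin.zero) (Fin.suc (Fin.suc (Fin.suc Fin.zero))) = _≡_.refl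
  s (Fin.suc Fin.zero) (Fin.suc (Fin.suc (Fin.suc (Fin.suc Fin.zero)))) = _≡_.refl
  s (Fin.suc (Fin.suc Fin.zero)) Fin.zero = _≡_.refl
  s (Fin.suc (Fin.suc Fin.zero)) (Fin.suc Fin.zero) = _≡_.refl
  s (Fin.suc (Fin.suc Fin.zero)) (Fin.suc (Fin.suc Fin.zero)) = _≡_.refl
  s (Fin.suc (Fin.suc Fin.zero)) (Fin.suc (Fin.suc (Fin.suc Fin.zero))) = _≡_.refl
  s (Fin.suc (Fin.suc Fin.zero)) (Fin.suc (Fin.suc (Fin.suc (Fin.suc Fin.zero)))) = _≡_.refl
  s (Fin.suc (Fin.suc (Fin.suc Fin.zero))) Fin.zero = _≡_.refl
  s (Fin.suc (Fin.suc (Fin.suc Fin.zero))) (Fin.suc Fin.zero) = _≡_.refl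
  s (Fin.suc (Fin.suc (Fin.suc Fin.zero))) (Fin.suc (Fin.suc Fin.zero)) = _≡_.refl
  s (Fin.suc (Fin.suc (Fin.suc Fin.zero))) (Fin.suc (Fin.suc (Fin.suc Fin.zero))) = _≡_.refl
  s (Fin.suc (Fin.suc (Fin.suc Fin.zero))) (Fin.suc (Fin.suc (Fin.suc (Fin.suc Fin.zero)))) = _≡_.refl
  s (Fin.suc (Fin.suc (Fin.suc (Fin.suc Fin.zero)))) Fin.zero = _≡_.refl
  s (Fin.suc (Fin.suc (Fin.suc (Fin.suc Fin.zero)))) (Fin.suc Fin.zero) = _≡_.refl
  s (Fin.suc (Fin.suc (Fin.suc (Fin.suc Fin.zero)))) (Fin.suc (Fin.suc Fin.zero)) = _≡_.refl
  s (Fin.suc (Fin.suc (Fin.suc (Fin.suc Fin.zero)))) (Fin.suc (Fin.suc (Fin.suc Fin.zero))) = _≡_.refl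
  s (Fin.suc (Fin.suc (Fin.suc (Fin.suc Fin.zero)))) (Fin.suc (Fin.suc (Fin.suc (Fin.suc Fin.zero)))) = _≡_.refl
  ir : ∀ x → K5-e-adj x x ≡ false
  ir Fin.zero = _≡_.refl
  ir (Fin.suc Fin.zero) = _≡_.refl
  ir (Fin.suc (Fin.suc Fin.zero)) = _≡_.refl
  ir (Fin.suc (Fin.suc (Fin.suc Fin.zero))) = _≡_.refl
  ir (Fin.suc (Fin.suc (Fin.suc (Fin.suc Fin.zero)))) = _≡_.refl

HasClique : {V : Set} → Graph V → ℕ → Set
HasClique {V} G k =
  Σ (Fin k → V) λ c → Injective _≡_ _≡_ c × (∀ i j → i ≢ j → adj G (c i) (c j) ≡ true)

IsCliqueNumber : {V : Set} → Graph V → ℕ → Set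
IsCliqueNumber G w = HasClique G w × ¬ HasClique G (suc w)

-- proper k-colouring exists, i.e. χ(G) ≤ k
Colourable : {V : Set} → Graph V → ℕ → Set
Colourable {V} G k =
  Σ (V → Fin k) λ c → ∀ x y → adj G x y ≡ true → c x ≢ c y

-- g p m (meaningful for p ≥ 2, m ≥ 1; other values are junk 0)
g : ℕ → ℕ → ℕ
g 0 _ = 0
g 1 _ = 0
g (suc (suc p)) 0 = 0
g (suc (suc p)) 1 = 1
g 2 2 = 3
g 2 (suc (suc (suc k))) = suc (suc (suc k))
g (suc (suc (suc p))) 2 = 2 * (suc (suc (suc p))) ∸ 2
g (suc (suc (suc p))) (suc (suc (suc k))) =
  g (suc (suc p)) (suc (suc (suc k))) + (2 * (suc (suc (suc k))) ∸ 2)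

-- f p m (meaningful for p ≥ 2, m ≥ 1; f p 0 = 0, the chromatic number of the empty graph)
f : ℕ → ℕ → ℕ
f 0 _ = 0
f 1 _ = 0
f (suc (suc p)) 0 = 0
f (suc (suc p)) 1 = 1
f 2 2 = 3
f 2 3 = 4
f 2 4 = 6
f 2 (suc (suc (suc (suc (suc s))))) = suc (suc (suc (suc (suc s))))
f (suc (suc (suc p))) 2 = 2 * (suc (suc (suc p))) ∸ 2
f (suc (suc (suc p))) 3 =
  (2 * (suc (suc (suc p))) * (suc (suc (suc p))) + 4) ∸ 3 * (suc (suc (suc p)))
f (suc (suc (suc p))) (suc (suc (suc (suc k)))) =
  f (suc (suc p)) (suc (suc (suc (suc k))))
  + 2 * g (suc (suc p)) (suc (suc (suc k)))
  + (3 * (suc (suc (suc (suc k)))) ∸ 6)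

{-# OPTIONS --safe #-}
module Submission where

-- All bounds are proved under the hypothesis ω(G) ≤ m, because f is not monotone (f 2 5 = 5 < 6 = f 2 4).
--
-- Let G contain a triangle abc. The common neighbourhoods of ab, ac and bc are disjoint unions of cliques, since G has no
-- K5-e, and take m - 2 colours each. The remaining neighbours of a are far from the edge bc, hence (p-1)K2-free, and
-- diamond-free; the same holds for b and ac. The vertices far from ab are (p-1)K2-free. This is the recursion of f; the
-- recursion of g comes in the same way from an edge. What remains are the case p = 2 and the triangle-free 3K2-free graphs.
-- If p = 2 and there is a large clique K, then the vertices outside K are independent and each of them misses a vertex of K.
--
-- The other cases, among them the theorem of Gaspers and Huang that (2K2, K4)-free graphs are 4-colourable, are settled by
-- certificates: lists of graphs H₁, ..., Hᵣ such that every graph which contains Hᵢ but none of H₁, ..., Hᵢ₋₁ is colourable.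
-- The vertices are classified by their adjacency to Hᵢ; a class is empty, or has no edges to another one, when a vertex or
-- an edge of that kind would create a forbidden graph or an earlier Hⱼ. Then the colours are assigned to the classes. In
-- addition a vertex u may be removed if its neighbours are all neighbours of a vertex v not adjacent to u.

open import Defs
open import Data.Bool using (Bool; true; false; _∧_; _∨_; not; T)
open import Data.Bool.ListAction using (all)
open import Data.Bool.Properties using (T?) renaming (_≟_ to _≟ᵇ_)
open import Data.Empty using (⊥; ⊥-elim)
open import Data.Fin as Fin using (Fin; zero; suc; fromℕ<; toℕ; inject≤; punchIn; punchOut)
open import Data.Fin.Properties using (_≟_; any?; toℕ<n; toℕ-injective; toℕ-cast; fromℕ<-injective; inject≤-injective; suc-injective; punchIn-punchOut; punchIn-injective; <-cmp; _<?_; <-trans; <-irrefl)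
open import Data.List using (List; []; _∷_; _++_; map; length; replicate; upTo; filter; take; lookup; allFin)
open import Data.List.Properties using (≡-dec; length-map; length-take)
open import Data.List.Membership.DecPropositional using (_∈?_)
open import Data.List.Membership.Propositional using (_∈_; _∉_; find)
open import Data.List.Membership.Propositional.Properties using (∈-++⁺ˡ; ∈-++⁺ʳ; ∈-upTo⁺; ∈-map⁺; ∈-filter⁻; ∈-allFin; ∈-lookup)
open import Data.List.Relation.Unary.All as All using (All; []; _∷_)
import Data.List.Relation.Unary.All.Properties as All
open import Data.List.Relation.Unary.AllPairs as AllPairs using (AllPairs; []; _∷_; allPairs?)
import Data.List.Relation.Unary.AllPairs.Properties as AllPairs
open import Data.List.Relation.Unary.Any using (here; there; index)
open import Data.List.Relation.Unary.Any.Properties using (lookup-index)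
open import Data.List.Relation.Unary.Unique.Propositional.Properties using (allFin⁺)
open import Data.Nat as ℕ using (ℕ; zero; suc; _+_; _*_; _∸_; _<_; _≤_; z≤n; s≤s; _≤?_; _≡ᵇ_; _<ᵇ_; _/_; _%_)
open import Data.Nat.Properties as ℕₚ using (≤-trans; ≤-reflexive; ≡ᵇ⇒≡; ≡⇒≡ᵇ; <ᵇ⇒<)
open import Data.Nat.Solver using (module +-*-Solver)
open import Data.Product using (Σ; _×_; _,_; proj₁; proj₂; ∃)
open import Data.Sum using (_⊎_; inj₁; inj₂)
open import Data.Unit using (⊤; tt)
open import Function.Definitions using (Injective)
open import Relation.Binary.Definitions using (tri<; tri≈; tri>)
open import Relation.Binary.PropositionalEquality using (_≡_; _≢_; refl; cong; cong₂; subst; subst₂; trans) renaming (sym to ≡-sym)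
open import Relation.Nullary using (¬_; Dec; yes; no; ¬?)
open import Relation.Nullary.Decidable using (⌊_⌋; _×-dec_; True; toWitness)

-- The recursion on p loses too much if it starts too early. For p = 2 a triangle-free graph may
-- need 3 colours (C5), so removing an edge and its neighbours would give 3 + 2 = 5 colours for p =
-- 3, while 2p - 2 = 4 are allowed; hence the {3K2, K3}-free graphs need their own certificate. Only
-- two vertices of the triangle pay for private neighbours, since a vertex adjacent to c alone is
-- already far from ab. A private neighbourhood of a costs g at m - 1, because a extends every
-- clique in it.
--
-- For p = 2 the argument with a large clique K needs 2 + 2t vertices in K, where t bounds the
-- neighbours in K of an outer vertex: t = 1 without a diamond, t = 2 without K5-e. So the
-- certificates must reach the clique numbers 3 and 5.
--
-- A certificate contains all embeddings explicitly and is checked by evaluating a Boolean function.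
-- Forbidden graphs and graphs settled earlier are treated alike: an occurrence of either one yields
-- the conclusion. A removed vertex u takes the colour of v, so certificates are applied within an
-- induction on the number of vertices.

private variable
  N k m p : ℕ

-- Boolean reflection and finite case distinction

∧-split : ∀ {a b} → T (a ∧ b) → T a × T b
∧-split {true} t = tt , t

∨-split : ∀ {a b} → T (a ∨ b) → T a ⊎ T b
∨-split {true}  _ = inj₁ tt
∨-split {false} t = inj₂ t

∨-left : ∀ {a b} → T a → T (a ∨ b)
∨-left {true} _ = tt

∨-right : ∀ a {b} → T b → T (a ∨ b)
∨-right true  _ = tt
∨-right false t = t

T-not : ∀ {a} → T (not a) → ¬ T a
T-not {false} _ ()

T⇒≡ : ∀ {a} → T a → a ≡ true
T⇒≡ {true} _ = refl

not-≡ᵇ : ∀ {a b} → T (not (a ≡ᵇ b)) → a ≢ b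
not-≡ᵇ {a} t refl = T-not t (≡⇒≡ᵇ a a refl)

all-∈ : ∀ {A : Set} (p : A → Bool) {xs x} → T (all p xs) → x ∈ xs → T (p x)
all-∈ p {y ∷ ys} t (here refl) = proj₁ (∧-split t)
all-∈ p {y ∷ ys} t (there i)   = all-∈ p (proj₂ (∧-split {p y} t)) i

-- `C` will be the colourability of the whole graph. A single vertex that exhibits a solved graph
-- ends the argument; otherwise the local property holds at all vertices simultaneously.
finite-⊎ : ∀ n {C : Set} {B : Fin n → Set} → (∀ x → C ⊎ B x) → C ⊎ (∀ x → B x)
finite-⊎ zero    f = inj₂ λ ()
finite-⊎ (suc n) {B = B} f with f zero | finite-⊎ n (λ x → f (suc x))
... | inj₁ c | _      = inj₁ c
... | inj₂ _ | inj₁ c = inj₁ c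
... | inj₂ b | inj₂ g = inj₂ λ { zero → b ; (suc x) → g x }

-- Patterns and the certificate checker

-- Non-adjacent and different; adjacent; unknown.
data Trit : Set where
  O I U : Trit

-- The i-th row of a pattern relates vertex i to the vertices i + 1, i + 2, ...
Row Pat : Set
Row = List Trit
Pat = List Row

-- Positions outside the row default to `U`, which asserts nothing and is therefore always sound.
at : Row → ℕ → Trit
at []      _       = U
at (b ∷ r) zero    = b
at (b ∷ r) (suc i) = at r i

set : Row → ℕ → Trit → Row
set []      _       _ = []
set (_ ∷ r) zero    b = b ∷ r
set (c ∷ r) (suc i) b = c ∷ set r i b

adjAt : Pat → ℕ → ℕ → Trit
adjAt []      _       _       = U
adjAt (r ∷ M) zero    zero    = U
adjAt (r ∷ M) zero    (suc j) = at r j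
adjAt (r ∷ M) (suc i) zero    = at r i
adjAt (r ∷ M) (suc i) (suc j) = adjAt M i j

-- `U` does not even match `U`: an embedding may rely only on adjacencies and non-adjacencies that
-- are established.
same : Trit → Trit → Bool
same O O = true
same I I = true
same _ _ = false

rowOK : Pat → Row → ℕ → List ℕ → Bool
rowOK M []      i []       = true
rowOK M (b ∷ r) i (j ∷ js) = same b (adjAt M i j) ∧ rowOK M r i js
rowOK M _       i _        = false

embOK : Pat → Pat → List ℕ → Bool
embOK M []      []       = true
embOK M (r ∷ P) (i ∷ is) = rowOK M r i is ∧ embOK M P is
embOK M _       _        = false

Code : Set
Code = Pat × List ℕ

-- The second component of a code tells where the vertices of `P` lie in `M`, so an embedding is
-- verified entry by entry instead of being searched for.
kills : List Code → Pat → Bool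
kills []             M = false
kills ((P , is) ∷ cs) M = embOK M P is ∨ kills cs M

-- spl m c₀ c₁ stands for the colour c₁ if the vertex has a neighbour with mark m, and for c₀ otherwise.
data Label : Set where
  col : (mark colour : ℕ) → Label
  spl : (mark c₀ c₁ : ℕ) → Label

-- br i a b asks for the adjacency to vertex i of H; dead claims that no vertex gets there.
data Tree : Set where
  dead : Tree
  leaf : Label → Tree
  br   : ℕ → Tree → Tree → Tree

-- A class with identity suc i consists of vertex i of H only; identity 0 imposes nothing.
record Class : Set where
  constructor class
  field
    ident : ℕ
    bits  : Row
    label : Label
open Class

-- Vertices of H that are not asked about keep the entry `U`, so one class can unite many adjacency
-- types.
leaves : Row → Tree → List Class
leaves r dead       = []
leaves r (leaf l)   = class 0 r l ∷ []
leaves r (br i a b) = leaves (set r i O) a ++ leaves (set r i I) b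

deadOK : List Code → Pat → Row → Tree → Bool
deadOK cs H r dead       = kills cs (r ∷ H)
deadOK cs H r (leaf l)   = true
deadOK cs H r (br i a b) = deadOK cs H (set r i O) a ∧ deadOK cs H (set r i I) b

nthLabel : List Label → ℕ → Label
nthLabel []       _       = col 0 0
nthLabel (l ∷ ls) zero    = l
nthLabel (l ∷ ls) (suc i) = nthLabel ls i

hrow : Pat → ℕ → Row
hrow []      _       = []
hrow (r ∷ H) zero    = U ∷ r
hrow (r ∷ H) (suc i) = at r i ∷ hrow H i

imageClass : Pat → List Label → ℕ → Class
imageClass H ls i = class (suc i) (hrow H i) (nthLabel ls i)

hasMark : ℕ → Label → Bool
hasMark m (col m′ _)  = m ≡ᵇ m′
hasMark m (spl _ _ _) = false

mayColour : ℕ → Label → Bool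
mayColour c (col _ a)   = c ≡ᵇ a
mayColour c (spl _ a b) = (c ≡ᵇ a) ∨ (c ≡ᵇ b)

opposite : Trit → Trit → Bool
opposite O I = true
opposite I O = true
opposite _ _ = false

clash₁ : Trit → ℕ → Row → Bool
clash₁ b zero    r = false
clash₁ b (suc i) r = opposite b (at r i)

clash : Trit → Class → Class → Bool
clash b c d = clash₁ b (ident c) (bits d) ∨ clash₁ b (ident d) (bits c)

module _ (k : ℕ) (cs : List Code) (H : Pat) (L : List Class) where

  -- x, y, z lie in the three classes, x is adjacent to y and z, and y is related to z by b.
  tripleOK₁ : Trit → Class → Class → Class → Bool
  tripleOK₁ b x y z = clash b y z ∨ kills cs ((I ∷ b ∷ bits y) ∷ (I ∷ bits x) ∷ bits z ∷ H)

  tripleOK : ℕ → Class → Class → Class → Bool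
  tripleOK m x y z = not (hasMark m (label z)) ∨ (clash I x z ∨ (tripleOK₁ O x y z ∧ tripleOK₁ I x y z))

  -- Here x has the split label and y the fixed colour b. If b = c₀, then y must carry the mark m:
  -- being a marked neighbour, it moves x to c₁ itself. If b = c₁, then y must not carry the mark,
  -- and for every marked neighbour z of x the edges xy and xz must lead to a solved graph, whether
  -- or not y and z are adjacent.
  splitOK : ℕ → ℕ → ℕ → Class → ℕ → ℕ → Class → Bool
  splitOK m c₀ c₁ x m′ b y =
    (not (c₀ ≡ᵇ b) ∨ (m ≡ᵇ m′)) ∧
    (not (c₁ ≡ᵇ b) ∨ (not (m ≡ᵇ m′) ∧ all (tripleOK m x y) L))

  -- For two split labels nothing is known about which colour is chosen, so the two palettes have to
  -- be disjoint.
  labelsOK : Class → Label → Class → Label → Bool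
  labelsOK x (col _ a)     y (col _ b)     = not (a ≡ᵇ b)
  labelsOK x (spl m c₀ c₁) y (col m′ b)    = splitOK m c₀ c₁ x m′ b y
  labelsOK x (col m′ b)    y (spl m c₀ c₁) = splitOK m c₀ c₁ y m′ b x
  labelsOK x (spl _ a b)   y l@(spl _ _ _) = not (mayColour a l) ∧ not (mayColour b l)

  sameVertex : ℕ → ℕ → Bool
  sameVertex (suc i) (suc j) = i ≡ᵇ j
  sameVertex _       _       = false

  pairOK : Class → Class → Bool
  pairOK x y = (clash I x y ∨ sameVertex (ident x) (ident y)) ∨
    (labelsOK x (label x) y (label y) ∨ kills cs ((I ∷ bits y) ∷ bits x ∷ H))

  -- Each class is also compared with itself, since two adjacent vertices could lie in it. Every
  -- other pair is checked in one order only, which suffices because adjacency is symmetric.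
  pairsOK : List Class → Bool
  pairsOK []       = true
  pairsOK (c ∷ ds) = all (pairOK c) (c ∷ ds) ∧ pairsOK ds

  boundOK : Label → Bool
  boundOK (col _ a)   = a <ᵇ k
  boundOK (spl _ a b) = (a <ᵇ k) ∧ (b <ᵇ k)

  colouringOK : Bool
  colouringOK = all (λ c → boundOK (label c)) L ∧ pairsOK L

free : Pat → Row
free H = replicate (length H) U

-- Inside H the inclusion of neighbourhoods is read off; i = u needs its own disjunct because the
-- diagonal of `adjAt` is `U`. Outside H the tree starts from the row of a vertex that is adjacent
-- to u but not to v, and it must have no leaf: all its ends are dead, so no such vertex escapes.
domOK : List Code → Pat → ℕ → ℕ → Tree → Bool
domOK cs H u v t =
  same O (adjAt H u v) ∧
  all (λ i → same O (adjAt H i u) ∨ ((i ≡ᵇ u) ∨ same I (adjAt H i v))) (upTo (length H)) ∧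
  deadOK cs H r₀ t ∧ all (λ _ → false) (leaves r₀ t)
  where r₀ = set (set (free H) u I) v O

data Rule : Set where
  dominated : (u v : ℕ) → Tree → Rule
  coloured  : List Label → Tree → Rule

ruleOK : ℕ → List Code → Pat → Rule → Bool
ruleOK k cs H (dominated u v t)  = domOK cs H u v t
ruleOK k cs H (coloured ls t)    = deadOK cs H (free H) t ∧
  colouringOK k cs H (leaves (free H) t ++ map (imageClass H ls) (upTo (length H)))

-- An embedding code is the list of hexadecimal digits, least significant first: two for the number of the pattern, then one for each vertex.
digits : ℕ → ℕ → List ℕ
digits zero    _ = []
digits (suc m) c = c % 16 ∷ digits m (c / 16)

-- A graph is stored as the upper triangle of its adjacency matrix. Each row is a binary number
-- whose least significant bit belongs to the next vertex.
row : ℕ → ℕ → Row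
row zero    _ = []
row (suc m) c with c % 2
... | zero = O ∷ row m (c / 2)
... | _    = I ∷ row m (c / 2)

pat : List ℕ → Pat
pat []       = []
pat (c ∷ cs) = row (length cs) c ∷ pat cs

-- Out of range: a pattern without embeddings.
nthPat : List Pat → ℕ → Pat
nthPat []       _       = (U ∷ []) ∷ []
nthPat (P ∷ Ps) zero    = P
nthPat (P ∷ Ps) (suc i) = nthPat Ps i

decode : List Pat → ℕ → Code
decode Ps c = let P = nthPat Ps (c % 256) in P , digits (length P) (c / 256)

record Step : Set where
  constructor step
  field
    graph : List ℕ
    codes : List ℕ
    rule  : Rule

-- The number in an embedding code indexes `Ps`: the forbidden patterns come first, and every
-- accepted graph is appended, so that a step can refer only to graphs before it.
stepsOK : ℕ → List Pat → List Step → Bool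
stepsOK k Ps []                  = true
stepsOK k Ps (step H cs ρ ∷ ss) = ruleOK k (map (decode Ps) cs) (pat H) ρ ∧ stepsOK k (Ps ++ pat H ∷ []) ss

-- Soundness of the checker

module Semantics {N : ℕ} (G : Graph (Fin N)) where

  V : Set
  V = Fin N

  _~_ : V → V → Set
  x ~ y = adj G x y ≡ true

  ~-sym : ∀ {x y} → x ~ y → y ~ x
  ~-sym {x} {y} e = trans (sym G y x) e

  ~⇒≢ : ∀ {x y} → x ~ y → x ≢ y
  ~⇒≢ {x} e refl with trans (≡-sym e) (irrefl G x)
  ... | ()

  ~? : ∀ x y → (x ~ y) ⊎ (adj G x y ≡ false)
  ~? x y with adj G x y
  ... | true  = inj₁ refl
  ... | false = inj₂ refl

  ¬~ : ∀ {x y} → x ~ y → adj G x y ≡ false → ⊥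
  ¬~ e f with trans (≡-sym e) f
  ... | ()

  -- `O` has to require that the vertices differ, because a vertex is not adjacent to itself; for
  -- `I` this follows from irreflexivity.
  Link : Trit → V → V → Set
  Link U x y = ⊤
  Link I x y = x ~ y
  Link O x y = adj G x y ≡ false × x ≢ y

  Link-sym : ∀ b {x y} → Link b x y → Link b y x
  Link-sym U _ = tt
  Link-sym I e = ~-sym e
  Link-sym O {x} {y} (e , ne) = trans (sym G y x) e , λ q → ne (≡-sym q)

  RowSat : Row → V → List V → Set
  RowSat []      x _        = ⊤
  RowSat (_ ∷ _) x []       = ⊥
  RowSat (b ∷ r) x (y ∷ ys) = Link b x y × RowSat r x ys

  Sat : Pat → List V → Set
  Sat []      []       = ⊤
  Sat (r ∷ M) (x ∷ xs) = RowSat r x xs × Sat M xs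
  Sat _       _        = ⊥

-- The parameter `dominated-colourable` is the place of the induction: it is supplied by colouring
-- the graph without u.
module Soundness {N : ℕ} (G : Graph (Fin N)) (k : ℕ)
  (dominated-colourable : ∀ u v → adj G u v ≡ false → u ≢ v →
     (∀ w → adj G w u ≡ true → adj G w v ≡ true) → Colourable G k) where

  open Semantics G

  C : Set
  C = Colourable G k

  -- The conclusion is a colouring and not a contradiction. Thus a forbidden pattern is good because
  -- it does not occur, an earlier graph because its occurrence has been dealt with, and `kills`
  -- need not distinguish them.
  Good : Pat → Set
  Good P = ∀ xs → Sat P xs → C

  module _ (d : V) where

    nth : List V → ℕ → V
    nth []       _       = d
    nth (x ∷ xs) zero    = x
    nth (x ∷ xs) (suc i) = nth xs i

    at-sound : ∀ r {x} ys → RowSat r x ys → ∀ i → Link (at r i) x (nth ys i)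
    at-sound []      ys       _        i       = tt
    at-sound (b ∷ r) (y ∷ ys) (l , ls) zero    = l
    at-sound (b ∷ r) (y ∷ ys) (l , ls) (suc i) = at-sound r ys ls i

    set-sound : ∀ r {x} ys → RowSat r x ys → ∀ i b → Link b x (nth ys i) → RowSat (set r i b) x ys
    set-sound []      ys       _        i       b l′ = tt
    set-sound (c ∷ r) (y ∷ ys) (l , ls) zero    b l′ = l′ , ls
    set-sound (c ∷ r) (y ∷ ys) (l , ls) (suc i) b l′ = l , set-sound r ys ls i b l′

    adjAt-sound : ∀ M xs → Sat M xs → ∀ i j → Link (adjAt M i j) (nth xs i) (nth xs j)
    adjAt-sound []      []       _       i       j       = tt
    adjAt-sound (r ∷ M) (x ∷ xs) _       zero    zero    = tt
    adjAt-sound (r ∷ M) (x ∷ xs) (s , _) zero    (suc j) = at-sound r xs s j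
    adjAt-sound (r ∷ M) (x ∷ xs) (s , _) (suc i) zero    = Link-sym (at r i) (at-sound r xs s i)
    adjAt-sound (r ∷ M) (x ∷ xs) (_ , s) (suc i) (suc j) = adjAt-sound M xs s i j

    hrow-sat : ∀ M xs → Sat M xs → ∀ i → RowSat (hrow M i) (nth xs i) xs
    hrow-sat []      []       _       i       = tt
    hrow-sat (r ∷ M) (x ∷ xs) (s , _) zero    = tt , s
    hrow-sat (r ∷ M) (x ∷ xs) (s , t) (suc i) = Link-sym (at r i) (at-sound r xs s i) , hrow-sat M xs t i

    same⇒≡ : ∀ b c → T (same b c) → b ≡ c
    same⇒≡ O O _ = refl
    same⇒≡ I I _ = refl

    rowOK-sound : ∀ M xs → Sat M xs → ∀ r i js → T (rowOK M r i js) → RowSat r (nth xs i) (map (nth xs) js)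
    rowOK-sound M xs s []      i []       _ = tt
    rowOK-sound M xs s []      i (_ ∷ _)  ()
    rowOK-sound M xs s (b ∷ r) i (j ∷ js) t with ∧-split {same b (adjAt M i j)} t
    ... | t₁ , t₂ with same⇒≡ b (adjAt M i j) t₁
    ... | refl = adjAt-sound M xs s i j , rowOK-sound M xs s r i js t₂

    embOK-sound : ∀ M xs → Sat M xs → ∀ P is → T (embOK M P is) → Sat P (map (nth xs) is)
    embOK-sound M xs s []      []       _ = tt
    embOK-sound M xs s (r ∷ P) (i ∷ is) t with ∧-split {rowOK M r i is} t
    ... | t₁ , t₂ = rowOK-sound M xs s r i is t₁ , embOK-sound M xs s P is t₂

    kills-sound : ∀ {cs} → All (λ c → Good (proj₁ c)) cs → ∀ M {xs} → Sat M xs → T (kills cs M) → C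
    kills-sound {(P , is) ∷ cs} (g ∷ gs) M {xs} s t with ∨-split {embOK M P is} t
    ... | inj₁ t₁ = g _ (embOK-sound M xs s P is t₁)
    ... | inj₂ t₂ = kills-sound gs M s t₂

  Sat-length : ∀ H xs → Sat H xs → length H ≡ length xs
  Sat-length []      []       _       = refl
  Sat-length (r ∷ H) (x ∷ xs) (_ , s) = cong suc (Sat-length H xs s)

  free-sat : ∀ H xs → Sat H xs → ∀ x → RowSat (free H) x xs
  free-sat []      []       _       x = tt
  free-sat (r ∷ H) (y ∷ ys) (_ , s) x = tt , free-sat H ys s x

  module _ {cs : List Code} (gs : All (λ c → Good (proj₁ c)) cs)
           (H : Pat) (xs : List V) (sH : Sat H xs) where

    Fresh : V → Set
    Fresh x = All (x ≢_) xs

    -- Independence of the default value `d` expresses that i lies in the range of `xs`.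
    Image : V → Set
    Image x = Σ ℕ λ i → i ∈ upTo (length H) × (∀ d → nth d xs i ≡ x)

    image? : ∀ x → Image x ⊎ Fresh x
    image? x with position xs
      where
      position : ∀ ys → (Σ ℕ λ i → i < length ys × (∀ d → nth d ys i ≡ x)) ⊎ All (x ≢_) ys
      position [] = inj₂ []
      position (y ∷ ys) with x ≟ y
      ... | yes refl = inj₁ (0 , s≤s z≤n , λ _ → refl)
      ... | no x≢y with position ys
      ... | inj₁ (i , i< , e) = inj₁ (suc i , s≤s i< , e)
      ... | inj₂ fr           = inj₂ (x≢y ∷ fr)
    ... | inj₂ fr           = inj₂ fr
    ... | inj₁ (i , i< , e) = inj₁ (i , ∈-upTo⁺ (subst (i <_) (≡-sym (Sat-length H xs sH)) i<) , e)

    -- A question about a position outside the row carries no information and goes to the `O`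
    -- branch. Freshness of x supplies the inequality that is part of `O`.
    branch : ∀ {x} r ys → All (x ≢_) ys → RowSat r x ys → ∀ i →
             RowSat (set r i O) x ys ⊎ RowSat (set r i I) x ys
    branch []      ys       fr        rs       i       = inj₁ tt
    branch {x} (b ∷ r) (y ∷ ys) (ne ∷ _) (l , rs) zero with ~? x y
    ... | inj₁ e = inj₂ (e , rs)
    ... | inj₂ e = inj₁ ((e , ne) , rs)
    branch (b ∷ r) (y ∷ ys) (_ ∷ fr)  (l , rs) (suc i) with branch r ys fr rs i
    ... | inj₁ s = inj₁ (l , s)
    ... | inj₂ s = inj₂ (l , s)

    Ident : ℕ → V → Set
    Ident zero    x = ⊤
    Ident (suc i) x = ∀ d → nth d xs i ≡ x

    Classified : List Class → V → Set
    Classified L x = Σ Class λ c → c ∈ L × RowSat (bits c) x xs × Ident (ident c) x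

    classify : ∀ t r → T (deadOK cs H r t) → ∀ {x} → Fresh x → RowSat r x xs → C ⊎ Classified (leaves r t) x
    classify dead       r ok {x} fr rs = inj₁ (kills-sound x gs (r ∷ H) (rs , sH) ok)
    classify (leaf l)   r ok fr rs = inj₂ (class 0 r l , here refl , rs , tt)
    classify (br i a b) r ok fr rs with ∧-split {deadOK cs H (set r i O) a} ok
    ... | ok₁ , ok₂ with branch r xs fr rs i
    classify (br i a b) r ok fr rs | ok₁ , ok₂ | inj₁ s with classify a (set r i O) ok₁ fr s
    ... | inj₁ c             = inj₁ c
    ... | inj₂ (c , ∈L , rs′) = inj₂ (c , ∈-++⁺ˡ ∈L , rs′)
    classify (br i a b) r ok fr rs | ok₁ , ok₂ | inj₂ s with classify b (set r i I) ok₂ fr s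
    ... | inj₁ c             = inj₁ c
    ... | inj₂ (c , ∈L , rs′) = inj₂ (c , ∈-++⁺ʳ (leaves (set r i O) a) ∈L , rs′)

    dominated-sound : ∀ u v t → T (domOK cs H u v t) → V → C
    dominated-sound u v t ok d with ∧-split {same O (adjAt H u v)} ok
    ... | uv , ok₁ with ∧-split {all (λ i → same O (adjAt H i u) ∨ ((i ≡ᵇ u) ∨ same I (adjAt H i v))) (upTo (length H))} ok₁
    ... | im , ok₂ with ∧-split {deadOK cs H (set (set (free H) u I) v O) t} ok₂
    ... | dd , none = conclude (finite-⊎ N λ w → dom w)
      where
      x y : V
      x = nth d xs u
      y = nth d xs v
      uv′ : Link O x y
      uv′ = subst (λ b → Link b x y) (≡-sym (same⇒≡ d O _ uv)) (adjAt-sound d H xs sH u v)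
      dom : ∀ w → C ⊎ (w ~ x → w ~ y)
      dom w with ~? w x | ~? w y
      ... | _ | inj₁ e = inj₂ λ _ → e
      ... | inj₂ e | _ = inj₂ λ e′ → ⊥-elim (¬~ e′ e)
      ... | inj₁ wx | inj₂ wy with image? w
      ... | inj₁ (i , i∈ , e) with ∨-split {same O (adjAt H i u)} (all-∈ _ im i∈)
      ... | inj₁ o = ⊥-elim (¬~ wx (proj₁ (subst (λ z → Link O z x) (e d)
                       (subst (λ b → Link b _ _) (≡-sym (same⇒≡ d O _ o)) (adjAt-sound d H xs sH i u)))))
      ... | inj₂ o with ∨-split {i ≡ᵇ u} o
      ... | inj₁ q = ⊥-elim (~⇒≢ wx (trans (≡-sym (e d)) (cong (nth d xs) (≡ᵇ⇒≡ i u q))))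
      ... | inj₂ q = inj₂ λ _ → subst (λ z → z ~ y) (e d)
                       (subst (λ b → Link b _ _) (≡-sym (same⇒≡ d I _ q)) (adjAt-sound d H xs sH i v))
      -- A vertex outside H that is adjacent to x but not to y would be sorted by the tree into one
      -- of its leaves, and there are none; so an embedding occurs instead.
      dom w | inj₁ wx | inj₂ wy | inj₂ fr
        with classify t _ dd fr (set-sound d _ xs (set-sound d _ xs (free-sat H xs sH w) u I wx) v O
               (wy , λ e → ¬~ (subst (_~ x) e wx) (trans (sym G y x) (proj₁ uv′))))
      ... | inj₁ c = inj₁ c
      ... | inj₂ (c , ∈L , _) = ⊥-elim (all-∈ _ none ∈L)
      conclude : C ⊎ (∀ w → w ~ x → w ~ y) → C
      conclude (inj₁ c) = c
      conclude (inj₂ f) = dominated-colourable x y (proj₁ uv′) (proj₂ uv′) f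

    opposite-sound : ∀ b c {x y} → T (opposite b c) → Link c x y → ¬ Link b x y
    opposite-sound O I _ l (e , _) = ¬~ l e
    opposite-sound I O _ (e , _) l = ¬~ l e

    clash₁-sound : ∀ b i {x y} r → RowSat r y xs → Ident i x → T (clash₁ b i r) → ¬ Link b y x
    clash₁-sound b (suc i) {x} {y} r rs ix t =
      opposite-sound b (at r i) t (subst (Link (at r i) y) (ix x) (at-sound x r xs rs i))

    clash-sound : ∀ b {x y} (cx cy : Class) → RowSat (bits cx) x xs → RowSat (bits cy) y xs →
                  Ident (ident cx) x → Ident (ident cy) y → T (clash b cx cy) → ¬ Link b x y
    clash-sound b (class i r _) (class j s _) rs ss ix iy t l with ∨-split {clash₁ b i s} t
    ... | inj₁ t₁ = clash₁-sound b i s ss ix t₁ (Link-sym b l)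
    ... | inj₂ t₂ = clash₁-sound b j r rs iy t₂ l

    module _ (L : List Class) (ok : T (colouringOK k cs H L)) (place : ∀ x → Classified L x) where

      lab : V → Label
      lab x = label (proj₁ (place x))

      -- The marked neighbour is sought in the whole graph, H included. The choice made by a split
      -- label is thus not determined by the class of the vertex.
      Witness : V → ℕ → Set
      Witness x m = ∃ λ z → T (hasMark m (lab z)) × x ~ z

      witness? : ∀ x m → Dec (Witness x m)
      witness? x m = any? λ z → T? (hasMark m (lab z)) ×-dec (adj G x z ≟ᵇ true)

      labelColour : V → Label → ℕ
      labelColour x (col _ a) = a
      labelColour x (spl m a b) with witness? x m
      ... | yes _ = b
      ... | no  _ = a

      colour : V → ℕ
      colour x = labelColour x (lab x)

      labelColour-may : ∀ x l → T (mayColour (labelColour x l) l)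
      labelColour-may x (col _ a) = ≡⇒≡ᵇ a a refl
      labelColour-may x (spl m a b) with witness? x m
      ... | yes _ = ∨-right (b ≡ᵇ a) (≡⇒≡ᵇ b b refl)
      ... | no  _ = ∨-left (≡⇒≡ᵇ a a refl)

      bounds : T (all (λ c → boundOK k cs H L (label c)) L)
      bounds = proj₁ (∧-split ok)

      colour-bound : ∀ x → colour x < k
      colour-bound x = go (lab x) (all-∈ _ bounds (proj₁ (proj₂ (place x))))
        where
        go : ∀ l → T (boundOK k cs H L l) → labelColour x l < k
        go (col _ a) t = <ᵇ⇒< a k t
        go (spl m a b) t with witness? x m
        ... | yes _ = <ᵇ⇒< b k (proj₂ (∧-split {a <ᵇ k} t))
        ... | no  _ = <ᵇ⇒< a k (proj₁ (∧-split {a <ᵇ k} t))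

      module _ {x y : V} (xy : x ~ y) where

        cx cy : Class
        cx = proj₁ (place x)
        cy = proj₁ (place y)
        sx = proj₁ (proj₂ (proj₂ (place x)))
        sy = proj₁ (proj₂ (proj₂ (place y)))
        ix = proj₂ (proj₂ (proj₂ (place x)))
        iy = proj₂ (proj₂ (proj₂ (place y)))

        triple : ∀ b {z} → x ~ z → Link b y z → T (tripleOK₁ k cs H L b cx cy (proj₁ (place z))) → C
        triple b {z} xz yz t with place z
        ... | cz , _ , sz , iz with ∨-split {clash b cy cz} t
        ... | inj₁ t₁ = ⊥-elim (clash-sound b cy cz sy sz iy iz t₁ yz)
        ... | inj₂ t₂ = kills-sound x gs _ ((~-sym xy , yz , sy) , (xz , sx) , sz , sH) t₂

        split-pair : ∀ m c₀ c₁ m′ b → lab y ≡ col m′ b →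
                     T (splitOK k cs H L m c₀ c₁ cx m′ b cy) → C ⊎ (labelColour x (spl m c₀ c₁) ≢ b)
        split-pair m c₀ c₁ m′ b ly ok with ∧-split {not (c₀ ≡ᵇ b) ∨ (m ≡ᵇ m′)} ok
        ... | ok₀ , okₜ with witness? x m
        ... | no nw with ∨-split {not (c₀ ≡ᵇ b)} ok₀
        ... | inj₁ t = inj₂ (not-≡ᵇ t)
        -- The vertex y carries the mark and is adjacent to x, so x would have seen a marked
        -- neighbour.
        ... | inj₂ t = ⊥-elim (nw (y , subst (λ l → T (hasMark m l)) (≡-sym ly) t , xy))
        split-pair m c₀ c₁ m′ b ly ok | ok₀ , okₜ | yes (z , zm , xz) with ∨-split {not (c₁ ≡ᵇ b)} okₜ
        ... | inj₁ t = inj₂ (not-≡ᵇ t)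
        ... | inj₂ t with ∧-split {not (m ≡ᵇ m′)} t
        ... | mm , tr with ∨-split {not (hasMark m (lab z))} (all-∈ _ tr (proj₁ (proj₂ (place z))))
        ... | inj₁ t′ = ⊥-elim (T-not t′ zm)
        ... | inj₂ t′ with ∨-split {clash I cx (proj₁ (place z))} t′
        ... | inj₁ cl = ⊥-elim (clash-sound I cx (proj₁ (place z)) sx (proj₁ (proj₂ (proj₂ (place z)))) ix (proj₂ (proj₂ (proj₂ (place z)))) cl xz)
        ... | inj₂ kk with ∧-split {tripleOK₁ k cs H L O cx cy (proj₁ (place z))} kk | ~? y z
        ... | kO , kI | inj₁ yz = inj₁ (triple I xz yz kI)
        ... | kO , kI | inj₂ yz = inj₁ (triple O xz (yz , y≢z) kO)
          where
          -- The vertex z carries the mark m and y another one; without this inequality the triple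
          -- could degenerate to a single edge.
          y≢z : y ≢ z
          y≢z q = T-not mm (subst (λ l → T (hasMark m l)) ly (subst (λ w → T (hasMark m (lab w))) (≡-sym q) zm))

      pair-sound : ∀ {x y} → x ~ y → T (pairOK k cs H L (proj₁ (place x)) (proj₁ (place y))) → C ⊎ (colour x ≢ colour y)
      pair-sound {x} {y} xy t with ∨-split {clash I (cx xy) (cy xy) ∨ sameVertex k cs H L (ident (cx xy)) (ident (cy xy))} t
      ... | inj₁ t₁ with ∨-split {clash I (cx xy) (cy xy)} t₁
      ...   | inj₁ t₂ = ⊥-elim (clash-sound I (cx xy) (cy xy) (sx xy) (sy xy) (ix xy) (iy xy) t₂ xy)
      ...   | inj₂ t₂ = ⊥-elim (~⇒≢ xy (eq (ident (cx xy)) (ident (cy xy)) (ix xy) (iy xy) t₂))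
        where
        eq : ∀ i j → Ident i x → Ident j y → T (sameVertex k cs H L i j) → x ≡ y
        eq (suc i) (suc j) e e′ t = trans (≡-sym (e x)) (trans (cong (nth x xs) (≡ᵇ⇒≡ i j t)) (e′ x))
      pair-sound {x} {y} xy t | inj₂ t₁ with ∨-split {labelsOK k cs H L (cx xy) (lab x) (cy xy) (lab y)} t₁
      ... | inj₂ t₂ = inj₁ (kills-sound x gs _ ((~-sym xy , sy xy) , sx xy , sH) t₂)
      ... | inj₁ t₂ = go (lab x) (lab y) refl refl t₂
        where
        go : ∀ lx ly → lab x ≡ lx → lab y ≡ ly → T (labelsOK k cs H L (cx xy) lx (cy xy) ly) →
             C ⊎ (labelColour x lx ≢ labelColour y ly)
        go (col _ a) (col _ b) px py t = inj₂ (not-≡ᵇ t)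
        go (spl m a b) (col m′ c) px py t = split-pair xy m a b m′ c py t
        go (col m′ c) (spl m a b) px py t with split-pair (~-sym xy) m a b m′ c px t
        ... | inj₁ c′ = inj₁ c′
        ... | inj₂ ne = inj₂ λ q → ne (≡-sym q)
        go (spl m a b) l@(spl m′ a′ b′) px py t with witness? x m
        ... | yes _ = inj₂ λ q → T-not (proj₂ (∧-split {not (mayColour a l)} t))
                        (subst (λ c → T (mayColour c l)) (≡-sym q) (labelColour-may y l))
        ... | no  _ = inj₂ λ q → T-not (proj₁ (∧-split {not (mayColour a l)} t))
                        (subst (λ c → T (mayColour c l)) (≡-sym q) (labelColour-may y l))

      pairs-∈ : ∀ {c d} ds → T (pairsOK k cs H L ds) → c ∈ ds → d ∈ ds →
                T (pairOK k cs H L c d) ⊎ T (pairOK k cs H L d c)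
      pairs-∈ (e ∷ ds) t c∈ d∈ with ∧-split {all (pairOK k cs H L e) (e ∷ ds)} t
      pairs-∈ (e ∷ ds) t (here refl) d∈          | t₁ , t₂ = inj₁ (all-∈ _ t₁ d∈)
      pairs-∈ (e ∷ ds) t (there c∈)  (here refl) | t₁ , t₂ = inj₂ (all-∈ _ t₁ (there c∈))
      pairs-∈ (e ∷ ds) t (there c∈)  (there d∈)  | t₁ , t₂ = pairs-∈ ds t₂ c∈ d∈

      proper : ∀ x y → C ⊎ (x ~ y → colour x ≢ colour y)
      proper x y with ~? x y
      ... | inj₂ e = inj₂ λ e′ → ⊥-elim (¬~ e′ e)
      ... | inj₁ xy with pairs-∈ L (proj₂ (∧-split {all (λ c → boundOK k cs H L (label c)) L} ok))
                           (proj₁ (proj₂ (place x))) (proj₁ (proj₂ (place y)))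
      ... | inj₁ t with pair-sound xy t
      ...   | inj₁ c  = inj₁ c
      ...   | inj₂ ne = inj₂ λ _ → ne
      proper x y | inj₁ xy | inj₂ t with pair-sound (~-sym xy) t
      ...   | inj₁ c  = inj₁ c
      ...   | inj₂ ne = inj₂ λ _ q → ne (≡-sym q)

      colouring : C
      colouring with finite-⊎ N (λ x → finite-⊎ N (proper x))
      ... | inj₁ c = c
      ... | inj₂ f = (λ x → fromℕ< (colour-bound x)) ,
                     λ x y e q → f x y e (fromℕ<-injective _ _ (colour-bound x) (colour-bound y) q)

    rule-sound : V → ∀ ρ → T (ruleOK k cs H ρ) → C
    rule-sound d (dominated u v t) ok = dominated-sound u v t ok d
    rule-sound d (coloured ls t) ok with ∧-split {deadOK cs H (free H) t} ok
    ... | dd , ok′ = conclude (finite-⊎ N place)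
      where
      L = leaves (free H) t ++ map (imageClass H ls) (upTo (length H))
      place : ∀ x → C ⊎ Classified L x
      place x with image? x
      ... | inj₁ (i , i∈ , e) = inj₂ (imageClass H ls i , ∈-++⁺ʳ (leaves (free H) t) (∈-map⁺ (imageClass H ls) i∈) ,
                                       subst (λ z → RowSat (hrow H i) z xs) (e d) (hrow-sat d H xs sH i) , e)
      ... | inj₂ fr with classify t (free H) dd fr (free-sat H xs sH x)
      ... | inj₁ c             = inj₁ c
      ... | inj₂ (c , ∈L , rs) = inj₂ (c , ∈-++⁺ˡ ∈L , rs)
      conclude : C ⊎ (∀ x → Classified L x) → C
      conclude (inj₁ c) = c
      conclude (inj₂ f) = colouring L ok′ f

  decode-good : ∀ {Ps} → All Good Ps → ∀ c → Good (proj₁ (decode Ps c))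
  decode-good {Ps} gs c = go gs (c % 256)
    where
    go : ∀ {Ps} → All Good Ps → ∀ i → Good (nthPat Ps i)
    go []       i       (x ∷ [])    ()
    go []       i       (x ∷ y ∷ _) ()
    go []       i       []          ()
    go (g ∷ gs) zero    = g
    go (g ∷ gs) (suc i) = go gs i

  decodes-good : ∀ {Ps} → All Good Ps → ∀ cs → All (λ c → Good (proj₁ c)) (map (decode Ps) cs)
  decodes-good gs []       = []
  decodes-good gs (c ∷ cs) = decode-good gs c ∷ decodes-good gs cs

  -- Every graph that has been settled joins the good patterns available to the later steps.
  steps-sound : V → ∀ {Ps} ss → All Good Ps → T (stepsOK k Ps ss) → All (λ s → Good (pat (Step.graph s))) ss
  steps-sound d []               gs ok = []
  steps-sound d {Ps} (step H cs ρ ∷ ss) gs ok with ∧-split {ruleOK k (map (decode Ps) cs) (pat H) ρ} ok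
  ... | ok₁ , ok₂ = good ∷ steps-sound d ss (All.++⁺ gs (good ∷ [])) ok₂
    where
    good : Good (pat H)
    good xs s = rule-sound (decodes-good gs cs) (pat H) xs s d ρ ok₁

-- Induced subgraphs, removal of a dominated vertex, and use of a certificate

restrict : ∀ {M N} → Graph (Fin N) → (Fin M → Fin N) → Graph (Fin M)
restrict G ι = record
  { adj    = λ x y → adj G (ι x) (ι y)
  ; sym    = λ x y → sym G (ι x) (ι y)
  ; irrefl = λ x → irrefl G (ι x) }

Avoids : ∀ {N} → Graph (Fin N) → Pat → Set
Avoids G P = ∀ xs → ¬ Semantics.Sat G P xs

module _ {M N} (G : Graph (Fin N)) (ι : Fin M → Fin N) (inj : ∀ {x y} → ι x ≡ ι y → x ≡ y) where

  private
    module S = Semantics G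
    module R = Semantics (restrict G ι)

  Link-map : ∀ b {x y} → R.Link b x y → S.Link b (ι x) (ι y)
  Link-map O (e , ne) = e , λ q → ne (inj q)
  Link-map I e        = e
  Link-map U _        = tt

  RowSat-map : ∀ r {x} ys → R.RowSat r x ys → S.RowSat r (ι x) (map ι ys)
  RowSat-map []      ys       _        = tt
  RowSat-map (b ∷ r) (y ∷ ys) (l , rs) = Link-map b l , RowSat-map r ys rs

  Sat-map : ∀ P xs → R.Sat P xs → S.Sat P (map ι xs)
  Sat-map []      []       _        = tt
  Sat-map (r ∷ P) (x ∷ xs) (rs , s) = RowSat-map r xs rs , Sat-map P xs s

  restrict-avoids : ∀ {P} → Avoids G P → Avoids (restrict G ι) P
  restrict-avoids av xs s = av (map ι xs) (Sat-map _ xs s)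

-- Giving u the colour of v is safe: every neighbour of u is a neighbour of v and hence has another
-- colour than v.
extend-colouring : ∀ {N k} (G : Graph (Fin (suc N))) u v → adj G u v ≡ false → u ≢ v →
  (∀ w → adj G w u ≡ true → adj G w v ≡ true) → Colourable (restrict G (punchIn u)) k → Colourable G k
extend-colouring {N} {k} G u v uv u≢v dom (c , pr) = col′ , proper′
  where
  open Semantics G
  col′ : Fin (suc N) → Fin k
  col′ x with u ≟ x
  ... | yes _  = c (punchOut u≢v)
  ... | no u≢x = c (punchOut u≢x)
  differ : ∀ {x y} (u≢x : u ≢ x) (u≢y : u ≢ y) → x ~ y → c (punchOut u≢x) ≢ c (punchOut u≢y)
  differ u≢x u≢y e = pr _ _ (subst₂ _~_ (≡-sym (punchIn-punchOut u≢x)) (≡-sym (punchIn-punchOut u≢y)) e)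
  proper′ : ∀ x y → adj G x y ≡ true → col′ x ≢ col′ y
  proper′ x y e with u ≟ x | u ≟ y
  ... | yes refl | yes refl = λ _ → ~⇒≢ e refl
  ... | yes refl | no u≢y   = differ u≢v u≢y (~-sym (dom y (~-sym e)))
  ... | no u≢x   | yes refl = differ u≢x u≢v (dom x e)
  ... | no u≢x   | no u≢y   = differ u≢x u≢y e

module _ (k : ℕ) (Ps : List Pat) (ss : List Step) (ok : T (stepsOK k Ps ss)) (Q : List ℕ) (Q∈ : True (_∈?_ (≡-dec ℕ._≟_) Q (map Step.graph ss)))
  (start : ∀ {N} (G : Graph (Fin N)) → All (Avoids G) Ps → Colourable G k ⊎ ∃ (Semantics.Sat G (pat Q))) where

  -- Induction on the number of vertices. The entry point `Q` is a graph of the list that is present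
  -- unless a colouring is already known; `start` has to serve all sizes, because the induction
  -- descends to smaller graphs, where `Q` may have disappeared.
  certified : ∀ {N} (G : Graph (Fin N)) → All (Avoids G) Ps → Colourable G k
  certified {zero}  G av = (λ ()) , λ ()
  certified {suc N} G av with start G av
  ... | inj₁ c        = c
  ... | inj₂ (xs , s) = All.lookup (All.map⁺ (steps-sound zero ss (All.map (λ a ys t → ⊥-elim (a ys t)) av) ok)) (toWitness Q∈) xs s
    where
    open Soundness G k (λ u v uv u≢v dom → extend-colouring G u v uv u≢v dom
      (certified (restrict G (punchIn u)) (All.map (restrict-avoids G (punchIn u) (punchIn-injective u _ _)) av)))

-- Forbidden substructures

module _ (G : Graph (Fin N)) where

  open Semantics G

  _≁_ : Fin N → Fin N → Set
  x ≁ y = adj G x y ≡ false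

  Clique : List (Fin N) → Set
  Clique = AllPairs _~_

  -- Disjointness of the two edges is implied: a common endpoint of both would be adjacent to the
  -- other end of one of them.
  Apart : Fin N × Fin N → Fin N × Fin N → Set
  Apart (u , v) (a , b) = u ≁ a × u ≁ b × v ≁ a × v ≁ b

  Matching : List (Fin N × Fin N) → Set
  Matching []             = ⊤
  Matching ((u , v) ∷ es) = u ~ v × All (Apart (u , v)) es × Matching es

  -- Lists instead of functions on `Fin m` let an argument prepend a vertex or an edge. A
  -- near-clique is the complete graph on m + 2 vertices minus one edge: the diamond for m = 2, K5-e
  -- for m = 3.
  NoClique NoMatching NoNearClique : ℕ → Set
  NoClique m     = ∀ xs → length xs ≡ m → ¬ Clique xs
  NoMatching p   = ∀ es → length es ≡ p → ¬ Matching es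
  NoNearClique m = ∀ a b ys → length ys ≡ m → Clique ys → All (a ~_) ys → All (b ~_) ys → a ≢ b → a ≁ b → ⊥

  NoClique-suc : NoClique m → NoClique (suc m)
  NoClique-suc none (x ∷ xs) e (_ ∷ cl) = none xs (ℕₚ.suc-injective e) cl

  NoClique⇒NoNearClique : NoClique (suc m) → NoNearClique m
  NoClique⇒NoNearClique none a b ys e cl a~ b~ _ _ = none (a ∷ ys) (cong suc e) (a~ ∷ cl)

  clique-∈ : ∀ {xs x y} → Clique xs → x ∈ xs → y ∈ xs → x ≢ y → x ~ y
  clique-∈ (x~ ∷ cl) (here refl) (here refl) x≢y = ⊥-elim (x≢y refl)
  clique-∈ (x~ ∷ cl) (here refl) (there y∈)  x≢y = All.lookup x~ y∈
  clique-∈ (x~ ∷ cl) (there x∈)  (here refl) x≢y = ~-sym (All.lookup x~ x∈)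
  clique-∈ (x~ ∷ cl) (there x∈)  (there y∈)  x≢y = clique-∈ cl x∈ y∈ x≢y

search : ∀ {N} m (P : List (Fin N) → Set) → (∀ xs → Dec (P xs)) → Dec (∃ λ xs → length xs ≡ m × P xs)
search zero P P? with P? []
... | yes p = yes ([] , refl , p)
... | no ¬p = no λ { ([] , _ , p) → ¬p p }
search (suc m) P P? with any? (λ x → search m (λ xs → P (x ∷ xs)) (λ xs → P? (x ∷ xs)))
... | yes (x , xs , e , p) = yes (x ∷ xs , cong suc e , p)
... | no none              = no λ { (x ∷ xs , e , p) → none (x , xs , ℕₚ.suc-injective e , p) }

clique-or-not : (G : Graph (Fin N)) → ∀ m → (∃ λ xs → length xs ≡ m × Clique G xs) ⊎ NoClique G m
clique-or-not G m with search m (Clique G) (allPairs? λ x y → adj G x y ≟ᵇ true)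
... | yes c = inj₁ c
... | no no-c = inj₂ λ xs e cl → no-c (xs , e , cl)

cliquePat : ℕ → Pat
cliquePat zero    = []
cliquePat (suc m) = replicate m I ∷ cliquePat m

nearCliquePat : ℕ → Pat
nearCliquePat m = (O ∷ replicate m I) ∷ replicate m I ∷ cliquePat m

matchingPat : ℕ → Pat
matchingPat zero    = []
matchingPat (suc p) = (I ∷ replicate (p + p) O) ∷ replicate (p + p) O ∷ matchingPat p

module _ (G : Graph (Fin N)) where

  open Semantics G

  full-row : ∀ m {x} ys → length ys ≡ m → RowSat (replicate m I) x ys → All (x ~_) ys
  full-row zero    []       e _        = []
  full-row (suc m) (y ∷ ys) e (l , rs) = l ∷ full-row m ys (ℕₚ.suc-injective e) rs

  row-full : ∀ {x} ys → All (x ~_) ys → RowSat (replicate (length ys) I) x ys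
  row-full []       []       = tt
  row-full (y ∷ ys) (l ∷ ls) = l , row-full ys ls

  Sat⇒clique : ∀ m xs → Sat (cliquePat m) xs → length xs ≡ m × Clique G xs
  Sat⇒clique zero    []       _        = refl , []
  Sat⇒clique (suc m) (x ∷ xs) (rs , s) with Sat⇒clique m xs s
  ... | e , cl = cong suc e , full-row m xs e rs ∷ cl

  clique⇒Sat : ∀ xs → Clique G xs → Sat (cliquePat (length xs)) xs
  clique⇒Sat []       []        = tt
  clique⇒Sat (x ∷ xs) (x~ ∷ cl) = row-full xs x~ , clique⇒Sat xs cl

  avoids-clique : NoClique G m → Avoids G (cliquePat m)
  avoids-clique {m} none xs s with Sat⇒clique m xs s
  ... | e , cl = none xs e cl

  avoids-nearClique : NoNearClique G m → Avoids G (nearCliquePat m)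
  avoids-nearClique {m} none (a ∷ []) (() , _)
  avoids-nearClique {m} none (a ∷ b ∷ ys) (((a≁b , a≢b) , ra) , rb , s) with Sat⇒clique m ys s
  ... | e , cl = none a b ys e cl (full-row m ys e ra) (full-row m ys e rb) a≢b a≁b

  pairUp : List (Fin N) → List (Fin N × Fin N)
  pairUp (u ∷ v ∷ xs) = (u , v) ∷ pairUp xs
  pairUp _            = []

  apart-rows : ∀ p {u v} xs → RowSat (replicate (p + p) O) u xs → RowSat (replicate (p + p) O) v xs →
               length (pairUp xs) ≡ p → All (Apart G (u , v)) (pairUp xs)
  apart-rows p       []           _  _  _ = []
  apart-rows p       (a ∷ [])     _  _  _ = []
  apart-rows (suc p) (a ∷ b ∷ xs) ru rv e rewrite ℕₚ.+-suc p p with ru | rv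
  ... | (ua , _) , (ub , _) , ru′ | (va , _) , (vb , _) , rv′ =
    (ua , ub , va , vb) ∷ apart-rows p xs ru′ rv′ (ℕₚ.suc-injective e)

  Sat⇒matching : ∀ p xs → Sat (matchingPat p) xs → length (pairUp xs) ≡ p × Matching G (pairUp xs)
  Sat⇒matching zero    []           _ = refl , tt
  Sat⇒matching (suc p) (u ∷ [])     (() , _)
  Sat⇒matching (suc p) (u ∷ v ∷ xs) ((uv , ru) , rv , s) with Sat⇒matching p xs s
  ... | e , mt = cong suc e , uv , apart-rows p xs ru rv e , mt

  avoids-matching : NoMatching G p → Avoids G (matchingPat p)
  avoids-matching {p} none xs s with Sat⇒matching p xs s
  ... | e , mt = none _ e mt

-- The certificates

paint : ℕ → Tree
paint c = leaf (col 0 c)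

plain : List ℕ → List Label
plain = map (col 0)

-- In the codes 0 and 1 stand for 2K2 and K4, and the graphs of the list are numbered from 2. The
-- list ends with the triangle, the edge and the empty pattern, which occurs in every graph: a graph
-- without an edge needs one colour, a graph with an edge but no earlier graph is coloured around
-- that edge, and so on upwards.
2K2-K4-certificate : List Step
2K2-K4-certificate =
  step (64 ∷ 3 ∷ 22 ∷ 13 ∷ 3 ∷ 3 ∷ 1 ∷ 0 ∷ [])
    (0x815000 ∷ 0x321000 ∷ 0x421000 ∷ 0x761000 ∷ 0x754001 ∷ 0x653001 ∷ 0x862000 ∷ 0x872000 ∷ 0x765001 ∷ [])
        (dominated 4 7 (br 0 dead (br 1 (br 2 dead (br 3 dead (br 5 (br 6 dead dead) dead))) (br 5 dead (br 6 dead
      dead))))) ∷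
  step (0 ∷ 19 ∷ 10 ∷ 6 ∷ 3 ∷ 1 ∷ 0 ∷ [])
    (0x321000 ∷ 0x421000 ∷ 0x721000 ∷ 0x651000 ∷ 0x764001 ∷ 0x753001 ∷ [])
    (dominated 0 1 (br 2 dead (br 3 dead (br 6 dead (br 4 (br 5 dead dead) dead))))) ∷
  step (0 ∷ 3 ∷ 10 ∷ 6 ∷ 3 ∷ 1 ∷ 0 ∷ [])
    (0x321000 ∷ 0x421000 ∷ 0x651000 ∷ 0x751000 ∷ 0x764001 ∷ 0x761000 ∷ 0x657432102 ∷ 0x753001 ∷ [])
    (dominated 0 1 (br 2 dead (br 3 dead (br 4 (br 5 dead (br 6 dead dead)) (br 6 (br 5 dead dead) dead))))) ∷
  step (48 ∷ 56 ∷ 15 ∷ 11 ∷ 6 ∷ 2 ∷ 1 ∷ 0 ∷ [])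
    (0x543001 ∷ 0x823000 ∷ 0x542000 ∷ 0x543802104 ∷ 0x453802104 ∷ 0x841000 ∷ 0x851000 ∷ [])
    (dominated 2 7 (br 1 dead (br 0 (br 3 (br 4 dead dead) (br 4 dead dead)) (br 3 dead (br 4 dead dead))))) ∷
  step (18 ∷ 56 ∷ 25 ∷ 7 ∷ 7 ∷ 2 ∷ 1 ∷ 0 ∷ [])
    (0x542000 ∷ 0x312000 ∷ 0x653000 ∷ 0x758420104 ∷ 0x862001 ∷ 0x743001 ∷ 0x751000 ∷ 0x851000 ∷ 0x872001 ∷ [])
        (dominated 1 4 (br 3 dead (br 0 (br 2 dead (br 5 dead (br 6 (br 7 dead dead) dead))) (br 6 dead (br 7 dead
      dead))))) ∷
  step (36 ∷ 26 ∷ 26 ∷ 9 ∷ 5 ∷ 3 ∷ 1 ∷ 0 ∷ [])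
    (0x831000 ∷ 0x851000 ∷ 0x861000 ∷ 0x423000 ∷ 0x725000 ∷ 0x743581205 ∷ 0x6708532105 ∷ 0x762001 ∷ [])
    (dominated 0 7 (br 2 dead (br 4 dead (br 5 dead (br 1 (br 3 dead (br 6 dead dead)) (br 6 dead dead)))))) ∷
  step (3 ∷ 14 ∷ 11 ∷ 6 ∷ 3 ∷ 1 ∷ 0 ∷ [])
        (0x4765321002 ∷ 0x316000 ∷ 0x623000 ∷ 0x4637520106 ∷ 0x217000 ∷ 0x732000 ∷ 0x4726530106 ∷ 0x4327650105 ∷
      0x743001 ∷ 0x642001 ∷ 0x651000 ∷ 0x751000 ∷ 0x764001 ∷ [])
        (dominated 3 4 (br 0 (br 1 (br 6 (br 2 (br 5 dead dead) (br 5 dead dead)) dead) (br 5 (br 2 (br 6 dead dead)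
      (br 6 dead dead)) dead)) (br 5 dead (br 6 dead dead)))) ∷
  step (9 ∷ 24 ∷ 14 ∷ 7 ∷ 2 ∷ 1 ∷ 0 ∷ [])
    (0x213000 ∷ 0x542000 ∷ 0x7536240107 ∷ 0x7653024106 ∷ 0x753001 ∷ 0x641000 ∷ 0x741000 ∷ 0x763001 ∷ [])
    (dominated 2 3 (br 0 (br 1 dead (br 4 dead (br 6 (br 5 dead dead) dead))) (br 5 dead (br 6 dead dead)))) ∷
  step (24 ∷ 12 ∷ 11 ∷ 6 ∷ 2 ∷ 1 ∷ 0 ∷ [])
        (0x524000 ∷ 0x764001 ∷ 0x431000 ∷ 0x731000 ∷ 0x7504631207 ∷ 0x623000 ∷ 0x741000 ∷ 0x7603541207 ∷ 0x753001 ∷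
      0x654371205 ∷ [])
        (dominated 0 1 (br 2 (br 3 dead (br 4 dead (br 6 dead (br 5 dead dead)))) (br 5 dead (br 3 (br 6 dead (br 4
      dead dead)) (br 4 dead (br 6 dead dead)))))) ∷
  step (401 ∷ 240 ∷ 124 ∷ 62 ∷ 31 ∷ 5 ∷ 4 ∷ 3 ∷ 0 ∷ 0 ∷ [])
        (0xa71000 ∷ 0xa21000 ∷ 0x764001 ∷ 0x321000 ∷ 0x841000 ∷ 0x731000 ∷ 0xa86000 ∷ 0xb81001 ∷ 0xb81000 ∷ 0x961001 ∷
      0x826000 ∷ 0xa26000 ∷ 0x618000 ∷ 0xa83001 ∷ 0xa84001 ∷ 0xa85001 ∷ 0x632000 ∷ 0x642000 ∷ 0x652000 ∷ 0xa21001 ∷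
      0x763001 ∷ 0x7a6432009 ∷ 0x851000 ∷ 0xb31001 ∷ 0xb91001 ∷ 0x213000 ∷ 0x214000 ∷ 0x215000 ∷ 0x938621003 ∷
      0xa82316004 ∷ 0x7643a9008 ∷ 0x96a000 ∷ 0x706432109 ∷ 0x697431009 ∷ 0xa23801609 ∷ 0x697531009 ∷ 0xa79000 ∷
      0x921001 ∷ 0x1a620430a ∷ 0x741000 ∷ 0x751000 ∷ 0x917000 ∷ 0xa82001 ∷ 0x982001 ∷ 0x765001 ∷ 0x963001 ∷ 0x86432109
      ∷ 0x965001 ∷ 0x986432009 ∷ 0x964001 ∷ 0x986532009 ∷ 0x86542109 ∷ 0x986542009 ∷ 0x86532109 ∷ 0xa72001 ∷
      0xa75386008 ∷ 0xa75486008 ∷ 0x831000 ∷ 0x93182a6005 ∷ 0x941001 ∷ 0x321001 ∷ [])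
        (coloured (plain (2 ∷ 1 ∷ 1 ∷ 1 ∷ 1 ∷ 3 ∷ 2 ∷ 2 ∷ 0 ∷ 0 ∷ [])) (br 0 (br 1 (br 2 (br 3 (br 4 (br 5 (br 7 (br 8
      dead (br 9 dead (br 6 dead (paint 1)))) dead) (br 7 dead (br 9 dead (paint 1)))) dead) dead) dead) (br 5 (br 2
      dead (br 3 dead (br 4 dead (br 6 (br 7 (br 9 (br 8 (paint 0) dead) dead) dead) dead)))) (br 2 (br 3 (br 4 (br 6
      (br 9 dead (br 7 (paint 2) dead)) (br 8 dead (br 7 (br 9 dead dead) dead))) (br 6 (br 8 (br 7 dead (br 9 dead
      dead)) dead) dead)) (br 6 (br 8 (br 4 (br 7 dead (br 9 dead dead)) (br 7 (paint 2) dead)) dead) dead)) (br 6 (br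
      8 (br 3 (br 4 (br 7 dead (br 9 dead dead)) (br 7 (paint 2) dead)) (br 7 (br 9 dead (paint 2)) dead)) dead)
      dead)))) (br 1 (br 5 (br 8 (br 9 (br 2 (br 6 dead (br 3 dead (br 4 dead (br 7 dead (paint 0))))) (br 7 dead
      (paint 0))) dead) (paint 3)) (br 7 dead (br 8 (br 9 dead (br 2 (br 3 (br 4 (br 6 dead (paint 1)) dead) dead)
      dead)) dead))) (br 8 (br 9 (br 2 (br 5 dead (br 3 dead (br 6 dead dead))) (br 3 (br 5 dead (br 6 dead dead)) (br
      4 (br 5 dead (br 6 dead dead)) (br 5 (paint 0) (br 6 (br 7 dead (paint 0)) dead))))) dead) dead)))) ∷
  step (396 ∷ 122 ∷ 124 ∷ 46 ∷ 31 ∷ 12 ∷ 6 ∷ 3 ∷ 0 ∷ 0 ∷ [])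
        (0x513000 ∷ 0x423000 ∷ 0x621000 ∷ 0x954000 ∷ 0x963001 ∷ 0xa52000 ∷ 0x5976a2008 ∷ 0xa9542876100b ∷ 0xa83001 ∷
      0xa73001 ∷ 0xa63001 ∷ 0xa41001 ∷ [])
        (dominated 2 4 (br 0 dead (br 1 (br 3 dead (br 5 dead (br 8 dead dead))) (br 9 dead (br 3 (br 5 (br 6 (br 7
      (br 8 dead dead) dead) dead) dead) dead))))) ∷
  step (31 ∷ 30 ∷ 23 ∷ 12 ∷ 6 ∷ 3 ∷ 1 ∷ 0 ∷ [])
        (0x531000 ∷ 0x831000 ∷ 0x621001 ∷ 0x631000 ∷ 0x941001 ∷ 0x631001 ∷ 0x321000 ∷ 0x531001 ∷ 0x521001 ∷ 0x831001 ∷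
      0x871000 ∷ 0x321001 ∷ 0x731000 ∷ 0x421000 ∷ 0x981000 ∷ 0x721001 ∷ 0x421001 ∷ 0x731001 ∷ 0x723000 ∷ 0x218000 ∷
      0x832000 ∷ 0x835471008 ∷ 0x874001 ∷ 0x521000 ∷ 0x621000 ∷ 0x951000 ∷ 0x721000 ∷ 0x84765139200c ∷ 0x48765129300c
      ∷ 0x39824765010b ∷ 0x34289765010b ∷ 0x93842765100b ∷ 0x92765084310c ∷ 0x82765093410c ∷ 0x830657109 ∷ 0x830756109
      ∷ 0x876532008 ∷ 0x431001 ∷ 0x317000 ∷ 0x487321003 ∷ 0x752001 ∷ 0x587321003 ∷ 0x853001 ∷ 0x742001 ∷ 0x843001 ∷
      0x315482008 ∷ 0x316482008 ∷ 0x316582008 ∷ 0x876432008 ∷ 0x875432008 ∷ 0x762001 ∷ 0x863001 ∷ 0x725481008 ∷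
      0x876001 ∷ 0x836471008 ∷ 0x875001 ∷ 0x836571008 ∷ 0x831765009 ∷ 0x92483765100b ∷ 0x981001 ∷ [])
        (coloured (plain (1 ∷ 2 ∷ 2 ∷ 0 ∷ 0 ∷ 0 ∷ 1 ∷ 3 ∷ [])) (br 0 (br 2 (br 6 (br 1 (br 7 (br 3 dead (br 4 dead
      (paint 1))) dead) (br 7 dead (br 3 (br 4 dead (br 5 dead (paint 1))) (br 4 (br 5 dead (paint 1)) (paint 1)))))
      dead) (br 1 (br 6 dead (br 7 (br 3 (paint 3) (br 4 (paint 3) (br 5 (paint 3) (paint 3)))) dead)) (br 3 (br 4 (br
      7 (br 6 dead (br 5 (paint 3) dead)) (br 5 (br 6 (paint 0) (paint 0)) dead)) (br 6 (br 7 (br 5 dead (paint 1))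
      dead) dead)) (br 6 (br 7 (br 4 (br 5 dead (paint 1)) (paint 1)) dead) dead)))) (br 1 (br 2 (br 3 (br 4 (br 5 (br
      6 (br 7 dead dead) (br 7 dead (paint 2))) (br 6 (paint 2) (br 7 dead dead))) (br 5 (br 6 (paint 2) (br 7 dead
      dead)) (br 6 (br 7 dead (paint 2)) (paint 2)))) (br 4 (br 5 (br 6 (paint 2) (br 7 dead dead)) (br 6 (paint 2)
      (paint 2))) (br 5 (br 6 (paint 2) (paint 2)) (br 6 (br 7 dead (paint 2)) (br 7 (paint 2) dead))))) (br 3 (br 4
      (br 5 (br 6 dead (br 7 (paint 3) (paint 0))) dead) dead) dead)) (br 3 (br 4 (br 5 (br 2 (br 7 dead (br 6 (paint
      0) (paint 0))) (br 6 (br 7 dead (paint 0)) (br 7 (paint 0) (paint 0)))) dead) dead) dead)))) ∷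
  step (195 ∷ 46 ∷ 57 ∷ 19 ∷ 14 ∷ 7 ∷ 3 ∷ 0 ∷ 0 ∷ [])
        (0x931000 ∷ 0x751000 ∷ 0x531000 ∷ 0x921000 ∷ 0x931001 ∷ 0x981001 ∷ 0x871001 ∷ 0x732000 ∷ 0x316000 ∷ 0x315000 ∷
      0x972000 ∷ 0x421000 ∷ 0xa81001 ∷ 0x932000 ∷ 0x427000 ∷ 0x831001 ∷ 0x523000 ∷ 0x623000 ∷ 0x852001 ∷ 0x862001 ∷
      0x541000 ∷ 0x642001 ∷ 0x321000 ∷ 0x651000 ∷ 0x631000 ∷ 0xa41001 ∷ 0xa51001 ∷ 0x531001 ∷ 0x861001 ∷ 0x761000 ∷
      0x875321003 ∷ 0x874000 ∷ 0x95173200a ∷ 0x935701209 ∷ 0x954001 ∷ 0x814000 ∷ 0x217000 ∷ 0x402653109 ∷ 0x821001 ∷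
      0x492653009 ∷ 0x973001 ∷ 0x72653109 ∷ 0x786592008 ∷ 0x873001 ∷ 0x875001 ∷ 0x975001 ∷ 0x973512004 ∷ 0x876001 ∷
      0x943001 ∷ 0x829000 ∷ 0x826574008 ∷ 0x641000 ∷ 0x542001 ∷ 0x38410650a ∷ 0x793084208 ∷ 0x29a10760a ∷ 0x421001 ∷
      [])
        (coloured (plain (2 ∷ 0 ∷ 1 ∷ 2 ∷ 1 ∷ 1 ∷ 0 ∷ 3 ∷ 3 ∷ [])) (br 0 (br 3 (br 1 (br 6 (br 2 (br 4 (br 5 (br 7
      dead (paint 0)) dead) dead) (br 4 dead (br 5 dead (br 8 (paint 0) dead)))) dead) (br 2 (br 4 (br 5 (br 6 dead
      (br 8 dead (br 7 (paint 2) (paint 1)))) dead) dead) (br 4 (br 5 (br 8 dead (br 6 (br 7 dead (paint 2)) dead))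
      (br 7 (paint 2) dead)) (br 7 (br 5 (paint 2) (br 6 (br 8 dead (paint 2)) dead)) dead)))) (br 7 dead (br 1 (br 6
      (br 2 (br 4 (br 5 (br 8 dead (paint 1)) dead) dead) (br 4 dead (br 5 dead dead))) dead) (br 4 (br 5 (br 2 (br 6
      dead (paint 1)) (br 6 (br 8 dead dead) dead)) dead) dead)))) (br 6 (br 4 dead (br 5 dead (br 1 (br 2 (br 8 dead
      (br 3 (paint 0) dead)) (br 7 (br 3 (paint 0) dead) dead)) (br 2 dead (br 8 dead dead))))) (br 2 (br 1 (br 3 dead
      (br 7 (br 8 (br 4 (br 5 dead (paint 3)) (br 5 (paint 3) (paint 3))) dead) (br 4 (br 5 (br 8 (paint 1) dead)
      dead) dead))) (br 7 (br 8 dead (br 4 (br 3 dead (br 5 (paint 1) dead)) dead)) dead)) (br 7 (br 8 (br 1 (paint 3)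
      (br 3 (br 4 dead (br 5 dead (paint 3))) (br 4 (br 5 dead dead) dead))) dead) dead))))) ∷
  step (195 ∷ 46 ∷ 45 ∷ 13 ∷ 11 ∷ 6 ∷ 3 ∷ 1 ∷ 0 ∷ [])
        (0x981001 ∷ 0x541000 ∷ 0x842001 ∷ 0x862001 ∷ 0x421000 ∷ 0x321000 ∷ 0xa91001 ∷ 0x841001 ∷ 0x217000 ∷ 0x914000 ∷
      0x972000 ∷ 0x732000 ∷ 0x932000 ∷ 0x523000 ∷ 0x743001 ∷ 0x741000 ∷ 0x651000 ∷ 0x851000 ∷ 0x931000 ∷ 0x315000 ∷
      0x815000 ∷ 0x475321004 ∷ 0x754032108 ∷ 0x986001 ∷ 0x453702109 ∷ 0x746000 ∷ 0x987001 ∷ 0x43275100a ∷ 0x973001 ∷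
      0x6928135006 ∷ 0x34179200a ∷ 0x874001 ∷ 0x739051208 ∷ 0x964000 ∷ 0x978536400d ∷ 0x821001 ∷ 0x975001 ∷
      0x978506420d ∷ 0x931001 ∷ 0x7698543200e ∷ 0x9478563200e ∷ 0x963001 ∷ 0x861001 ∷ [])
        (coloured (plain (0 ∷ 3 ∷ 2 ∷ 1 ∷ 2 ∷ 0 ∷ 0 ∷ 2 ∷ 1 ∷ [])) (br 0 (br 4 (br 2 (br 7 (paint 2) (br 1 (br 6 (br 3
      dead (br 8 dead (br 5 (paint 0) dead))) dead) (br 3 (br 5 (br 6 dead (br 8 dead dead)) dead) dead))) (br 1 dead
      (br 3 (br 6 dead (br 8 (br 5 (br 7 dead (paint 1)) (br 7 dead dead)) dead)) (br 6 (br 7 (br 8 dead (br 5 dead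
      dead)) dead) dead)))) (br 2 dead (br 7 dead (br 1 (br 6 (br 3 (br 5 (paint 0) dead) dead) dead) (br 3 (br 5 (br
      6 (br 8 dead (paint 0)) dead) dead) dead))))) (br 1 (br 7 (paint 3) (br 8 (br 2 (br 3 (br 4 dead (br 6 dead
      (paint 1))) (br 6 dead dead)) (br 4 dead (br 6 (br 3 dead (br 5 dead dead)) dead))) dead)) (br 7 (br 2 (br 6
      dead (br 8 dead (br 4 (br 3 dead (br 5 dead dead)) dead))) (br 8 (br 6 dead (br 3 (br 4 dead (paint 1)) dead))
      dead)) dead)))) ∷
  step (30 ∷ 51 ∷ 14 ∷ 11 ∷ 6 ∷ 3 ∷ 1 ∷ 0 ∷ [])
        (0x872001 ∷ 0x371652009 ∷ 0x871000 ∷ 0x512000 ∷ 0x846571008 ∷ 0x8674532100f ∷ 0x7683542100f ∷ 0x7486532100e ∷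
      0x641001 ∷ 0x8376542100e ∷ 0x842001 ∷ 0x732001 ∷ 0x631001 ∷ [])
        (dominated 1 4 (br 0 dead (br 2 (br 3 (br 5 (br 6 dead (br 7 dead dead)) (br 6 (br 7 dead dead) (br 7 dead
      dead))) (br 5 (br 6 dead (br 7 dead dead)) dead)) (br 5 (br 6 (br 7 dead (br 3 dead dead)) dead) dead)))) ∷
  step (105 ∷ 56 ∷ 30 ∷ 15 ∷ 6 ∷ 3 ∷ 0 ∷ 0 ∷ [])
        (0x542000 ∷ 0x213000 ∷ 0x468752008 ∷ 0x3687520110 ∷ 0x853001 ∷ 0x753001 ∷ 0x641000 ∷ 0x458761008 ∷
      0x3587610210 ∷ 0x368705210d ∷ 0x863001 ∷ 0x763001 ∷ [])
        (dominated 2 3 (br 0 (br 1 dead (br 4 dead (br 6 (br 7 (br 5 dead dead) dead) dead))) (br 5 dead (br 6 (br 7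
      (br 1 (br 4 dead dead) (br 4 dead dead)) dead) dead)))) ∷
  step (43 ∷ 26 ∷ 22 ∷ 11 ∷ 6 ∷ 3 ∷ 1 ∷ 0 ∷ [])
        (0x641000 ∷ 0x321000 ∷ 0x821000 ∷ 0x981001 ∷ 0x831000 ∷ 0x941001 ∷ 0x532000 ∷ 0x832000 ∷ 0x875001 ∷ 0x852000 ∷
      0x876001 ∷ 0x861000 ∷ 0x762001 ∷ 0x751001 ∷ 0x314000 ∷ 0x54183200a ∷ 0x63284100a ∷ 0x423000 ∷ 0x835041208 ∷
      0x6780354120f ∷ 0x721001 ∷ 0x531001 ∷ 0x846032108 ∷ 0x5780463210f ∷ 0x854001 ∷ 0x841000 ∷ 0x8670524110 ∷
      0x863001 ∷ 0x951001 ∷ [])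
        (coloured (plain (0 ∷ 2 ∷ 2 ∷ 3 ∷ 1 ∷ 1 ∷ 3 ∷ 0 ∷ [])) (br 0 (br 1 (paint 0) (br 6 (paint 3) (br 5 (br 2 (br 3
      (br 4 dead (br 7 dead dead)) dead) (br 3 (br 7 dead (br 4 (paint 1) dead)) (br 7 (br 4 dead dead) dead)))
      dead))) (br 1 (br 6 (paint 2) (br 4 (br 2 (br 3 (br 5 dead (br 7 dead dead)) (br 7 dead (br 5 (paint 1) dead)))
      (br 3 dead (br 7 (br 5 dead dead) dead))) dead)) (br 6 (br 2 (br 4 dead (br 7 dead (br 3 (br 5 dead dead)
      dead))) (br 4 (br 7 dead (br 5 (br 3 dead (paint 1)) dead)) dead)) dead)))) ∷
  step (28 ∷ 54 ∷ 29 ∷ 12 ∷ 7 ∷ 3 ∷ 0 ∷ 0 ∷ [])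
        (0x721000 ∷ 0x531000 ∷ 0x841000 ∷ 0x941000 ∷ 0x871000 ∷ 0x435000 ∷ 0x743001 ∷ 0x513000 ∷ 0x654000 ∷ 0x621000 ∷
      0x741000 ∷ 0x761000 ∷ 0x426000 ∷ 0x651001 ∷ 0x765001 ∷ 0x742001 ∷ 0x852001 ∷ 0x842001 ∷ 0x632000 ∷ 0x521000 ∷
      0x631000 ∷ 0x831000 ∷ 0x961001 ∷ 0x861001 ∷ 0x721001 ∷ 0x851000 ∷ 0x951000 ∷ 0x821000 ∷ 0x763542003 ∷
      0x863542003 ∷ 0x5087641310 ∷ 0x248753008 ∷ 0x6087541210 ∷ 0x638754008 ∷ 0x523000 ∷ 0x612000 ∷ 0x528764008 ∷
      0x6587320410 ∷ 0x638705420d ∷ 0x8764305211 ∷ 0x865001 ∷ 0x208746108 ∷ 0x752001 ∷ 0x843001 ∷ 0x6387540210 ∷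
      0x731000 ∷ 0x8762503411 ∷ 0x763001 ∷ 0x8732406511 ∷ 0x863001 ∷ 0x4638720510e ∷ [])
        (coloured (plain (3 ∷ 2 ∷ 3 ∷ 0 ∷ 0 ∷ 2 ∷ 1 ∷ 1 ∷ [])) (br 0 (br 1 (br 3 (br 5 (br 2 (br 4 (br 6 dead (br 7
      dead (paint 2))) dead) (br 4 dead (br 6 (br 7 dead (paint 2)) (paint 2)))) dead) (br 2 (br 5 (br 4 dead (br 6
      (br 7 dead (paint 2)) (paint 2))) (br 4 (br 6 (br 7 dead (paint 3)) (br 7 (paint 3) dead)) (br 6 (br 7 (paint 3)
      dead) dead))) (br 4 dead (br 6 (br 7 (br 5 (paint 1) dead) dead) dead)))) (br 5 dead (br 2 (br 3 (br 4 (br 6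
      (paint 3) (br 7 (paint 3) dead)) dead) (br 6 (br 7 (paint 3) dead) dead)) (br 4 dead (br 6 (br 7 (br 3 dead
      dead) dead) dead))))) (br 1 (br 6 dead (br 7 dead (br 2 (br 3 (br 4 (br 5 (paint 2) dead) dead) (br 4 (br 5 dead
      dead) (br 5 dead dead))) (br 3 (br 4 dead (paint 2)) dead)))) (br 4 (br 2 (br 5 dead (br 6 dead (br 3 (br 7 dead
      dead) dead))) (br 3 (br 5 (br 6 (paint 0) (br 7 (paint 0) dead)) (br 6 (br 7 (paint 0) dead) dead)) (br 5 dead
      (br 6 (br 7 dead dead) dead)))) (br 5 (br 2 dead (br 6 (br 7 (paint 1) dead) dead)) dead))))) ∷
  step (71 ∷ 44 ∷ 28 ∷ 14 ∷ 7 ∷ 1 ∷ 1 ∷ 0 ∷ [])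
        (0x761000 ∷ 0x631000 ∷ 0x741000 ∷ 0x751000 ∷ 0x941000 ∷ 0x321000 ∷ 0x921000 ∷ 0x921001 ∷ 0x732000 ∷ 0x764001 ∷
      0x742000 ∷ 0x763001 ∷ 0x651000 ∷ 0x2831540a ∷ 0x6097382112 ∷ 0x8961703212 ∷ 0x821001 ∷ 0x852001 ∷ 0x874001 ∷
      0x672503109 ∷ 0x104386508 ∷ 0x652001 ∷ 0x7580326110 ∷ 0x873001 ∷ 0x7152430a ∷ 0x63275100a ∷ 0x8670435211 ∷
      0x875001 ∷ 0x765001 ∷ 0x784361008 ∷ 0x524000 ∷ 0x841001 ∷ 0x523000 ∷ 0x831001 ∷ 0x7854602112 ∷ 0x7486351012 ∷
      0x7853602112 ∷ 0x7386451012 ∷ 0x71435209 ∷ 0x6874305120e ∷ 0x18260540a ∷ 0x951000 ∷ 0x321001 ∷ 0x8905137240f ∷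
      0x8904137250f ∷ [])
        (coloured (plain (0 ∷ 2 ∷ 2 ∷ 2 ∷ 3 ∷ 1 ∷ 0 ∷ 1 ∷ [])) (br 0 (br 1 (paint 0) (br 7 (paint 1) (br 4 (br 2 (br 6
      dead (br 3 (br 5 (paint 3) dead) dead)) (br 6 (br 3 dead (br 5 dead dead)) dead)) dead))) (br 1 (br 2 (br 3 (br
      4 (br 5 dead (br 6 dead (br 7 (paint 2) (paint 2)))) (br 5 (br 6 dead (br 7 (paint 2) dead)) (br 6 (br 7 dead
      (paint 2)) dead))) (br 4 dead (br 7 (br 5 (br 6 dead dead) (br 6 dead dead)) dead))) (br 4 dead (br 7 (br 3 (br
      5 (br 6 dead dead) (br 6 dead dead)) (br 6 (br 5 dead dead) dead)) dead))) (br 7 (br 2 (br 6 dead (br 3 (br 4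
      (paint 3) dead) (br 5 (paint 3) dead))) (br 3 (br 6 dead (br 5 (paint 3) dead)) (br 4 (br 5 dead dead) (br 5 (br
      6 dead dead) dead)))) dead)))) ∷
  step (27 ∷ 52 ∷ 28 ∷ 15 ∷ 3 ∷ 2 ∷ 1 ∷ 0 ∷ [])
        (0x631001 ∷ 0x621000 ∷ 0x741001 ∷ 0x831000 ∷ 0x741000 ∷ 0x841000 ∷ 0x543000 ∷ 0x871000 ∷ 0x632000 ∷ 0x518000 ∷
      0x873001 ∷ 0x754001 ∷ 0x617000 ∷ 0x835000 ∷ 0x314000 ∷ 0x631000 ∷ 0x761001 ∷ 0x6147802314 ∷ 0x941000 ∷ 0x761000
      ∷ 0x7905631840f ∷ 0x981000 ∷ 0x214000 ∷ 0x523000 ∷ 0x8546037120e ∷ 0x872001 ∷ 0x7645028130e ∷ 0x864001 ∷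
      0x8643705112 ∷ 0x7542806112 ∷ 0x521001 ∷ 0x726000 ∷ 0x876402109 ∷ 0x752001 ∷ 0x642000 ∷ 0x654001 ∷ 0x874001 ∷
      0x4576802112 ∷ 0x478062108 ∷ 0x487053108 ∷ 0x981001 ∷ [])
        (coloured (plain (3 ∷ 2 ∷ 2 ∷ 2 ∷ 0 ∷ 1 ∷ 1 ∷ 0 ∷ [])) (br 0 (br 1 (br 3 (br 4 (br 2 (br 7 (paint 0) dead)
      dead) (br 5 (br 6 (paint 1) dead) (br 6 dead (br 7 (br 2 dead (paint 3)) dead)))) dead) (br 4 (br 7 (br 2 (br 3
      (br 5 dead (paint 0)) dead) (br 3 dead (br 5 (br 6 (paint 0) dead) (br 6 (paint 3) dead)))) dead) (br 6 (br 2
      (br 3 (br 5 dead (br 7 dead (paint 3))) dead) (br 3 (br 5 dead (paint 3)) (br 5 (br 7 (paint 3) dead) dead)))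
      dead))) (br 1 (br 2 (br 3 (br 6 dead (br 7 dead (paint 2))) (br 6 (paint 1) (br 4 (br 7 (br 5 (paint 0) dead)
      dead) dead))) (br 4 dead (br 5 (br 3 (br 6 dead (br 7 dead dead)) (br 6 (br 7 dead dead) dead)) dead))) (br 4
      (br 2 (br 5 dead (br 3 (br 6 dead (br 7 dead dead)) (br 7 (br 6 dead dead) dead))) (br 3 dead (br 5 (br 6 (br 7
      dead dead) (br 7 dead dead)) dead))) dead)))) ∷
  step (51 ∷ 42 ∷ 26 ∷ 13 ∷ 5 ∷ 3 ∷ 1 ∷ 0 ∷ [])
        (0x841000 ∷ 0x851000 ∷ 0x7816243006 ∷ 0x8764251012 ∷ 0x8675341012 ∷ 0x761001 ∷ 0x623000 ∷ 0x5680432112 ∷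
      0x732000 ∷ 0x8746205130f ∷ 0x8520463115 ∷ 0x621001 ∷ [])
        (dominated 0 7 (br 3 dead (br 4 dead (br 1 (br 2 (br 5 (br 6 dead dead) (br 6 dead dead)) (br 5 dead dead))
      (br 5 (br 2 (br 6 dead dead) dead) dead))))) ∷
  step (88 ∷ 53 ∷ 28 ∷ 15 ∷ 6 ∷ 3 ∷ 0 ∷ 0 ∷ [])
        (0x741000 ∷ 0x321000 ∷ 0x543000 ∷ 0x6875431015 ∷ 0x851001 ∷ 0x763001 ∷ 0x642000 ∷ 0x5876421015 ∷ 0x861001 ∷
      0x752001 ∷ 0x732001 ∷ [])
        (dominated 0 3 (br 6 dead (br 1 (br 2 dead (br 4 dead (br 5 (br 7 dead dead) dead))) (br 2 (br 4 (br 5 dead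
      (br 7 dead dead)) dead) dead)))) ∷
  step (42 ∷ 44 ∷ 21 ∷ 7 ∷ 6 ∷ 3 ∷ 1 ∷ 0 ∷ [])
        (0x621000 ∷ 0x751000 ∷ 0x741000 ∷ 0x861000 ∷ 0x971001 ∷ 0x852001 ∷ 0x931000 ∷ 0x824000 ∷ 0x635000 ∷ 0x754001 ∷
      0x764001 ∷ 0x862001 ∷ 0x643001 ∷ 0x516000 ∷ 0x421000 ∷ 0x731000 ∷ 0x8965170316 ∷ 0x8594760115 ∷ 0x971000 ∷
      0x312000 ∷ 0x712000 ∷ 0x826531004 ∷ 0x268053108 ∷ 0x432000 ∷ 0x6584720317 ∷ 0x641000 ∷ 0x742000 ∷ 0x751001 ∷
      0x6780235112 ∷ 0x753000 ∷ 0x8702653116 ∷ 0x523000 ∷ 0x85326100a ∷ 0x875001 ∷ 0x8475360113 ∷ 0x823605109 ∷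
      0x865203109 ∷ 0x863001 ∷ 0x821000 ∷ 0x8195736020f ∷ [])
        (coloured (plain (1 ∷ 0 ∷ 0 ∷ 1 ∷ 3 ∷ 2 ∷ 0 ∷ 1 ∷ [])) (br 0 (br 1 (br 5 (br 2 (br 4 (br 3 (br 7 dead (br 6
      (paint 2) (paint 2))) (br 7 dead (br 6 (paint 3) (paint 2)))) dead) (br 4 dead (br 7 dead (br 6 (br 3 (paint 2)
      dead) dead)))) (br 4 dead (br 2 (br 7 (br 3 (paint 1) dead) dead) (br 3 (br 7 (paint 1) dead) dead)))) (br 2
      dead (br 6 dead (br 3 (br 4 (br 5 (paint 2) dead) (br 7 (br 5 (paint 2) dead) dead)) (br 4 (br 5 (br 7 (paint 2)
      dead) dead) dead))))) (br 1 (br 5 dead (br 7 dead (paint 0))) (br 2 (br 3 dead (br 4 (br 5 (br 7 dead (br 6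
      (paint 3) (paint 3))) (br 6 (br 7 (paint 3) dead) dead)) (br 5 dead (br 6 (br 7 dead dead) dead)))) (br 3 (br 5
      dead (br 6 dead (br 4 (br 7 dead dead) dead))) (br 5 (br 7 dead (br 4 (br 6 dead dead) dead)) dead)))))) ∷
  step (49 ∷ 35 ∷ 14 ∷ 11 ∷ 6 ∷ 3 ∷ 1 ∷ 0 ∷ [])
        (0x531000 ∷ 0x721000 ∷ 0x871000 ∷ 0x841000 ∷ 0x427000 ∷ 0x753001 ∷ 0x752000 ∷ 0x215000 ∷ 0x876001 ∷ 0x851000 ∷
      0x951000 ∷ 0x981001 ∷ 0x841001 ∷ 0x854001 ∷ 0x8605472116 ∷ 0x842001 ∷ 0x734000 ∷ 0x861000 ∷ 0x9764851015 ∷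
      0x985641318 ∷ 0x9058136218 ∷ 0x9716580216 ∷ 0x9176852012 ∷ 0x843000 ∷ 0x9160485218 ∷ 0x641001 ∷ 0x8520374106 ∷
      0x854721004 ∷ 0x6584370213 ∷ 0x762000 ∷ 0x364251716 ∷ 0x714000 ∷ 0x847502109 ∷ 0x87254100a ∷ 0x763001 ∷
      0x548072108 ∷ 0x8647025118 ∷ 0x761001 ∷ 0x703162408 ∷ 0x615000 ∷ 0x852407109 ∷ 0x8730652414 ∷ 0x875001 ∷
      0x6874530218 ∷ 0x5874630218 ∷ 0x864001 ∷ 0x541000 ∷ 0x8470562115 ∷ [])
        (coloured (plain (0 ∷ 2 ∷ 0 ∷ 3 ∷ 1 ∷ 1 ∷ 2 ∷ 0 ∷ [])) (br 0 (br 3 (br 2 (br 4 (br 1 (br 6 (br 5 (br 7 dead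
      (paint 2)) (paint 3)) dead) (br 6 dead (br 7 dead (br 5 (paint 1) dead)))) (br 1 dead (br 5 dead (br 6 (br 7
      (paint 0) dead) (br 7 (paint 0) dead))))) (br 7 dead (br 1 (br 4 (br 6 (br 5 (paint 2) (paint 2)) dead) dead)
      (br 4 (br 6 dead (br 5 dead dead)) (br 6 dead dead))))) (br 6 dead (br 1 (br 4 (br 7 (br 2 (br 5 (paint 1) dead)
      (br 5 (paint 1) dead)) dead) dead) (br 7 (br 4 (br 5 (br 2 (paint 1) (paint 1)) dead) dead) dead)))) (br 6 (br 1
      (br 2 (br 3 (br 4 dead (br 7 dead (br 5 (paint 2) (paint 2)))) dead) (br 3 (br 4 dead (br 7 dead (paint 2))) (br
      4 (br 7 dead (br 5 (paint 2) dead)) (br 7 (br 5 (paint 2) dead) dead)))) (br 4 dead (br 5 dead (br 2 (br 3 (br 7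
      dead dead) dead) (br 3 (br 7 dead dead) dead))))) (br 5 (br 1 (br 3 dead (br 2 (br 4 dead (br 7 dead dead)) (br
      4 (br 7 dead (paint 1)) dead))) (br 2 (br 4 dead (br 7 (br 3 dead dead) dead)) (br 3 dead (br 4 (br 7 dead dead)
      dead)))) dead)))) ∷
  step (49 ∷ 35 ∷ 22 ∷ 14 ∷ 7 ∷ 1 ∷ 1 ∷ 0 ∷ [])
        (0x821000 ∷ 0x531000 ∷ 0x851000 ∷ 0x653001 ∷ 0x721000 ∷ 0x534000 ∷ 0x765001 ∷ 0x327000 ∷ 0x752000 ∷ 0x832001 ∷
      0x425000 ∷ 0x831000 ∷ 0x215000 ∷ 0x826000 ∷ 0x386502109 ∷ 0x764001 ∷ 0x7683540215 ∷ 0x36258100a ∷ 0x8765403214 ∷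
      0x743000 ∷ 0x651703209 ∷ 0x761001 ∷ 0x5786403118 ∷ 0x3086425118 ∷ 0x576031208 ∷ 0x5768340119 ∷ 0x853001 ∷
      0x842001 ∷ 0x875001 ∷ 0x841000 ∷ 0x3208546119 ∷ 0x63157200a ∷ 0x874001 ∷ 0x762000 ∷ 0x5086372112 ∷ [])
        (coloured (plain (3 ∷ 2 ∷ 0 ∷ 3 ∷ 2 ∷ 1 ∷ 0 ∷ 1 ∷ [])) (br 0 (br 5 (paint 1) (br 1 (br 4 (br 7 dead (br 2 (br
      3 (br 6 (paint 0) dead) dead) dead)) dead) (br 2 (br 3 (br 4 (br 6 dead (br 7 dead dead)) (br 6 (paint 0) dead))
      (br 4 dead (br 6 (paint 0) dead))) (br 4 (br 6 dead (br 3 (br 7 dead dead) dead)) dead)))) (br 1 (br 2 (br 4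
      dead (br 3 dead (br 6 (br 5 (br 7 dead dead) dead) dead))) (br 3 (br 4 (br 6 dead (br 5 (br 7 dead (paint 2))
      dead)) dead) (br 4 (br 7 dead (br 5 (br 6 dead dead) dead)) (br 5 (br 6 (br 7 dead dead) dead) dead)))) (br 2
      (br 4 dead (br 7 dead (br 3 (br 6 (br 5 dead dead) dead) dead))) (br 7 (br 3 dead (br 4 dead (br 5 dead dead)))
      dead))))) ∷
  step (67 ∷ 28 ∷ 25 ∷ 11 ∷ 6 ∷ 3 ∷ 1 ∷ 0 ∷ [])
        (0x752001 ∷ 0x832000 ∷ 0x842000 ∷ 0x876542008 ∷ 0x7843650214 ∷ 0x8674532012 ∷ 0x762001 ∷ 0x583470211a ∷
      0x751000 ∷ 0x3780415212 ∷ 0x8350471215 ∷ [])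
        (dominated 1 7 (br 2 dead (br 3 dead (br 0 (br 4 (br 5 (br 6 dead dead) (br 6 dead dead)) (br 6 dead dead))
      (br 4 (br 6 dead dead) (br 6 dead dead)))))) ∷
  step (97 ∷ 35 ∷ 14 ∷ 11 ∷ 6 ∷ 3 ∷ 1 ∷ 0 ∷ [])
        (0x841000 ∷ 0x641000 ∷ 0x921000 ∷ 0x961000 ∷ 0x931000 ∷ 0x951001 ∷ 0x531000 ∷ 0x753001 ∷ 0x971000 ∷ 0x215000 ∷
      0x871001 ∷ 0x321000 ∷ 0x714000 ∷ 0x631000 ∷ 0x216000 ∷ 0x843000 ∷ 0x752000 ∷ 0x762000 ∷ 0x427000 ∷ 0x763001 ∷
      0x842001 ∷ 0x821000 ∷ 0x9608243119 ∷ 0x961001 ∷ 0x9801763514 ∷ 0x8765941015 ∷ 0x8675941015 ∷ 0x861000 ∷ 0x821001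
      ∷ 0x854721003 ∷ 0x8701652414 ∷ 0x734000 ∷ 0x8047652111 ∷ 0x28310650a ∷ 0x2408631518 ∷ 0x2085413715 ∷ 0x703651209
      ∷ 0x541000 ∷ 0x875001 ∷ 0x847652009 ∷ 0x8756432019 ∷ 0x6584370213 ∷ 0x47652109 ∷ 0x813000 ∷ 0x854001 ∷ 0x864001
      ∷ 0x8730652414 ∷ 0x307652109 ∷ 0x14762309 ∷ 0x9102763514 ∷ [])
        (coloured (plain (3 ∷ 2 ∷ 3 ∷ 0 ∷ 2 ∷ 2 ∷ 0 ∷ 1 ∷ [])) (br 0 (br 2 (br 6 (br 3 (br 1 (br 4 (br 5 (br 7 dead
      (paint 0)) dead) dead) (br 4 dead (br 5 dead (br 7 (paint 0) (paint 0))))) dead) (br 3 (br 1 dead (br 4 (br 5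
      (br 7 dead (paint 3)) (paint 3)) (br 7 (br 5 dead (paint 3)) dead))) (br 7 (br 1 (paint 1) (br 4 (br 5 (paint 1)
      (paint 1)) (br 5 (paint 1) dead))) (br 1 (br 4 (paint 2) dead) dead)))) (br 7 dead (br 1 (br 4 (br 5 (br 3 (br 6
      (paint 2) dead) (br 6 dead (paint 2))) dead) dead) (br 3 (br 4 (br 6 dead (br 5 dead dead)) (br 6 (br 5 dead
      dead) dead)) dead)))) (br 1 (br 2 (br 4 dead (br 5 dead (br 6 (paint 0) dead))) (br 3 (br 4 dead (br 5 dead (br
      6 (br 7 dead (paint 0)) dead))) (br 7 (br 4 (br 5 (paint 1) (br 6 (paint 1) dead)) (br 6 (br 5 (paint 1) dead)
      dead)) (br 4 (br 5 (br 6 (paint 2) dead) dead) dead)))) (br 7 (br 2 (br 4 dead (br 5 dead (br 3 (br 6 (paint 0)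
      dead) (br 6 dead dead)))) (br 3 dead (br 4 (br 5 dead dead) (br 6 dead dead)))) dead)))) ∷
  step (49 ∷ 35 ∷ 22 ∷ 13 ∷ 3 ∷ 3 ∷ 1 ∷ 0 ∷ [])
        (0x831000 ∷ 0x841000 ∷ 0x8437652005 ∷ 0x768543011c ∷ 0x678534011c ∷ 0x761001 ∷ 0x825000 ∷ 0x652000 ∷
      0x326841518 ∷ 0x762000 ∷ 0x754001 ∷ 0x653001 ∷ [])
        (dominated 0 7 (br 2 dead (br 3 dead (br 1 (br 4 (br 5 (br 6 dead dead) (br 6 dead dead)) dead) (br 4 (br 5
      dead dead) (br 5 (br 6 dead dead) dead)))))) ∷
  step (67 ∷ 38 ∷ 28 ∷ 14 ∷ 7 ∷ 2 ∷ 1 ∷ 0 ∷ [])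
        (0x314000 ∷ 0x523000 ∷ 0x853762009 ∷ 0x8746532016 ∷ 0x8647532016 ∷ 0x43762109 ∷ 0x842001 ∷ 0x651000 ∷ 0x751000
      ∷ 0x847652011b ∷ 0x8402761314 ∷ 0x8043762111 ∷ 0x864001 ∷ [])
        (dominated 3 4 (br 0 (br 2 dead (br 1 dead (br 7 (br 5 (br 6 dead dead) (br 6 dead dead)) dead))) (br 5 dead
      (br 6 dead (br 7 (br 1 dead (br 2 dead dead)) dead))))) ∷
  step (15 ∷ 41 ∷ 24 ∷ 14 ∷ 7 ∷ 2 ∷ 1 ∷ 0 ∷ [])
        (0x421000 ∷ 0x841000 ∷ 0x321000 ∷ 0x981000 ∷ 0x941001 ∷ 0x431000 ∷ 0x321001 ∷ 0x324000 ∷ 0x325000 ∷ 0x874001 ∷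
      0x643000 ∷ 0x653000 ∷ 0x751000 ∷ 0x761001 ∷ 0x931000 ∷ 0x217000 ∷ 0x742000 ∷ 0x876543009 ∷ 0x736000 ∷ 0x871000 ∷
      0x1039728415 ∷ 0x861000 ∷ 0x931001 ∷ 0x930245811d ∷ 0x761000 ∷ 0x935214812 ∷ 0x751001 ∷ 0x793654114 ∷ 0x431001 ∷
      0x941000 ∷ 0x1094872315 ∷ 0x316000 ∷ 0x627000 ∷ 0x867542009 ∷ 0x875001 ∷ 0x8013542614 ∷ 0x752000 ∷ 0x823071461c
      ∷ 0x875460231c ∷ 0x2680341519 ∷ 0x8703542614 ∷ 0x21630540a ∷ 0x2680351419 ∷ 0x865470321c ∷ 0x832061471c ∷
      0x873001 ∷ 0x865001 ∷ 0x864001 ∷ 0x862001 ∷ 0x5083761215 ∷ 0x4083761215 ∷ 0x1093782415 ∷ 0x1043287915 ∷ [])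
        (coloured (plain (1 ∷ 2 ∷ 0 ∷ 3 ∷ 3 ∷ 0 ∷ 2 ∷ 1 ∷ [])) (br 0 (br 2 (br 5 (br 1 (br 3 (br 4 (br 6 (paint 0)
      dead) dead) dead) (br 3 (br 6 dead (br 4 (br 7 dead (paint 0)) (br 7 (paint 0) dead))) (br 4 (br 6 dead (br 7
      (paint 0) dead)) (br 6 (paint 0) (br 7 dead dead))))) dead) (br 7 (br 1 (br 6 (br 3 (br 5 dead (br 4 dead (paint
      1))) (br 4 (br 5 dead (paint 1)) (br 5 (paint 1) dead))) dead) (br 3 (br 5 dead (br 4 dead dead)) (br 4 (br 5
      dead dead) (br 5 (br 6 (paint 1) dead) (paint 1))))) (paint 2))) (br 5 (br 7 dead (br 1 (br 6 (br 2 (br 3 (br 4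
      (paint 0) dead) dead) (br 3 dead (br 4 dead dead))) dead) (br 2 (br 3 (br 6 dead dead) (br 6 (paint 0) dead))
      dead))) (br 1 (br 2 (br 3 (br 4 (br 6 dead (br 7 (paint 3) (paint 3))) dead) dead) (br 3 (br 4 (br 6 (br 7 dead
      dead) (br 7 (paint 3) dead)) (br 7 (br 6 dead dead) dead)) (br 7 (br 6 dead dead) dead))) (br 2 (br 6 dead (br 7
      (paint 3) dead)) dead))))) ∷
  step (43 ∷ 26 ∷ 21 ∷ 9 ∷ 6 ∷ 3 ∷ 1 ∷ 0 ∷ [])
        (0x981000 ∷ 0x621000 ∷ 0x741000 ∷ 0x723000 ∷ 0x762001 ∷ 0x714000 ∷ 0x218000 ∷ 0x852000 ∷ 0x625000 ∷ 0x635000 ∷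
      0x832000 ∷ 0x853407621f ∷ 0x863001 ∷ 0x841000 ∷ 0x861000 ∷ 0x941001 ∷ 0x721001 ∷ 0x786521003 ∷ 0x753000 ∷
      0x784052131a ∷ 0x843001 ∷ 0x783061241a ∷ 0x516000 ∷ 0x546000 ∷ 0x716324519 ∷ 0x864307511f ∷ 0x768053121c ∷
      0x786052131d ∷ 0x752108631f ∷ 0x875001 ∷ 0x725413619 ∷ 0x751001 ∷ 0x7086152313 ∷ 0x764000 ∷ 0x213465716 ∷
      0x761208541f ∷ 0x876001 ∷ 0x2078614515 ∷ 0x437000 ∷ 0x758064211c ∷ 0x857061341c ∷ 0x854001 ∷ [])
        (coloured (plain (1 ∷ 3 ∷ 2 ∷ 1 ∷ 2 ∷ 1 ∷ 0 ∷ 3 ∷ [])) (br 4 (br 5 (br 0 (br 1 (br 7 (br 2 (br 6 dead (paint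
      2)) (br 6 dead (br 3 (paint 1) (paint 3)))) dead) (br 7 dead (br 2 (br 3 (paint 1) (br 6 dead dead)) (paint
      1)))) (br 7 dead (br 1 (br 2 (paint 2) (br 3 (br 6 dead dead) dead)) (br 6 (br 2 (paint 2) dead) dead)))) (br 0
      dead (br 3 dead (br 1 (br 2 (br 6 (br 7 (paint 0) dead) (br 7 dead dead)) (br 6 dead dead)) (br 6 (br 7 dead
      dead) dead))))) (br 0 (br 1 (br 5 dead (br 7 (br 2 (br 3 (br 6 (paint 0) dead) (br 6 dead dead)) (br 6 dead
      dead)) dead)) (br 2 (br 5 dead (br 6 (br 7 dead dead) dead)) (br 3 (br 5 (br 6 (br 7 (paint 0) dead) (br 7 dead
      dead)) (br 6 (br 7 (paint 0) dead) dead)) (br 6 dead (br 5 dead dead))))) (br 6 (br 1 (br 2 (br 5 dead (br 3 (br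
      7 dead dead) (br 7 (paint 0) dead))) dead) (br 2 (br 5 dead (br 7 dead dead)) (br 3 (br 7 dead (br 5 dead dead))
      (br 5 dead dead)))) dead)))) ∷
  step (38 ∷ 49 ∷ 6 ∷ 13 ∷ 5 ∷ 3 ∷ 1 ∷ 0 ∷ [])
        (0x981001 ∷ 0x421000 ∷ 0x831000 ∷ 0x412000 ∷ 0x873000 ∷ 0x715000 ∷ 0x652000 ∷ 0x653001 ∷ 0x318000 ∷
      0x980317641f ∷ 0x931001 ∷ 0x8192035418 ∷ 0x821000 ∷ 0x851000 ∷ 0x324000 ∷ 0x416000 ∷ 0x586431004 ∷ 0x47852311d ∷
      0x7680425312 ∷ 0x861000 ∷ 0x6708523119 ∷ 0x72184300a ∷ 0x8564702319 ∷ 0x843000 ∷ 0x634000 ∷ 0x564803109 ∷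
      0x54386100a ∷ 0x674805311a ∷ 0x587460321a ∷ 0x872001 ∷ 0x874001 ∷ 0x876001 ∷ 0x847021308 ∷ 0x542000 ∷
      0x856073108 ∷ 0x865001 ∷ 0x743000 ∷ 0x781402309 ∷ 0x6830275106 ∷ 0x84721351d ∷ 0x854001 ∷ [])
        (coloured (plain (3 ∷ 3 ∷ 0 ∷ 2 ∷ 1 ∷ 2 ∷ 1 ∷ 0 ∷ [])) (br 7 (br 0 (br 1 (br 2 (br 3 (br 5 (br 4 dead (br 6
      dead (paint 0))) dead) dead) (br 3 dead (br 6 dead (br 4 (br 5 dead dead) (br 5 dead dead))))) (br 3 dead (br 2
      (br 5 dead (br 4 (paint 0) dead)) (br 6 dead (br 4 (br 5 dead dead) dead))))) (br 1 dead (br 4 dead (br 5 dead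
      (br 2 (br 6 (br 3 dead dead) dead) dead))))) (br 1 (br 6 (paint 1) (br 3 (br 5 (br 0 (br 2 dead (br 4 (paint 2)
      dead)) (br 2 dead (paint 2))) dead) dead)) (br 6 (br 0 (br 2 dead (br 3 dead (br 4 (br 5 dead dead) dead))) (br
      2 (br 3 (br 4 dead (br 5 (paint 2) dead)) dead) (br 3 dead (br 4 dead dead)))) dead)))) ∷
  step (7 ∷ 28 ∷ 22 ∷ 13 ∷ 4 ∷ 3 ∷ 1 ∷ 0 ∷ [])
        (0x761000 ∷ 0x546000 ∷ 0x537000 ∷ 0x863001 ∷ 0x851000 ∷ 0x8476025121 ∷ 0x8367025121 ∷ 0x624000 ∷ 0x867042531c
      ∷ 0x876032541c ∷ 0x874001 ∷ [])
        (dominated 0 4 (br 7 dead (br 1 (br 2 (br 6 (br 5 dead (br 3 dead dead)) dead) (br 5 (br 3 (br 6 dead dead)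
      dead) dead)) (br 2 (br 6 (br 5 dead (br 3 dead dead)) dead) (br 5 (br 6 dead (br 3 dead dead)) dead))))) ∷
  step (96 ∷ 19 ∷ 18 ∷ 14 ∷ 7 ∷ 3 ∷ 0 ∷ 0 ∷ [])
    (0x765001 ∷ 0x421000 ∷ 0x641000 ∷ 0x531000 ∷ 0x6574820321 ∷ 0x865001 ∷ 0x743000 ∷ 0x852000 ∷ 0x6087543212 ∷ [])
        (dominated 0 3 (br 1 dead (br 5 dead (br 2 (br 4 dead (br 6 (br 7 dead dead) dead)) (br 6 dead (br 4 (br 7
      dead dead) dead)))))) ∷
  step (56 ∷ 44 ∷ 26 ∷ 13 ∷ 0 ∷ 3 ∷ 1 ∷ 0 ∷ [])
        (0x873001 ∷ 0x546000 ∷ 0x613000 ∷ 0x875000 ∷ 0x8730654121 ∷ 0x7830654221 ∷ 0x712000 ∷ 0x78632541a ∷ 0x841000 ∷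
      0x623000 ∷ 0x87631541a ∷ 0x742000 ∷ [])
        (dominated 2 3 (br 0 (br 5 dead (br 4 dead (br 1 (br 6 (br 7 dead dead) (br 7 dead dead)) (br 6 dead (br 7
      dead dead))))) (br 7 dead (br 6 (br 1 (br 5 dead (br 4 dead dead)) dead) dead)))) ∷
  step (72 ∷ 7 ∷ 20 ∷ 12 ∷ 3 ∷ 3 ∷ 1 ∷ 0 ∷ [])
    (0x874001 ∷ 0x631000 ∷ 0x761000 ∷ 0x421000 ∷ 0x654000 ∷ 0x7680543222 ∷ 0x862000 ∷ 0x8703624521 ∷ 0x78653241d ∷ [])
        (dominated 0 5 (br 2 dead (br 6 dead (br 1 (br 3 dead (br 4 dead (br 7 dead dead))) (br 7 dead (br 3 (br 4
      dead dead) dead)))))) ∷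
  step (51 ∷ 26 ∷ 14 ∷ 7 ∷ 3 ∷ 0 ∷ 0 ∷ [])
        (0x754321003 ∷ 0x314000 ∷ 0x423000 ∷ 0x6743521017 ∷ 0x215000 ∷ 0x532000 ∷ 0x6752431017 ∷ 0x6732154017 ∷
      0x653001 ∷ 0x642001 ∷ 0x541000 ∷ 0x6751342017 ∷ 0x6741253017 ∷ 0x654001 ∷ 0x631001 ∷ 0x621001 ∷ [])
        (dominated 5 6 (br 0 (br 1 (br 4 (br 2 (br 3 dead dead) (br 3 dead dead)) dead) (br 3 (br 2 (br 4 dead dead)
      (br 4 dead dead)) dead)) (br 1 (br 2 (br 3 (br 4 dead dead) (br 4 dead dead)) dead) dead))) ∷
  step (35 ∷ 22 ∷ 13 ∷ 3 ∷ 3 ∷ 1 ∷ 0 ∷ [])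
        (0x651000 ∷ 0x654001 ∷ 0x714000 ∷ 0x764532101a ∷ 0x754623101a ∷ 0x523000 ∷ 0x5473620115 ∷ 0x6472530115 ∷
      0x643001 ∷ 0x542001 ∷ [])
        (dominated 3 6 (br 0 dead (br 1 (br 2 (br 4 (br 5 dead dead) (br 5 dead dead)) (br 4 dead (br 5 dead dead)))
      (br 4 (br 5 dead (br 2 dead dead)) dead)))) ∷
  step (7 ∷ 12 ∷ 11 ∷ 6 ∷ 3 ∷ 1 ∷ 0 ∷ [])
        (0x651000 ∷ 0x765001 ∷ 0x524000 ∷ 0x316000 ∷ 0x623000 ∷ 0x415000 ∷ 0x432000 ∷ 0x732000 ∷ 0x742000 ∷ 0x751000 ∷
      0x761000 ∷ 0x431001 ∷ 0x473612004 ∷ 0x5476321023 ∷ 0x6375421023 ∷ 0x436701209 ∷ 0x217000 ∷ 0x7465320121 ∷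
      0x756042108 ∷ 0x7356420121 ∷ 0x765032108 ∷ 0x53276100a ∷ 0x643705211a ∷ 0x534706211a ∷ 0x652001 ∷ 0x743001 ∷
      0x7643510221 ∷ 0x7534610221 ∷ 0x35174200a ∷ 0x743051208 ∷ 0x465703121a ∷ 0x734061208 ∷ 0x356704121a ∷
      0x7054632112 ∷ 0x764001 ∷ 0x7063542112 ∷ 0x753001 ∷ [])
        (coloured (plain (2 ∷ 3 ∷ 0 ∷ 1 ∷ 1 ∷ 0 ∷ 2 ∷ [])) (br 0 (br 1 (br 6 (br 2 (br 5 (br 3 dead (br 4 dead dead))
      dead) (br 5 dead (br 3 (br 4 dead dead) dead))) dead) (br 2 (br 3 dead (br 5 (br 6 dead (br 4 dead dead)) dead))
      (br 3 (br 4 (br 6 dead (br 5 dead dead)) dead) (br 6 (br 4 (br 5 dead dead) (br 5 dead dead)) dead)))) (br 1 (br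
      2 (br 3 (br 4 (br 5 dead (br 6 dead dead)) (br 5 (br 6 dead dead) (br 6 dead dead))) (br 4 dead (br 5 (br 6 dead
      dead) (br 6 dead dead)))) (br 3 (br 5 dead (br 4 (br 6 dead dead) (br 6 dead dead))) dead)) (br 2 (br 3 dead (br
      6 dead (br 5 (br 4 dead dead) dead))) (br 3 (br 6 dead (br 4 (br 5 dead dead) dead)) dead))))) ∷
  step (28 ∷ 22 ∷ 13 ∷ 4 ∷ 3 ∷ 1 ∷ 0 ∷ [])
        (0x651001 ∷ 0x721000 ∷ 0x731000 ∷ 0x7654321022 ∷ 0x7653421020 ∷ 0x7562431020 ∷ 0x654000 ∷ 0x4076321515 ∷
      0x4075231615 ∷ [])
        (dominated 0 6 (br 1 dead (br 2 dead (br 3 (br 4 (br 5 dead dead) (br 5 dead dead)) (br 4 (br 5 dead dead) (br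
      5 dead dead)))))) ∷
  step (41 ∷ 24 ∷ 14 ∷ 7 ∷ 2 ∷ 1 ∷ 0 ∷ [])
        (0x542000 ∷ 0x213000 ∷ 0x735261029 ∷ 0x736052127 ∷ 0x753001 ∷ 0x641000 ∷ 0x736152029 ∷ 0x735061227 ∷
      0x7065321417 ∷ 0x763001 ∷ [])
        (dominated 2 3 (br 0 (br 1 dead (br 4 dead (br 6 (br 5 dead dead) dead))) (br 5 dead (br 6 (br 1 (br 4 dead
      dead) (br 4 dead dead)) dead)))) ∷
  step (24 ∷ 21 ∷ 12 ∷ 7 ∷ 2 ∷ 1 ∷ 0 ∷ [])
    (0x741000 ∷ 0x321000 ∷ 0x543000 ∷ 0x750643129 ∷ 0x763001 ∷ 0x642000 ∷ 0x760542129 ∷ 0x752001 ∷ 0x732001 ∷ [])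
        (dominated 0 3 (br 6 dead (br 1 (br 2 dead (br 4 dead (br 5 dead dead))) (br 2 (br 4 (br 5 dead dead) dead)
      dead)))) ∷
  step (7 ∷ 20 ∷ 12 ∷ 6 ∷ 3 ∷ 1 ∷ 0 ∷ [])
    (0x751000 ∷ 0x761000 ∷ 0x7651432024 ∷ 0x6740513221 ∷ 0x675302128 ∷ 0x576203128 ∷ 0x65732127 ∷ [])
    (dominated 0 6 (br 4 dead (br 5 dead (br 1 (br 2 (br 3 dead dead) dead) (br 2 dead dead))))) ∷
  step (7 ∷ 12 ∷ 10 ∷ 6 ∷ 3 ∷ 1 ∷ 0 ∷ [])
        (0x415000 ∷ 0x652001 ∷ 0x524000 ∷ 0x751000 ∷ 0x651000 ∷ 0x761000 ∷ 0x765001 ∷ 0x316000 ∷ 0x623000 ∷ 0x732000 ∷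
      0x534000 ∷ 0x756042108 ∷ 0x643000 ∷ 0x765032108 ∷ 0x576321004 ∷ 0x742000 ∷ 0x5764321025 ∷ 0x6753421025 ∷
      0x657043108 ∷ 0x217000 ∷ 0x7652431025 ∷ 0x53276100a ∷ 0x7650432122 ∷ 0x6750423122 ∷ 0x5760324122 ∷ 0x7651403224
      ∷ 0x7561304224 ∷ 0x6571204324 ∷ 0x7504613221 ∷ 0x6504712321 ∷ 0x7603514221 ∷ 0x5603712421 ∷ 0x65143229 ∷
      0x6702514321 ∷ 0x5702613421 ∷ 0x75142329 ∷ 0x76532141d ∷ 0x764001 ∷ 0x753001 ∷ [])
        (coloured (plain (0 ∷ 2 ∷ 1 ∷ 3 ∷ 0 ∷ 1 ∷ 2 ∷ [])) (br 0 (br 1 (br 6 (br 2 (br 5 (br 3 (br 4 dead dead) (br 4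
      dead dead)) dead) (br 5 dead (br 3 (br 4 dead dead) (br 4 dead dead)))) dead) (br 2 (br 5 (br 6 dead (br 3 (br 4
      dead dead) (br 4 dead dead))) dead) (br 3 (br 4 (br 5 dead (br 6 dead dead)) dead) (br 4 (br 5 (br 6 dead dead)
      (br 6 dead dead)) (br 5 (br 6 dead dead) dead))))) (br 1 (br 2 (br 3 (br 4 (br 5 dead (br 6 dead dead)) (br 5
      (br 6 dead dead) (br 6 dead dead))) (br 4 dead (br 5 (br 6 dead dead) (br 6 dead dead)))) (br 5 dead (br 3 (br 4
      (br 6 dead dead) (br 6 dead dead)) (br 4 dead dead)))) (br 2 (br 6 dead (br 3 (br 4 (br 5 dead dead) (br 5 dead
      dead)) (br 4 dead dead))) (br 3 (br 5 dead (br 4 (br 6 dead dead) dead)) (br 4 (br 5 dead (br 6 dead dead)) (br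
      5 (br 6 dead dead) dead))))))) ∷
  step (32 ∷ 19 ∷ 10 ∷ 6 ∷ 3 ∷ 1 ∷ 0 ∷ [])
    (0x321000 ∷ 0x421000 ∷ 0x651000 ∷ 0x764352029 ∷ 0x764001 ∷ 0x753462029 ∷ 0x765043227 ∷ 0x753001 ∷ [])
    (dominated 0 1 (br 2 dead (br 3 dead (br 4 (br 5 dead (br 6 dead dead)) (br 6 (br 5 dead dead) dead))))) ∷
  -- The 5-wheel: vertex 5 is the hub and 0, 1, 3, 4, 2 is the rim. It already needs four colours.
  step (19 ∷ 10 ∷ 6 ∷ 3 ∷ 1 ∷ 0 ∷ [])
        (0x314000 ∷ 0x423000 ∷ 0x532000 ∷ 0x541000 ∷ 0x654321003 ∷ 0x65432102e ∷ 0x64352102b ∷ 0x64350212a ∷ 0x215000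
      ∷ 0x65243102b ∷ 0x65240312a ∷ 0x63215402b ∷ 0x63210542a ∷ 0x653241029 ∷ 0x653001 ∷ 0x642351029 ∷ 0x654032127 ∷
      0x642001 ∷ 0x65134202b ∷ 0x65130422a ∷ 0x64125302b ∷ 0x64120532a ∷ 0x654132029 ∷ 0x654001 ∷ 0x631452029 ∷
      0x653041227 ∷ 0x631001 ∷ 0x621543029 ∷ 0x642051327 ∷ 0x631052427 ∷ 0x621043527 ∷ 0x605432126 ∷ 0x621001 ∷ [])
        (coloured (plain (1 ∷ 2 ∷ 2 ∷ 1 ∷ 3 ∷ 0 ∷ [])) (br 0 (br 1 (br 4 (br 2 (br 3 (br 5 dead dead) dead) (br 3 dead
      (br 5 dead dead))) dead) (br 2 (br 3 (br 4 dead (br 5 dead dead)) dead) (br 3 (br 4 (br 5 dead dead) (br 5 dead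
      dead)) (br 5 (br 4 dead dead) dead)))) (br 1 (br 2 (br 3 (br 4 dead (br 5 dead dead)) (br 4 (br 5 dead dead) (br
      5 dead dead))) (br 3 dead (br 5 (br 4 dead dead) dead))) (br 5 (br 2 (br 4 dead (br 3 dead dead)) (br 3 (br 4
      dead dead) (br 4 dead dead))) dead)))) ∷
  step (3 ∷ 10 ∷ 6 ∷ 3 ∷ 1 ∷ 0 ∷ [])
    (0x641000 ∷ 0x651000 ∷ 0x65432012d ∷ 0x564302128 ∷ 0x465203128 ∷ 0x54632127 ∷ [])
    (dominated 0 5 (br 3 dead (br 4 dead (br 1 (br 2 dead dead) (br 2 dead dead))))) ∷
  step (12 ∷ 11 ∷ 6 ∷ 3 ∷ 1 ∷ 0 ∷ [])
    (0x621000 ∷ 0x631000 ∷ 0x26340130 ∷ 0x462350127 ∷ 0x541001 ∷ [])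
    (dominated 0 5 (br 1 dead (br 2 dead (br 3 dead (br 4 dead dead))))) ∷
  -- The complement of the 7-cycle 0, 5, 2, 3, 4, 1, 6. It has no K4 and needs four colours, since
  -- its independent sets have at most two vertices.
  step (15 ∷ 11 ∷ 10 ∷ 6 ∷ 3 ∷ 1 ∷ 0 ∷ [])
        (0x751000 ∷ 0x321000 ∷ 0x641000 ∷ 0x421001 ∷ 0x217000 ∷ 0x421000 ∷ 0x316000 ∷ 0x643000 ∷ 0x871000 ∷ 0x321001 ∷
      0x751001 ∷ 0x425000 ∷ 0x534000 ∷ 0x861000 ∷ 0x2451631 ∷ 0x531001 ∷ 0x34152031 ∷ 0x6180473219 ∷ 0x18620931 ∷
      0x921001 ∷ 0x861001 ∷ 0x531000 ∷ 0x753001 ∷ 0x12045730 ∷ 0x765001 ∷ 0x761000 ∷ 0x46271030 ∷ 0x24163030 ∷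
      0x2416302f ∷ 0x21340531 ∷ 0x642001 ∷ 0x1325402f ∷ 0x13054630 ∷ 0x752000 ∷ 0x871001 ∷ [])
        (coloured (plain (2 ∷ 1 ∷ 0 ∷ 3 ∷ 3 ∷ 0 ∷ 1 ∷ [])) (br 0 (br 3 (br 1 (br 4 (br 6 (br 2 (br 5 (paint 0) dead)
      (br 5 dead dead)) dead) dead) (br 2 (br 5 (paint 0) dead) (br 5 dead dead))) (br 4 (br 2 dead (br 1 (br 6 (paint
      1) dead) dead)) (br 5 (br 6 (br 1 (paint 2) (paint 2)) (br 1 dead (br 2 (paint 0) dead))) (br 1 (br 2 dead (br 6
      (leaf (spl 1 1 2)) dead)) dead)))) (br 3 (br 4 (br 5 (br 2 (br 6 dead (br 1 dead (leaf (spl 2 3 0)))) dead) (br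
      1 (br 2 (paint 3) (br 6 (leaf (col 1 1)) (leaf (col 2 3)))) (br 2 (br 6 dead (paint 3)) dead))) (br 1 dead (br 2
      (br 6 dead (br 5 (paint 0) dead)) dead))) (br 1 (br 2 (br 4 dead dead) (br 4 (br 5 dead (paint 1)) dead))
      dead)))) ∷
  -- The gem: the path 0, 2, 3, 1 together with vertex 4, which is adjacent to all of it.
  step (10 ∷ 6 ∷ 3 ∷ 1 ∷ 0 ∷ [])
        (0x421000 ∷ 0x531001 ∷ 0x631000 ∷ 0x531000 ∷ 0x651001 ∷ 0x621000 ∷ 0x542001 ∷ 0x65042131 ∷ 0x64053131 ∷
      0x541001 ∷ 0x564031229 ∷ 0x312000 ∷ 0x45320131 ∷ 0x35410231 ∷ 0x543001 ∷ 0x54321030 ∷ 0x5432102f ∷ 0x465021329 ∷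
      0x6431231 ∷ 0x631001 ∷ 0x6521331 ∷ 0x641000 ∷ 0x623000 ∷ 0x765231032 ∷ 0x650371227 ∷ 0x621001 ∷ 0x654321032 ∷
      0x651000 ∷ 0x421001 ∷ [])
        (coloured (plain (0 ∷ 1 ∷ 1 ∷ 0 ∷ 2 ∷ [])) (br 0 (br 1 (br 2 (br 3 (paint 3) (br 4 (paint 1) (leaf (col 1
      1)))) (br 3 (br 4 (paint 0) (paint 3)) (br 4 (paint 2) dead))) (br 2 dead (br 3 (br 4 (paint 0) (paint 0)) (br 4
      dead dead)))) (br 1 (br 3 dead (br 4 (br 2 (leaf (spl 1 1 2)) dead) (br 2 (paint 1) dead))) (br 2 (br 3 (br 4
      dead dead) (br 4 (paint 2) dead)) (br 4 (br 3 (paint 2) (paint 2)) dead))))) ∷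
  step (3 ∷ 1 ∷ 0 ∷ [])
    (0x321000 ∷ 0x321001 ∷ 0x4203133 ∷ 0x421000 ∷ 0x3402133 ∷ 0x431001 ∷ 0x431000 ∷ 0x2304133 ∷ 0x421001 ∷ [])
        (coloured (plain (2 ∷ 1 ∷ 0 ∷ [])) (br 0 (br 1 (br 2 (paint 3) (paint 1)) (br 2 (paint 2) (paint 2))) (br 2
      (br 1 (paint 0) (paint 0)) (br 1 (paint 1) dead)))) ∷
  step (1 ∷ 0 ∷ [])
    (0x21034 ∷ 0x321000 ∷ 0x31034 ∷ [])
    (coloured (plain (2 ∷ 1 ∷ [])) (br 0 (br 1 (paint 0) (paint 2)) (paint 1))) ∷
  step []
    (0x1035 ∷ [])
    (coloured [] (paint 0)) ∷
  []

-- The list ends with 2K2, the edge and the empty pattern. Many of the graphs before them consist of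
-- a 5-cycle and a second 5-cycle or a path, with or without edges between them.
3K2-K3-certificate : List Step
3K2-K3-certificate =
  step (33 ∷ 32 ∷ 33 ∷ 32 ∷ 6 ∷ 12 ∷ 8 ∷ 4 ∷ 2 ∷ 1 ∷ 0 ∷ [])
        (0xa1001 ∷ 0x51001 ∷ 0x81001 ∷ 0x54321000 ∷ 0xc1001 ∷ 0x96541000 ∷ 0xb7321000 ∷ 0x41001 ∷ 0x21001 ∷ 0xb7961000
      ∷ 0xa4001 ∷ 0x9321a000 ∷ 0x82001 ∷ 0x96001 ∷ 0x31001 ∷ 0x4321b000 ∷ 0x96214000 ∷ 0x43718000 ∷ 0xb9001 ∷
      0x96854000 ∷ 0x43827000 ∷ 0x75432000 ∷ 0xa6752000 ∷ 0xb7001 ∷ 0xa6718000 ∷ 0x8593a000 ∷ 0x75001 ∷ 0x85001 ∷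
      0xa6001 ∷ 0x43215000 ∷ 0x43216000 ∷ 0x43716000 ∷ 0xb9214000 ∷ 0xb7432000 ∷ 0x75932000 ∷ 0x93215000 ∷ 0x85436000
      ∷ 0x61001 ∷ [])
        (coloured (plain (0 ∷ 1 ∷ 0 ∷ 2 ∷ 0 ∷ 0 ∷ 1 ∷ 3 ∷ 2 ∷ 3 ∷ 0 ∷ [])) (br 0 (br 2 (br 4 (br 5 (br 1 (br 3 (br 10
      (br 6 (br 7 (br 8 (br 9 (paint 0) dead) (paint 0)) dead) (br 7 dead (br 8 (br 9 (paint 0) dead) (paint 0))))
      dead) (br 8 dead (br 9 (br 10 (br 6 (br 7 (paint 0) dead) (paint 0)) dead) dead))) (br 7 (br 3 (br 6 dead (br 10
      (br 8 (br 9 (paint 0) dead) (paint 0)) dead)) (br 8 dead (br 9 (br 6 dead (paint 0)) dead))) dead)) (br 8 (br 9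
      (br 1 (br 3 dead (br 10 dead (paint 3))) (br 6 dead (br 7 (br 3 dead (paint 3)) dead))) dead) dead)) (br 6 (br 7
      (br 1 (br 3 dead (br 8 dead (br 5 (paint 3) dead))) (br 3 (br 5 (br 10 dead (paint 3)) dead) (paint 3))) dead)
      dead)) (paint 2)) (paint 1))) ∷
  -- Two disjoint 5-cycles.
  step (3 ∷ 2 ∷ 2 ∷ 1 ∷ 0 ∷ 3 ∷ 2 ∷ 2 ∷ 1 ∷ 0 ∷ [])
        (0x81001 ∷ 0x31001 ∷ 0x41001 ∷ 0x86001 ∷ 0x76001 ∷ 0xa9001 ∷ 0x71001 ∷ 0x91001 ∷ 0x97001 ∷ 0xa8001 ∷
      0xa8531000 ∷ 0xa1001 ∷ 0xa8641000 ∷ 0x21001 ∷ 0x87321000 ∷ 0x54001 ∷ 0x53001 ∷ 0xa9316000 ∷ 0x97421000 ∷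
      0xb9321000 ∷ 0x54816a327902 ∷ 0x547169328a02 ∷ 0x63915b427802 ∷ 0x97651000 ∷ 0x43912b657802 ∷ 0xba421000 ∷
      0xba651000 ∷ 0x7621a000 ∷ 0x76215000 ∷ 0x86215000 ∷ 0xa9215000 ∷ 0x97215000 ∷ 0xa8215000 ∷ 0x76314000 ∷
      0x86314000 ∷ 0xa9314000 ∷ 0x97314000 ∷ 0xa8314000 ∷ 0x86219000 ∷ 0x76541000 ∷ 0x86541000 ∷ 0xa9541000 ∷
      0x97541000 ∷ 0xa8541000 ∷ 0x875163a94202 ∷ 0x965173a84202 ∷ 0x874162a95302 ∷ 0x964172a85302 ∷ 0x76423000 ∷
      0x86423000 ∷ 0x97423000 ∷ 0x97218000 ∷ 0x42001 ∷ 0x76532000 ∷ 0x97532000 ∷ 0xa8217000 ∷ 0xa8532000 ∷ 0x7631a000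
      ∷ 0xa65284973102 ∷ 0x965274a83102 ∷ 0x7654a000 ∷ 0xa9546000 ∷ 0xa63281975402 ∷ 0x963271a85402 ∷ 0x86319000 ∷
      0x86549000 ∷ 0x7642a000 ∷ 0x86429000 ∷ 0x97428000 ∷ 0x9851a3764202 ∷ 0xa8427000 ∷ 0xa75193864202 ∷ 0x7653a000 ∷
      0x86539000 ∷ 0x97538000 ∷ 0x9841a2765302 ∷ 0xa8537000 ∷ 0xa74192865302 ∷ 0xb9531000 ∷ 0xb9641000 ∷
      0x154806a327902 ∷ 0x1547069328a02 ∷ 0x163905b427802 ∷ 0x143902b657802 ∷ [])
        (coloured (plain (1 ∷ 0 ∷ 0 ∷ 1 ∷ 2 ∷ 1 ∷ 0 ∷ 0 ∷ 1 ∷ 2 ∷ [])) (br 0 (br 1 (br 2 (br 3 (br 4 (br 5 (br 6 (br 9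
      (br 7 (br 8 (paint 0) dead) (br 8 dead (paint 2))) dead) (br 8 (br 7 (br 9 dead (paint 1)) (br 9 (paint 1)
      dead)) dead)) (br 6 (br 7 (br 8 (br 9 dead (paint 0)) (br 9 (paint 0) dead)) dead) dead)) (br 5 (br 6 dead (br 7
      dead (br 8 (br 9 dead dead) dead))) (br 6 (br 7 (br 8 dead (br 9 dead dead)) dead) dead))) (br 4 (br 5 (br 6
      dead (br 7 dead (br 8 (br 9 dead dead) dead))) (br 6 (br 7 (br 8 dead (br 9 dead dead)) dead) dead)) dead)) (br
      4 (br 3 (br 5 (br 6 dead (br 7 dead (paint 2))) (br 6 (br 7 (br 8 dead (paint 2)) dead) dead)) (br 5 (br 6
      (paint 2) (br 8 (br 7 (paint 2) (paint 2)) dead)) (br 6 (br 7 (br 8 (paint 2) (paint 2)) dead) dead))) dead))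
      (br 3 (br 2 (br 4 (br 5 (br 6 dead (paint 1)) (br 6 (br 7 (br 8 dead (br 9 dead dead)) dead) dead)) (br 5 (br 6
      (br 9 (br 7 (br 8 (paint 1) dead) (paint 1)) dead) (paint 1)) (br 6 (br 7 (br 8 (br 9 dead dead) (br 9 dead
      dead)) dead) dead))) (br 4 (br 5 (br 6 (br 9 (br 7 (br 8 (paint 1) dead) (paint 1)) dead) (paint 1)) (br 6 (br 7
      (br 8 (br 9 dead dead) (br 9 dead dead)) dead) dead)) dead)) dead)) (br 1 (br 2 (br 3 (br 4 (br 5 (br 6 dead (br
      7 dead (br 8 (br 9 dead dead) dead))) (br 6 (br 7 (br 8 dead (br 9 dead dead)) dead) dead)) (br 5 (br 6 (br 9
      (br 7 (br 8 (paint 0) dead) (br 8 dead dead)) dead) (br 8 (br 7 (br 9 dead dead) (br 9 dead dead)) dead)) (br 6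
      (br 7 (br 8 (paint 0) (br 9 dead dead)) dead) dead))) (br 4 (br 5 (br 6 (br 9 (br 7 (br 8 (paint 0) dead) (br 8
      dead dead)) dead) (br 8 (br 7 (br 9 dead dead) (br 9 dead dead)) dead)) (br 6 (br 7 (br 8 (paint 0) (br 9 dead
      dead)) dead) dead)) dead)) dead) dead))) ∷
  step (9 ∷ 1 ∷ 65 ∷ 1 ∷ 16 ∷ 9 ∷ 1 ∷ 1 ∷ 1 ∷ 0 ∷ [])
        (0xba321000 ∷ 0x71001 ∷ 0x21001 ∷ 0x91001 ∷ 0x41001 ∷ 0x87431000 ∷ 0x98001 ∷ 0xa6001 ∷ 0x31001 ∷ 0x81001 ∷
      0x87651000 ∷ 0xa6218000 ∷ 0x76431000 ∷ 0x98321000 ∷ 0x98651000 ∷ 0x51001 ∷ 0x76549000 ∷ 0xa5001 ∷ 0x76325000 ∷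
      0x87325000 ∷ 0x98216000 ∷ 0x76219000 ∷ 0x76513000 ∷ 0xa3001 ∷ 0x8721a000 ∷ 0x43001 ∷ 0x54001 ∷ 0x76214000 ∷
      0x87214000 ∷ 0xa9214000 ∷ 0xa539640128702 ∷ 0x87513000 ∷ 0x98546000 ∷ 0x87a31000 ∷ [])
        (coloured (plain (3 ∷ 0 ∷ 3 ∷ 0 ∷ 2 ∷ 1 ∷ 0 ∷ 1 ∷ 2 ∷ 0 ∷ [])) (br 6 (br 1 (br 3 (br 4 (br 8 (br 9 (br 0 (br 2
      (br 5 (br 7 (paint 0) dead) (br 7 dead (paint 0))) (br 5 dead (paint 0))) (br 2 (br 5 dead (br 7 dead (paint
      2))) (br 5 (br 7 (paint 2) (paint 0)) (br 7 dead (paint 2))))) (br 2 (br 5 (br 0 (br 7 dead (paint 2)) dead)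
      dead) dead)) (br 5 dead (br 7 (br 9 (br 0 (br 2 dead dead) (br 2 dead (paint 0))) dead) dead))) (br 0 (br 9 (br
      2 (br 5 dead (br 7 dead (br 8 (paint 0) dead))) (br 5 (br 7 (br 8 (paint 0) dead) dead) (br 7 (paint 0) (br 8
      (paint 0) dead)))) dead) dead)) (br 2 (br 4 (br 0 (br 5 dead (br 7 dead (br 8 (br 9 dead dead) dead))) (br 5
      (paint 2) (br 9 (br 7 dead (paint 2)) dead))) dead) dead)) (paint 3)) (paint 1))) ∷
  -- A 5-cycle and a disjoint path on four vertices.
  step (9 ∷ 1 ∷ 1 ∷ 1 ∷ 0 ∷ 1 ∷ 1 ∷ 1 ∷ 0 ∷ [])
        (0x21001 ∷ 0x91001 ∷ 0x43b28000 ∷ 0x81001 ∷ 0x87321000 ∷ 0x41001 ∷ 0xa9321000 ∷ 0x87325000 ∷ 0x31001 ∷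
      0x98216000 ∷ 0x76219000 ∷ 0x435218796003 ∷ 0x87513000 ∷ 0x98765432104 ∷ 0x87214000 ∷ 0x76001 ∷ 0x87001 ∷ 0x98001
      ∷ 0x76325000 ∷ 0x54001 ∷ 0x76214000 ∷ 0x43001 ∷ 0x76513000 ∷ [])
        (coloured ((col 0 1) ∷ (col 0 0) ∷ (col 0 1) ∷ (spl 1 2 3) ∷ (col 0 0) ∷ (col 0 2) ∷ (col 0 3) ∷ (col 1 2) ∷
      (col 0 3) ∷ []) (br 0 (br 1 (br 6 (br 7 (br 3 (br 8 (br 5 (br 2 (br 4 (leaf (spl 1 2 3)) dead) (leaf (spl 1 2
      3))) dead) (br 5 dead (br 2 (br 4 dead dead) (br 4 dead dead)))) dead) (br 8 (br 2 (br 3 (br 4 (br 5 (paint 3)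
      (paint 3)) (br 5 dead (paint 3))) (br 4 (br 5 dead (paint 3)) dead)) (br 3 (br 4 (br 5 dead (paint 3)) (br 5
      (paint 3) (paint 3))) dead)) dead)) (br 7 (br 5 (br 8 (paint 2) (br 2 (br 3 (leaf (col 1 2)) (leaf (col 1 2)))
      (leaf (col 1 2)))) dead) dead)) (paint 1)) (paint 0))) ∷
  step (137 ∷ 1 ∷ 33 ∷ 1 ∷ 0 ∷ 5 ∷ 1 ∷ 0 ∷ 0 ∷ [])
        (0x21001 ∷ 0x71001 ∷ 0xa7651000 ∷ 0x76b2a000 ∷ 0x51001 ∷ 0x91001 ∷ 0x76513000 ∷ 0x81001 ∷ 0x61001 ∷
      0x87016543205 ∷ 0x73925000 ∷ 0x65923000 ∷ 0x41001 ∷ 0x98651000 ∷ 0x96548000 ∷ 0x87549000 ∷ 0x967803215404 ∷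
      0x76542000 ∷ 0x87001 ∷ 0x76001 ∷ 0x96001 ∷ 0x93001 ∷ 0x32001 ∷ 0x76431000 ∷ 0x87605432105 ∷ 0x87542000 ∷
      0x8901a456205 ∷ [])
        (coloured ((col 0 1) ∷ (spl 1 2 3) ∷ (col 0 0) ∷ (col 0 1) ∷ (col 0 0) ∷ (col 1 2) ∷ (col 0 3) ∷ (col 0 2) ∷
      (col 0 3) ∷ []) (br 3 (br 4 (br 6 (br 5 (br 1 (br 8 (br 7 (br 0 (br 2 (leaf (spl 1 2 3)) dead) (br 2 dead (leaf
      (spl 1 2 3)))) dead) (br 7 dead (br 0 (br 2 dead dead) dead))) dead) (br 8 (br 0 (br 1 (br 2 (br 7 dead (paint
      3)) (paint 3)) (br 2 (br 7 dead (paint 3)) dead)) (br 1 (br 2 (paint 3) (br 7 (paint 3) (paint 3))) dead))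
      dead)) (br 5 (br 7 (br 8 (paint 2) (br 0 (br 2 (leaf (col 1 2)) dead) dead)) dead) dead)) (paint 1)) (paint 0)))
      ∷
  -- A 5-cycle and a disjoint path 5, 6, 7. One end of the path is dominated by the other: a further
  -- vertex adjacent to 5 alone, for instance, would lengthen the path to four vertices, which is an
  -- earlier graph.
  step (9 ∷ 1 ∷ 1 ∷ 1 ∷ 0 ∷ 1 ∷ 1 ∷ 0 ∷ [])
        (0x87605432105 ∷ 0x87325000 ∷ 0x87513000 ∷ 0x8762154306 ∷ 0x87214000 ∷ 0x87542000 ∷ 0x8763451206 ∷
      0x8761543206 ∷ 0x54001 ∷ 0x32001 ∷ 0x87431000 ∷ 0x8762345106 ∷ 0x8765432106 ∷ 0x43001 ∷ 0x51001 ∷ 0x21001 ∷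
      0x76001 ∷ [])
        (dominated 5 7 (br 6 (br 0 (br 1 (br 3 (br 2 (br 4 dead dead) (br 4 dead dead)) dead) (br 2 (br 3 (br 4 dead
      dead) (br 4 dead dead)) dead)) (br 1 (br 4 (br 2 (br 3 dead dead) (br 3 dead dead)) dead) dead)) dead)) ∷
  step (521 ∷ 513 ∷ 49 ∷ 193 ∷ 12 ∷ 51 ∷ 2 ∷ 2 ∷ 7 ∷ 0 ∷ 0 ∷ 0 ∷ [])
        (0xb1001 ∷ 0x61001 ∷ 0x51001 ∷ 0x31001 ∷ 0x97321000 ∷ 0x96d31000 ∷ 0x76001 ∷ 0xa8321000 ∷ 0x41001 ∷ 0xa8217000
      ∷ 0x21001 ∷ 0x54001 ∷ 0x85c27000 ∷ 0x86001 ∷ 0xc6001 ∷ 0x43001 ∷ 0x83001 ∷ 0x93001 ∷ 0x76325000 ∷ 0xa9216000 ∷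
      0x7654a000 ∷ 0xb6001 ∷ 0x94c21000 ∷ 0x87431000 ∷ 0x71001 ∷ 0xd1001 ∷ 0x83b17000 ∷ 0xb4001 ∷ 0xb632a000 ∷
      0x85c2b000 ∷ 0x76431000 ∷ 0x7605432107 ∷ 0xc2001 ∷ 0xc4001 ∷ 0x95001 ∷ 0x86219000 ∷ 0x32001 ∷ 0x2108a97607 ∷
      0x83b1c000 ∷ 0x80762154306 ∷ 0x76513000 ∷ 0xa8b47000 ∷ 0x85001 ∷ 0xa8001 ∷ 0x76542000 ∷ 0x6705432107 ∷
      0xa8c47000 ∷ 0xc651a000 ∷ 0x97218000 ∷ 0xa8b42000 ∷ 0xb9001 ∷ 0xa9001 ∷ 0xa80b4c2107 ∷ 0xc9001 ∷ 0x76214000 ∷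
      0xa9214000 ∷ 0x97001 ∷ [])
        (coloured (plain (2 ∷ 0 ∷ 2 ∷ 0 ∷ 1 ∷ 3 ∷ 1 ∷ 0 ∷ 0 ∷ 3 ∷ 1 ∷ 1 ∷ [])) (br 0 (br 2 (br 7 (br 11 (br 1 (br 4
      (br 6 (br 10 (br 3 (br 5 (paint 1) dead) (paint 1)) dead) dead) (br 3 (br 8 (br 5 (br 6 dead (br 9 dead (paint
      0))) (br 6 (br 9 dead (paint 0)) dead)) dead) dead)) (br 3 (br 4 (br 5 (br 6 dead (br 9 dead dead)) (br 6 (br 10
      (br 9 dead (br 8 (paint 2) dead)) dead) dead)) (paint 2)) (br 4 (br 10 (br 6 (br 5 (paint 2) (paint 1)) dead)
      dead) dead))) (br 1 (br 3 (br 5 (br 8 (br 10 dead (br 4 (br 6 (br 9 (paint 0) dead) dead) (br 6 dead (br 9 dead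
      (paint 0))))) dead) dead) dead) dead)) (br 4 (br 5 (br 9 (br 1 (br 3 (br 6 (br 8 dead (br 10 (br 11 dead dead)
      dead)) dead) (br 6 dead (br 8 dead dead))) (paint 2)) dead) dead) dead)) (br 1 (br 3 (br 7 (br 8 (br 4 (br 5 (br
      6 dead (br 9 dead (paint 0))) (br 6 (br 9 dead (br 10 (paint 0) dead)) dead)) (br 5 (paint 0) (br 6 (paint 0)
      dead))) dead) dead) dead) dead)) (br 1 (br 4 (br 10 (br 5 (br 2 (br 9 (br 6 (br 3 dead (paint 1)) (paint 3))
      dead) (br 3 (br 7 (br 8 (br 6 (br 9 dead dead) (br 9 dead (br 11 dead (paint 0)))) dead) dead) dead)) (br 6 (br
      7 (br 11 (paint 1) dead) dead) dead)) dead) dead) dead))) ∷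
  step (521 ∷ 513 ∷ 49 ∷ 193 ∷ 12 ∷ 51 ∷ 2 ∷ 2 ∷ 3 ∷ 0 ∷ 0 ∷ 0 ∷ [])
        (0xb1001 ∷ 0x81001 ∷ 0x31001 ∷ 0x87321000 ∷ 0x51001 ∷ 0xc6001 ∷ 0x61001 ∷ 0xb6001 ∷ 0x83001 ∷ 0x7621a000 ∷
      0x85001 ∷ 0x76001 ∷ 0xa9216000 ∷ 0xc651a000 ∷ 0xc7431000 ∷ 0x41001 ∷ 0xd1001 ∷ 0x93001 ∷ 0x95001 ∷ 0x97001 ∷
      0xb632a000 ∷ 0x86001 ∷ 0x97c41000 ∷ 0xa8b47000 ∷ 0xc6931000 ∷ 0xa9001 ∷ 0x32001 ∷ 0xc2001 ∷ 0x76513000 ∷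
      0xa8217000 ∷ 0x54001 ∷ 0xa8b42000 ∷ 0x43001 ∷ 0x71001 ∷ 0xa8d51000 ∷ 0xbad51000 ∷ 0xbad71000 ∷ 0x21001 ∷
      0x7605432107 ∷ 0x76325000 ∷ 0x86219000 ∷ 0x76431000 ∷ 0x83b1c000 ∷ 0x85c2b000 ∷ 0xa8c41000 ∷ 0x97218000 ∷
      0xb9001 ∷ 0x30a81b4c206 ∷ 0x76542000 ∷ 0x1208a97607 ∷ 0x7643a000 ∷ 0x6705432107 ∷ 0x86214000 ∷ 0xa9214000 ∷
      0xa8001 ∷ 0xa8c47000 ∷ 0x50a82c4b106 ∷ 0xa8b1c000 ∷ 0x8a0b4c2107 ∷ 0xa8c2b000 ∷ 0x2108a97607 ∷ 0x7654a000 ∷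
      0xc4001 ∷ 0xa1001 ∷ [])
        (coloured (plain (3 ∷ 0 ∷ 1 ∷ 0 ∷ 1 ∷ 0 ∷ 1 ∷ 3 ∷ 2 ∷ 0 ∷ 1 ∷ 1 ∷ [])) (br 0 (br 6 (br 3 (br 1 (br 2 (br 4 (br
      5 (br 9 (br 7 (br 8 (br 10 (br 11 (paint 0) dead) (br 11 dead (paint 0))) dead) (br 8 dead (br 10 (paint 0)
      dead))) dead) dead) (br 5 dead (br 7 (br 8 (br 9 dead (br 10 (br 11 dead dead) dead)) dead) dead))) (br 7 (br 8
      (br 10 (br 4 (br 5 dead (br 9 dead (br 11 dead dead))) (br 5 (br 9 (br 11 (paint 2) dead) dead) (br 9 dead (br
      11 dead dead)))) (br 5 (br 4 dead (br 9 (br 11 dead (paint 0)) dead)) dead)) dead) dead)) (br 2 (br 11 (br 4 (br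
      5 dead (br 7 (br 10 (br 9 dead (br 8 (paint 2) dead)) dead) dead)) (br 7 (br 8 (br 5 (br 9 dead dead) (br 10 (br
      9 dead (paint 2)) dead)) dead) dead)) dead) dead)) (paint 1)) (br 5 (br 8 (br 1 (br 2 (br 3 (br 4 dead (br 7 (br
      9 dead (br 10 dead (paint 2))) dead)) (br 4 (br 7 dead (br 9 dead dead)) dead)) (br 3 (br 7 (br 9 dead (br 4 (br
      11 dead (paint 2)) (paint 2))) dead) dead)) (br 2 (br 11 (br 3 (br 4 (br 9 (br 7 dead (paint 2)) dead) (paint
      2)) (br 4 (br 9 (paint 2) dead) dead)) dead) dead)) dead) dead)) (br 1 (br 4 (br 10 (br 2 (br 3 (br 5 (br 6 dead
      (br 8 (br 9 (br 7 dead (br 11 dead (paint 0))) dead) dead)) (br 6 (br 7 (br 11 (br 8 dead (br 9 dead dead))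
      dead) dead) dead)) (br 11 (br 5 (br 8 dead (paint 1)) (paint 1)) dead)) (br 3 (br 7 (br 8 (br 5 (br 6 (br 9 dead
      dead) (br 9 dead (paint 2))) (br 6 (br 11 dead dead) dead)) dead) dead) dead)) dead) dead) dead))) ∷
  step (521 ∷ 513 ∷ 49 ∷ 193 ∷ 12 ∷ 19 ∷ 2 ∷ 2 ∷ 7 ∷ 0 ∷ 0 ∷ 0 ∷ [])
        (0x71001 ∷ 0x51001 ∷ 0x81001 ∷ 0xc1001 ∷ 0x21001 ∷ 0x31001 ∷ 0x94c21000 ∷ 0x76001 ∷ 0x96d31000 ∷ 0x32001 ∷
      0xa9001 ∷ 0x86001 ∷ 0x93001 ∷ 0x43001 ∷ 0x54001 ∷ 0xa8321000 ∷ 0x41001 ∷ 0xb9c51000 ∷ 0x97321000 ∷ 0x91001 ∷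
      0x83b1c000 ∷ 0x83001 ∷ 0xa9216000 ∷ 0x76325000 ∷ 0x7643a000 ∷ 0x85001 ∷ 0xc2001 ∷ 0xb6c2a000 ∷ 0xb1001 ∷
      0xa8c41000 ∷ 0xc9001 ∷ 0xc4001 ∷ 0x30a81b4c206 ∷ 0x76513000 ∷ 0x7605432107 ∷ 0x86219000 ∷ 0x76214000 ∷
      0x97214000 ∷ 0x7621a000 ∷ 0xa8214000 ∷ 0x76c25000 ∷ 0xa8b1c000 ∷ 0xa8001 ∷ 0xa8b42000 ∷ 0xb0762345106 ∷
      0xa80b4c2107 ∷ 0x7651c000 ∷ 0x7651a000 ∷ 0xb4001 ∷ 0xb6001 ∷ 0x83b17000 ∷ 0xb9001 ∷ 0x6705432107 ∷ 0xa8217000 ∷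
      0x97218000 ∷ 0x76542000 ∷ 0x1208a97607 ∷ 0xba862c40106 ∷ [])
        (coloured (plain (0 ∷ 3 ∷ 1 ∷ 0 ∷ 1 ∷ 0 ∷ 2 ∷ 2 ∷ 0 ∷ 1 ∷ 1 ∷ 1 ∷ [])) (br 10 (br 0 (br 7 (br 6 (br 1 (br 2
      (br 11 (br 3 (br 9 (br 4 (br 5 (br 8 (paint 2) dead) dead) (br 5 dead (paint 2))) dead) (br 4 (br 5 dead (br 8
      dead (br 9 dead dead))) dead)) dead) (br 3 (br 8 (br 4 (br 5 dead (br 9 dead (paint 2))) (br 5 (br 9 (br 11 dead
      dead) dead) (br 9 dead (paint 2)))) dead) dead)) (br 2 (br 11 (br 9 (br 3 dead (br 4 (br 5 (paint 1) (paint 1))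
      dead)) (br 8 (br 3 (br 5 dead (paint 2)) (br 4 (br 5 dead (paint 2)) dead)) dead)) dead) dead)) (br 2 dead (br 1
      (br 3 (br 5 (br 8 (br 9 dead (br 11 dead (br 4 (paint 0) (paint 0)))) dead) dead) dead) dead))) (br 2 (br 4 (br
      5 (br 9 (br 1 (br 3 (br 6 (br 11 dead dead) dead) (paint 1)) (br 11 (br 3 (paint 1) (paint 1)) dead)) dead)
      dead) dead) dead)) (br 1 (br 4 (br 2 (br 3 (br 5 (paint 3) (br 6 (br 7 (br 8 (br 9 (paint 2) (br 11 (paint 2)
      (paint 3))) (br 9 (br 11 dead dead) dead)) dead) dead)) (br 11 (br 5 (br 9 (br 7 dead (paint 1)) dead) (br 6 (br
      7 (paint 2) dead) dead)) dead)) (br 3 (br 7 (br 8 (br 5 (paint 3) (br 6 (br 9 (paint 2) (br 11 (paint 2) (paint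
      3))) dead)) dead) dead) dead)) dead) dead)) (br 0 (br 3 (br 5 (br 8 (br 1 (br 2 (br 4 (br 6 (br 7 (paint 0)
      dead) dead) (br 6 dead (paint 0))) (paint 0)) (br 2 (br 11 (br 4 (br 6 dead (paint 0)) (br 7 (br 6 (br 9 dead
      dead) (paint 0)) dead)) dead) dead)) dead) dead) dead) dead))) ∷
  step (521 ∷ 1 ∷ 49 ∷ 65 ∷ 12 ∷ 19 ∷ 2 ∷ 2 ∷ 3 ∷ 0 ∷ 0 ∷ [])
        (0xb9321000 ∷ 0x21001 ∷ 0x91001 ∷ 0xb1001 ∷ 0xca624000 ∷ 0xb9c51000 ∷ 0xc1001 ∷ 0x51001 ∷ 0xa8b42000 ∷
      0xa8214000 ∷ 0x512049a86704 ∷ 0xba9876543210a ∷ 0xba98765432109 ∷ 0x35796a8b402108 ∷ 0x54001 ∷ 0x32001 ∷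
      0xa8b17000 ∷ 0xb4001 ∷ 0xb6001 ∷ 0xb9001 ∷ [])
        (coloured ((col 0 3) ∷ (col 0 2) ∷ (col 0 0) ∷ (col 0 3) ∷ (col 0 0) ∷ (col 0 0) ∷ (spl 1 2 3) ∷ (col 0 1) ∷
      (col 0 1) ∷ (col 0 0) ∷ (col 1 2) ∷ []) (br 7 (br 9 (br 0 (br 10 (br 6 (br 3 (br 1 (br 2 (leaf (spl 1 2 3))
      (leaf (spl 1 2 3))) dead) (br 1 dead (br 2 (br 4 (br 5 (br 8 dead dead) (br 8 dead dead)) dead) dead))) dead)
      (br 3 (br 5 (br 8 (br 1 (paint 3) (paint 3)) dead) dead) dead)) (br 10 (br 1 (br 4 (br 3 (paint 2) (leaf (col 1
      2))) dead) dead) dead)) (paint 1)) (paint 0))) ∷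
  step (521 ∷ 1 ∷ 49 ∷ 65 ∷ 12 ∷ 19 ∷ 2 ∷ 2 ∷ 1 ∷ 1 ∷ 0 ∷ [])
        (0xc1001 ∷ 0x21001 ∷ 0x97321000 ∷ 0xa1001 ∷ 0x81001 ∷ 0xa8c21000 ∷ 0x54001 ∷ 0xb6952000 ∷ 0x85001 ∷ 0x31001 ∷
      0x86001 ∷ 0x76001 ∷ 0x32001 ∷ 0xb4001 ∷ 0xa8001 ∷ 0x83001 ∷ 0x51001 ∷ 0x71001 ∷ 0xa8c51000 ∷ 0xb1001 ∷
      0x97214000 ∷ 0x97b42000 ∷ 0x97001 ∷ 0xb6001 ∷ 0xba001 ∷ 0x6705432107 ∷ 0x1208a97607 ∷ 0x86214000 ∷ 0xa9214000 ∷
      0x43001 ∷ 0x453129a8670b ∷ 0x76325000 ∷ 0x83b17000 ∷ 0x93001 ∷ 0x95001 ∷ 0xa9001 ∷ 0xa8214000 ∷ 0x76214000 ∷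
      0x86219000 ∷ 0x7605432107 ∷ 0x76542000 ∷ 0x97218000 ∷ 0x87621000 ∷ [])
        (coloured (plain (0 ∷ 2 ∷ 3 ∷ 0 ∷ 2 ∷ 0 ∷ 1 ∷ 1 ∷ 0 ∷ 3 ∷ 1 ∷ [])) (br 0 (br 6 (br 7 (br 8 (br 10 (br 1 (br 3
      (paint 1) dead) (br 2 (br 3 dead (br 4 (br 5 dead (paint 1)) dead)) dead)) (br 3 (br 5 (br 9 (br 1 (br 2 (br 4
      (paint 0) dead) (paint 0)) dead) dead) dead) dead)) (br 2 (br 4 (br 9 (br 1 (br 3 (br 5 dead dead) dead) (br 3
      (br 5 dead (paint 3)) (paint 3))) dead) dead) dead)) (br 2 (br 4 (br 5 (br 9 (br 1 (br 3 (br 8 dead (paint 3))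
      dead) (paint 3)) dead) dead) dead) dead)) (br 5 (br 8 (br 1 (br 2 (br 3 (br 4 dead (br 7 (paint 0) dead)) (br 4
      (br 7 dead (br 9 dead dead)) dead)) (br 3 (br 7 (paint 0) dead) dead)) (br 2 (br 3 (br 4 (br 10 dead (paint 0))
      (br 7 (br 9 (br 10 dead (paint 0)) dead) dead)) (br 4 (br 10 dead dead) dead)) dead)) dead) dead)) (br 1 (br 4
      (br 10 (br 3 (br 5 (paint 2) (br 6 (br 7 (br 8 (paint 1) (paint 2)) dead) dead)) (paint 2)) dead) dead) dead)))
      ∷
  step (521 ∷ 1 ∷ 49 ∷ 65 ∷ 12 ∷ 19 ∷ 2 ∷ 2 ∷ 1 ∷ 0 ∷ 0 ∷ [])
        (0x81001 ∷ 0xc1001 ∷ 0x71001 ∷ 0x51001 ∷ 0xa1001 ∷ 0x21001 ∷ 0xbac71000 ∷ 0xb632a000 ∷ 0x76214000 ∷ 0x97218000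
      ∷ 0x7621a000 ∷ 0xb4001 ∷ 0x43001 ∷ 0x83001 ∷ 0x32001 ∷ 0x76542000 ∷ 0x54001 ∷ 0xb6952000 ∷ 0x86001 ∷ 0xa8b42000
      ∷ 0xb6001 ∷ 0x41001 ∷ 0xb1001 ∷ 0x97321000 ∷ 0x87431000 ∷ 0xb6325000 ∷ 0xb0762345106 ∷ 0x6705432107 ∷ 0xa9214000
      ∷ 0xa8217000 ∷ 0x76325000 ∷ 0x85001 ∷ 0x1208a97607 ∷ 0x7643a000 ∷ 0x93001 ∷ 0x95001 ∷ 0x97001 ∷ 0xa9001 ∷
      0x7605432107 ∷ 0x76431000 ∷ 0x321049a86704 ∷ 0x76001 ∷ 0x97214000 ∷ 0xa9216000 ∷ 0x97b42000 ∷ 0x2108a97607 ∷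
      0x7654a000 ∷ 0xa8b47000 ∷ 0x435219a8670b ∷ 0x453129a8670b ∷ [])
        (coloured (plain (1 ∷ 3 ∷ 0 ∷ 1 ∷ 0 ∷ 1 ∷ 0 ∷ 2 ∷ 1 ∷ 0 ∷ 2 ∷ [])) (br 8 (br 5 (br 1 (br 10 (br 0 (br 6 (br 3
      (br 7 (br 9 (paint 3) dead) dead) dead) (br 2 (br 4 (br 3 dead (br 9 dead dead)) dead) (br 3 (br 7 (br 9 dead
      (paint 1)) dead) dead))) (br 4 (br 2 (br 9 (br 6 (br 3 dead (br 7 dead (paint 0))) (paint 3)) dead) (br 3 (br 7
      (br 6 (br 9 dead dead) (br 9 dead dead)) dead) dead)) dead)) (br 0 (br 3 (br 2 (br 4 (br 6 (br 7 (br 9 (paint 1)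
      dead) dead) dead) (br 6 dead (paint 1))) (paint 1)) dead) dead)) (br 0 (br 2 (br 3 (br 4 (br 6 dead (br 10 dead
      (paint 1))) (br 7 (br 6 (br 9 dead dead) (br 9 (br 10 dead (paint 1)) dead)) dead)) (br 4 (br 10 dead dead)
      dead)) dead) dead)) (br 6 (br 7 (br 10 (br 0 (br 1 (br 3 (br 9 dead (br 2 (paint 2) (paint 2))) dead) (br 2 (br
      3 dead (br 4 (paint 2) dead)) dead)) (paint 2)) dead) dead) dead)) (br 2 (br 4 (br 6 (br 9 (br 0 (br 1 (br 3 (br
      5 (paint 0) dead) (br 5 dead (paint 0))) (br 3 (br 5 dead (br 7 (br 10 dead dead) dead)) (paint 0))) (paint 0))
      dead) dead) dead) dead))) ∷
  step (521 ∷ 1 ∷ 49 ∷ 65 ∷ 12 ∷ 3 ∷ 2 ∷ 2 ∷ 3 ∷ 0 ∷ 0 ∷ [])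
        (0xc1001 ∷ 0x21001 ∷ 0x91001 ∷ 0xb9c51000 ∷ 0xa9001 ∷ 0x41001 ∷ 0x93001 ∷ 0x54001 ∷ 0xa8b42000 ∷ 0x71001 ∷
      0xa8321000 ∷ 0x51001 ∷ 0x32001 ∷ 0x43001 ∷ 0x760b432107 ∷ 0x76b13000 ∷ 0x76325000 ∷ 0x86219000 ∷ 0x76431000 ∷
      0x7621a000 ∷ 0x76214000 ∷ 0x97214000 ∷ 0xa8214000 ∷ 0x76542000 ∷ 0x37681b40206 ∷ 0x453128a9760d ∷ 0xa9876345120d
      ∷ 0xa9876345120c ∷ 0xb0a9876345120a ∷ 0xb1001 ∷ 0xb4001 ∷ 0xb9001 ∷ 0x76b42000 ∷ 0x95001 ∷ 0x7632b000 ∷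
      0xb6702345106 ∷ 0x76513000 ∷ 0x453128a9760b ∷ 0x76001 ∷ 0x97001 ∷ 0xb9862000 ∷ 0xa8217000 ∷ 0x921b68a0706 ∷ [])
        (coloured (plain (1 ∷ 3 ∷ 0 ∷ 1 ∷ 0 ∷ 0 ∷ 2 ∷ 1 ∷ 1 ∷ 0 ∷ 2 ∷ [])) (br 7 (br 10 (br 6 (br 0 (br 1 (br 2 (br 3
      (br 5 (br 4 (br 8 (br 9 (paint 2) dead) dead) dead) dead) (br 4 (br 5 dead (br 8 dead (br 9 dead dead))) dead))
      (br 3 (br 5 dead (br 8 (paint 2) dead)) dead)) (br 2 (br 4 (br 3 (br 5 dead (br 9 dead (br 8 dead dead))) (br 5
      dead (br 8 (br 9 dead dead) (br 9 dead dead)))) (br 3 (br 5 dead (br 8 (br 9 dead dead) dead)) dead)) dead)) (br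
      1 (br 4 (br 3 (br 9 (br 2 (br 5 dead (paint 2)) (br 8 (paint 2) dead)) (paint 3)) (paint 3)) dead) dead)) (br 5
      (br 8 (br 1 (br 0 (br 9 dead dead) (paint 3)) dead) dead) dead)) (br 0 (br 3 (br 8 (br 1 (br 2 (br 4 (br 5 (br 6
      dead dead) (paint 1)) (paint 1)) (br 4 (br 5 (br 6 dead (paint 1)) (paint 1)) (paint 1))) (paint 1)) dead) dead)
      dead)) (paint 0))) ∷
  step (9 ∷ 1 ∷ 49 ∷ 1 ∷ 12 ∷ 3 ∷ 2 ∷ 2 ∷ 1 ∷ 0 ∷ [])
        (0xa9001 ∷ 0x76001 ∷ 0x97001 ∷ 0x86214000 ∷ 0x97214000 ∷ 0xa8214000 ∷ 0x512049a86704 ∷ 0xa9876345120e ∷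
      0x7651a000 ∷ 0xa8967345120d ∷ 0xa8967345120c ∷ 0xa9876345120d ∷ 0xa9876345120c ∷ 0xa9876345120b ∷ 0x321049a86704
      ∷ 0xa9876543210e ∷ 0x7632a000 ∷ 0xa8967543210d ∷ 0xa8967543210c ∷ 0xa9876543210d ∷ 0xa9876543210c ∷
      0xa9876543210b ∷ 0x21001 ∷ 0x54001 ∷ 0x43001 ∷ [])
        (dominated 3 7 (br 2 (br 4 (br 0 (br 1 (br 5 dead (br 6 (br 8 dead (br 9 dead dead)) dead)) (br 5 (br 6 (br 9
      (br 8 dead dead) dead) (br 8 (br 9 dead dead) dead)) (br 6 (br 8 (br 9 dead dead) (br 9 dead dead)) dead))) (br
      1 (br 5 (br 6 (br 9 (br 8 dead dead) dead) (br 8 (br 9 dead dead) dead)) (br 6 (br 8 (br 9 dead dead) (br 9 dead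
      dead)) dead)) dead)) dead) dead)) ∷
  step (9 ∷ 1 ∷ 49 ∷ 1 ∷ 4 ∷ 3 ∷ 2 ∷ 2 ∷ 1 ∷ 0 ∷ [])
        (0x81001 ∷ 0xa1001 ∷ 0x21001 ∷ 0x61001 ∷ 0xba651000 ∷ 0x86001 ∷ 0x93516000 ∷ 0x76001 ∷ 0x85001 ∷ 0xa8651000 ∷
      0x76431000 ∷ 0x93001 ∷ 0x83001 ∷ 0x43001 ∷ 0x97001 ∷ 0xa8001 ∷ 0x54001 ∷ 0x32001 ∷ 0x51001 ∷ 0xa8961000 ∷
      0x87431000 ∷ 0x97542000 ∷ 0x97218000 ∷ 0x7621a000 ∷ 0xa9001 ∷ 0x76214000 ∷ 0x7605432107 ∷ 0x76325000 ∷
      0x76513000 ∷ 0x7643a000 ∷ 0x1208a97607 ∷ 0xa9216000 ∷ 0x345129a06704 ∷ 0x36791540206 ∷ 0x6705432107 ∷ 0xa8217000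
      ∷ 0x86214000 ∷ 0xa9214000 ∷ 0xa9542000 ∷ 0x7654a000 ∷ [])
        (coloured (plain (0 ∷ 1 ∷ 2 ∷ 0 ∷ 1 ∷ 3 ∷ 0 ∷ 0 ∷ 3 ∷ 2 ∷ [])) (br 0 (br 6 (br 2 (br 3 (br 4 (br 8 (br 1 (br 5
      (br 7 (br 9 (paint 1) dead) dead) dead) dead) (br 9 (br 1 (br 5 (paint 2) dead) (paint 2)) dead)) (br 7 (br 1
      (br 5 dead (br 8 (paint 0) (paint 0))) (br 5 (br 9 (br 8 dead (paint 0)) dead) (paint 0))) dead)) (br 4 (br 1
      (br 5 dead (br 7 (br 8 dead (paint 2)) dead)) (br 5 (br 8 dead (paint 2)) (br 7 (br 8 dead (paint 2)) dead)))
      dead)) (br 1 (br 3 (br 7 (br 8 (br 4 (br 5 dead (br 9 dead dead)) (paint 0)) dead) dead) dead) dead)) (br 5 (br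
      8 (br 1 (br 2 (br 3 (br 4 dead (br 7 (br 9 dead (paint 3)) dead)) (br 4 (br 7 dead (br 9 dead dead)) dead))
      (paint 3)) (br 2 (br 3 (br 4 (br 9 dead (paint 3)) (br 7 (br 9 (paint 3) (paint 3)) dead)) (paint 3)) dead))
      dead) dead)) (br 1 (br 4 (br 2 (br 3 (br 7 (br 8 (br 5 (br 6 dead (br 9 (paint 1) (paint 3))) (br 6 (paint 1)
      dead)) (paint 2)) (br 5 (br 6 dead (br 8 (br 9 (paint 1) dead) dead)) dead)) (br 6 (br 5 (paint 1) (br 7 (br 8
      (paint 1) (paint 2)) dead)) (paint 3))) (br 3 (br 7 (br 8 (br 5 (br 9 (paint 1) (br 6 dead (paint 3))) (br 6
      (paint 1) dead)) dead) dead) dead)) dead) dead))) ∷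
  step (9 ∷ 1 ∷ 17 ∷ 1 ∷ 8 ∷ 3 ∷ 2 ∷ 2 ∷ 1 ∷ 0 ∷ [])
        (0x51001 ∷ 0x31001 ∷ 0x81001 ∷ 0x41001 ∷ 0x91001 ∷ 0xb1001 ∷ 0xba541000 ∷ 0x86001 ∷ 0x71001 ∷ 0x21001 ∷
      0xa8001 ∷ 0x76001 ∷ 0x95001 ∷ 0x97001 ∷ 0xa9001 ∷ 0x54001 ∷ 0x83001 ∷ 0x43001 ∷ 0xa8217000 ∷ 0xa8547000 ∷
      0x76431000 ∷ 0x87321000 ∷ 0x87621000 ∷ 0x76214000 ∷ 0x86214000 ∷ 0xa9214000 ∷ 0x97214000 ∷ 0xa8214000 ∷ 0x32001
      ∷ 0x6705432107 ∷ 0x76513000 ∷ 0x7621a000 ∷ 0x86219000 ∷ 0x1208a97607 ∷ 0x345128a07604 ∷ 0x76325000 ∷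
      0x7605432107 ∷ 0x7654a000 ∷ 0xa9216000 ∷ 0x543219a06704 ∷ 0x95326000 ∷ 0x97831000 ∷ 0xa9436000 ∷ 0xa9431000 ∷
      0x86542000 ∷ 0x213548a07610 ∷ 0x76542000 ∷ 0xa8542000 ∷ 0x9a8675402104 ∷ 0xa89675402110 ∷ [])
        (coloured (plain (2 ∷ 0 ∷ 1 ∷ 0 ∷ 1 ∷ 2 ∷ 0 ∷ 0 ∷ 3 ∷ 1 ∷ [])) (br 0 (br 1 (br 3 (br 5 (br 4 (br 2 (br 6 (br 9
      (br 7 (br 8 (paint 2) dead) (paint 2)) dead) dead) (br 6 dead (br 7 (br 9 dead dead) dead))) (br 8 (br 6 (br 2
      dead (paint 0)) (br 7 (br 9 dead (paint 3)) (br 2 (br 9 (paint 2) dead) dead))) dead)) (br 6 (br 7 (br 2 (br 4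
      dead (br 8 (br 9 dead dead) dead)) (paint 0)) dead) dead)) (br 2 (br 4 (br 5 (br 6 dead (br 7 dead (br 8 (br 9
      dead dead) dead))) (br 6 (br 7 (br 8 dead (br 9 dead dead)) dead) dead)) dead) dead)) (br 2 (br 8 (br 9 (br 5
      (br 6 (br 7 dead (br 3 (paint 2) (br 4 (paint 2) dead))) (br 3 (br 7 (paint 3) (paint 2)) (paint 3))) (br 3 dead
      (br 4 (br 6 (br 7 (paint 1) dead) dead) dead))) (br 7 (br 3 (br 4 (br 5 dead (paint 3)) (paint 3)) (paint 3))
      dead)) (br 4 (br 6 (br 9 (br 3 (br 5 dead (br 7 dead dead)) (br 5 (br 7 dead dead) (paint 1))) dead) dead)
      dead)) dead)) (br 1 (br 4 (br 7 (br 2 (br 9 (br 3 (br 6 (br 5 dead (paint 1)) dead) (br 5 (br 6 (paint 1) (paint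
      1)) (paint 1))) (br 8 (br 5 (br 6 dead (paint 3)) dead) dead)) (br 3 (br 6 (br 5 (br 9 (paint 0) dead) (paint
      0)) (br 5 (br 9 dead dead) dead)) dead)) (br 2 (br 5 (br 9 (br 3 (br 6 dead (br 8 dead dead)) (paint 1)) dead)
      dead) dead)) dead) dead))) ∷
  step (9 ∷ 1 ∷ 65 ∷ 25 ∷ 16 ∷ 3 ∷ 2 ∷ 2 ∷ 1 ∷ 0 ∷ [])
        (0x97621000 ∷ 0x81001 ∷ 0x21001 ∷ 0xa8621000 ∷ 0x84001 ∷ 0x61001 ∷ 0x76542000 ∷ 0x73b2a000 ∷ 0x71001 ∷
      0xa5321000 ∷ 0xb3761098206 ∷ 0x31001 ∷ 0x97518000 ∷ 0x86519000 ∷ 0x451239086704 ∷ 0x76513000 ∷ 0x86001 ∷ 0x76001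
      ∷ 0x97001 ∷ 0x94001 ∷ 0x6705432107 ∷ 0xa9001 ∷ 0x76214000 ∷ 0x43001 ∷ 0x32001 ∷ 0x86513000 ∷ [])
        (coloured ((col 0 1) ∷ (col 0 0) ∷ (spl 1 2 3) ∷ (col 0 1) ∷ (col 0 0) ∷ (col 0 3) ∷ (col 1 2) ∷ (col 0 2) ∷
      (col 0 3) ∷ (col 0 1) ∷ []) (br 0 (br 4 (br 5 (br 6 (br 2 (br 8 (br 7 (br 1 (br 3 (leaf (spl 1 2 3)) dead) (br 3
      dead (leaf (spl 1 2 3)))) dead) (br 7 dead (br 3 (br 1 dead dead) dead))) dead) (br 8 (br 1 (br 2 (br 3 dead (br
      7 (paint 3) dead)) (br 3 (br 7 dead (paint 3)) dead)) (br 2 (br 3 (paint 3) (br 7 (paint 3) dead)) dead)) dead))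
      (br 6 (br 7 (br 8 (paint 2) (br 3 (br 9 (leaf (col 1 2)) dead) dead)) dead) dead)) (paint 1)) (paint 0))) ∷
  -- Two 5-cycles that share vertex 3.
  step (9 ∷ 1 ∷ 1 ∷ 25 ∷ 0 ∷ 3 ∷ 2 ∷ 0 ∷ 0 ∷ [])
        (0x97621000 ∷ 0x21001 ∷ 0x31001 ∷ 0x81001 ∷ 0xa8621000 ∷ 0x71001 ∷ 0x84001 ∷ 0x76542000 ∷ 0x43b2a000 ∷
      0x76429000 ∷ 0x61001 ∷ 0xa5321000 ∷ 0x95321000 ∷ 0x76824000 ∷ 0x46739821006 ∷ 0x97518000 ∷ 0x86519000 ∷
      0x451239086704 ∷ 0x76513000 ∷ 0x86001 ∷ 0x76001 ∷ 0x97001 ∷ 0x94001 ∷ 0x6705432107 ∷ 0x76214000 ∷ 0x43001 ∷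
      0x32001 ∷ 0x86513000 ∷ [])
        (coloured ((col 0 1) ∷ (col 0 0) ∷ (spl 1 2 3) ∷ (col 0 1) ∷ (col 0 0) ∷ (col 0 3) ∷ (col 1 2) ∷ (col 0 2) ∷
      (col 0 3) ∷ []) (br 0 (br 4 (br 5 (br 6 (br 2 (br 8 (br 7 (br 1 (br 3 (leaf (spl 1 2 3)) dead) (br 3 dead (leaf
      (spl 1 2 3)))) dead) (br 7 dead (br 3 (br 1 dead dead) dead))) dead) (br 8 (br 1 (br 2 (br 3 dead (br 7 (paint
      3) dead)) (br 3 (br 7 dead (paint 3)) dead)) (br 2 (br 3 (paint 3) (br 7 (paint 3) dead)) dead)) dead)) (br 6
      (br 7 (br 8 (paint 2) (br 3 (br 1 (leaf (col 1 2)) (leaf (col 1 2))) dead)) dead) dead)) (paint 1)) (paint 0)))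
      ∷
  -- A 5-cycle and a disjoint edge.
  step (9 ∷ 1 ∷ 1 ∷ 1 ∷ 0 ∷ 1 ∷ 0 ∷ [])
        (0x21001 ∷ 0x61001 ∷ 0x41001 ∷ 0x43826000 ∷ 0x81001 ∷ 0x71001 ∷ 0x5439821007 ∷ 0x87321000 ∷ 0x43629000 ∷
      0x43001 ∷ 0x54001 ∷ 0x31001 ∷ 0x657432109811 ∷ 0x657430128910 ∷ 0x675342109811 ∷ 0x567342109804 ∷ 0x675340128910
      ∷ 0x657432109810 ∷ 0x675342109810 ∷ 0x67534210980f ∷ 0x76001 ∷ 0x76214000 ∷ 0x76325000 ∷ 0x6705432107 ∷
      0x7605432107 ∷ 0x76513000 ∷ 0x675342109812 ∷ 0x75342109813 ∷ [])
        (coloured ((col 0 1) ∷ (col 0 0) ∷ (col 0 1) ∷ (spl 1 2 3) ∷ (col 0 0) ∷ (col 0 3) ∷ (col 1 2) ∷ []) (br 0 (br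
      1 (br 5 (br 6 (br 3 (br 2 (br 4 (leaf (spl 1 2 3)) dead) (br 4 dead (leaf (spl 1 2 3)))) dead) (br 2 (br 3 (br 4
      dead (paint 3)) (br 4 (paint 3) dead)) (br 3 (br 4 (paint 3) (paint 3)) dead))) (br 6 (br 2 (br 3 (br 4 dead
      (leaf (col 1 2))) (br 4 (leaf (col 1 2)) dead)) (br 3 (br 4 (leaf (col 1 2)) (leaf (col 1 2))) dead)) dead))
      (paint 1)) (paint 0))) ∷
  step (1 ∷ 0 ∷ 1 ∷ 0 ∷ [])
    (0x21001 ∷ 0x54321000 ∷ 0x43001 ∷ 0x436521014 ∷ 0x51001 ∷ 0x41001 ∷ 0x31001 ∷ [])
        (coloured ((col 0 1) ∷ (col 0 0) ∷ (col 0 3) ∷ (col 1 2) ∷ []) (br 0 (br 1 (br 2 (br 3 (leaf (spl 1 2 3))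
      (paint 3)) (br 3 (leaf (col 1 2)) dead)) (paint 1)) (paint 0))) ∷
  step (1 ∷ 0 ∷ [])
    (0x21001 ∷ 0x321015 ∷ 0x31001 ∷ [])
    (coloured (plain (1 ∷ 0 ∷ [])) (br 0 (br 1 (paint 2) (paint 1)) (paint 0))) ∷
  step []
    (0x1016 ∷ [])
    (coloured [] (paint 0)) ∷
  []

-- This list ends with K4 rather than with the empty pattern, as graphs without K4 have their own
-- bound. It begins with K5, so that in all later steps K5 counts as excluded too.
2K2-K5-e-K6-certificate : List Step
2K2-K5-e-K6-certificate =
  step (15 ∷ 7 ∷ 3 ∷ 1 ∷ 0 ∷ [])
        (0x321000 ∷ 0x421000 ∷ 0x541000 ∷ 0x521000 ∷ 0x641000 ∷ 0x531000 ∷ 0x621000 ∷ 0x431000 ∷ 0x5431001 ∷ 0x4213001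
      ∷ 0x3214001 ∷ 0x3215001 ∷ 0x54321002 ∷ 0x5421001 ∷ 0x5213001 ∷ 0x4321001 ∷ 0x4312001 ∷ 0x5412001 ∷ 0x5312001 ∷
      0x631000 ∷ [])
        (coloured (plain (0 ∷ 1 ∷ 2 ∷ 3 ∷ 4 ∷ [])) (br 0 (br 1 (br 2 (paint 0) (br 3 (paint 0) (br 4 (paint 0) dead)))
      (br 2 (br 3 (br 4 (paint 0) (paint 2)) (br 4 (paint 2) dead)) (br 3 (paint 3) dead))) (br 1 (br 2 (br 3 (paint
      1) (br 4 (paint 1) dead)) (br 3 (br 4 (paint 1) dead) dead)) (br 2 (br 3 (br 4 (paint 2) dead) dead) (br 3 dead
      (br 4 dead dead)))))) ∷
  step (176 ∷ 106 ∷ 58 ∷ 29 ∷ 13 ∷ 7 ∷ 3 ∷ 0 ∷ 0 ∷ [])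
        (0x821000 ∷ 0x721000 ∷ 0x9105401 ∷ 0x531000 ∷ 0xa51000 ∷ 0xa71000 ∷ 0xa21000 ∷ 0x9516001 ∷ 0x6519001 ∷
      0xa81000 ∷ 0x6419001 ∷ 0x5319001 ∷ 0x841000 ∷ 0x851000 ∷ 0x421000 ∷ 0x8504301 ∷ 0x541000 ∷ 0x8407501 ∷ 0x9615001
      ∷ 0x9406101 ∷ 0x9416001 ∷ 0x9761001 ∷ 0x732000 ∷ 0x623000 ∷ 0x9405201 ∷ 0x9617001 ∷ 0x8704301 ∷ 0x831000 ∷
      0x9703101 ∷ 0x7619001 ∷ 0x7608101 ∷ 0x9716001 ∷ [])
        (coloured (plain (3 ∷ 1 ∷ 0 ∷ 0 ∷ 1 ∷ 0 ∷ 1 ∷ 3 ∷ 2 ∷ [])) (br 0 (br 5 (paint 0) (br 6 (paint 1) (br 8 (paint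
      3) dead))) (br 6 (br 1 (br 3 dead (br 7 dead (br 2 (br 4 dead (paint 2)) (br 4 (br 5 dead (br 8 (paint 2) dead))
      dead)))) (br 2 dead (br 3 (br 4 dead (br 7 dead (paint 2))) (br 4 (br 7 dead (paint 2)) (br 7 (br 8 (paint 2)
      dead) dead))))) (br 1 (br 3 dead (br 7 dead (br 2 (br 4 dead dead) dead))) (br 2 (br 4 dead (br 7 dead (br 3 (br
      5 (br 8 (paint 4) dead) dead) dead))) (br 8 (br 5 (br 3 (br 4 dead (paint 4)) (paint 4)) dead) dead)))))) ∷
  step (397 ∷ 184 ∷ 79 ∷ 27 ∷ 22 ∷ 14 ∷ 7 ∷ 1 ∷ 1 ∷ 0 ∷ [])
        (0xa91000 ∷ 0x971000 ∷ 0x731000 ∷ 0xa71000 ∷ 0x521000 ∷ 0x831000 ∷ 0xb81000 ∷ 0x9864001 ∷ 0xa51000 ∷ 0xb21000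
      ∷ 0xb71000 ∷ 0x432000 ∷ 0x532000 ∷ 0xa537001 ∷ 0x539000 ∷ 0x417000 ∷ 0x9846001 ∷ 0x542000 ∷ 0x631000 ∷ 0xa74000
      ∷ 0x9648001 ∷ 0xa753001 ∷ 0x641000 ∷ 0x541000 ∷ 0xb31000 ∷ 0x625000 ∷ 0xa18000 ∷ 0x965000 ∷ 0x913000 ∷ 0x84a000
      ∷ 0x516000 ∷ 0x756000 ∷ 0x724000 ∷ 0xa24000 ∷ 0x8604201 ∷ 0xa735001 ∷ 0x741000 ∷ 0x621000 ∷ 0xa20b101 ∷ 0x861000
      ∷ 0x213000 ∷ 0x720a801 ∷ 0x620a801 ∷ 0x823000 ∷ 0x647000 ∷ 0xa709201 ∷ 0x942000 ∷ 0xa503101 ∷ 0x753a001 ∷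
      0xa38000 ∷ 0x5403101 ∷ 0x983000 ∷ 0xa507101 ∷ 0x8649001 ∷ 0x871000 ∷ 0x7508301 ∷ 0xb203101 ∷ 0x9803101 ∷
      0x651000 ∷ [])
        (coloured (plain (0 ∷ 4 ∷ 3 ∷ 4 ∷ 1 ∷ 0 ∷ 0 ∷ 3 ∷ 1 ∷ 2 ∷ [])) (br 0 (br 1 (br 2 (br 3 (br 6 (br 4 (br 5 (br 8
      (br 7 (paint 0) (br 9 dead (paint 0))) dead) dead) (br 5 dead (br 7 (br 9 (paint 2) dead) (br 8 (paint 4)
      dead)))) dead) (br 6 dead (br 9 dead (br 4 (br 5 (br 8 (br 7 (paint 1) (paint 1)) dead) dead) dead)))) dead) (br
      7 (br 8 (br 2 (br 3 dead (br 4 dead (br 5 dead (br 6 (br 9 dead (paint 3)) (br 9 (paint 3) dead))))) dead) (br 5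
      (br 6 (br 2 (paint 0) (br 3 (paint 0) (br 9 dead (br 4 (paint 0) dead)))) (br 3 dead (br 9 (br 2 (br 4 dead
      (paint 2)) (paint 2)) dead))) (br 3 (br 2 dead (br 4 dead (br 6 (br 9 (paint 2) dead) dead))) dead))) (br 9 dead
      (br 5 (br 6 (br 2 (br 3 dead (br 4 dead (br 8 dead dead))) (br 4 (br 3 dead (br 8 dead dead)) dead)) dead)
      dead)))) (br 1 (br 3 (br 2 (br 5 dead (br 6 dead (br 7 (br 9 (br 8 (paint 3) (br 4 dead (paint 4))) dead) (br 8
      (br 9 dead (br 4 (paint 1) dead)) dead)))) (br 7 dead (br 4 (br 5 (br 6 (br 8 (paint 1) (br 9 (paint 2) (paint
      4))) dead) (br 6 dead (br 8 (br 9 (paint 4) dead) dead))) (br 5 dead (br 6 (br 8 (br 9 (paint 4) dead) dead)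
      dead))))) (br 6 dead (br 9 dead (br 4 (br 2 (br 5 dead (br 8 (br 7 (paint 3) dead) dead)) dead) dead)))) (br 2
      (br 3 dead (br 4 dead (br 5 dead (br 6 dead (br 7 (br 8 (paint 3) dead) dead))))) (br 3 (br 4 dead (br 8 dead
      (br 9 (br 6 (br 7 dead (br 5 (paint 2) dead)) dead) dead))) (br 4 (br 5 (br 7 dead (br 8 (br 6 (br 9 dead (paint
      1)) (paint 1)) dead)) (br 6 dead (br 7 (br 8 dead dead) dead))) dead)))))) ∷
  step (158 ∷ 55 ∷ 77 ∷ 56 ∷ 23 ∷ 7 ∷ 6 ∷ 3 ∷ 1 ∷ 0 ∷ [])
        (0x421000 ∷ 0x531000 ∷ 0xb91000 ∷ 0x961000 ∷ 0x951000 ∷ 0x841000 ∷ 0x761000 ∷ 0x435000 ∷ 0x853000 ∷ 0x521000 ∷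
      0x431000 ∷ 0x5109401 ∷ 0xba1000 ∷ 0x417000 ∷ 0x654000 ∷ 0xa948001 ∷ 0xa984001 ∷ 0x810b701 ∷ 0x931000 ∷ 0x426000
      ∷ 0x754000 ∷ 0x4302101 ∷ 0x847000 ∷ 0xa849001 ∷ 0x764000 ∷ 0x61a000 ∷ 0x5208701 ∷ 0x962000 ∷ 0x945000 ∷
      0x7108201 ∷ 0x8970b6a3104 ∷ 0x69a7b0518305 ∷ 0x7618001 ∷ 0xb51000 ∷ 0x7602101 ∷ 0x6217001 ∷ 0xa71000 ∷ 0xa81000
      ∷ 0x329000 ∷ 0x318000 ∷ 0x612000 ∷ 0x912000 ∷ 0x721000 ∷ 0x738000 ∷ 0x6105301 ∷ 0x6307101 ∷ 0x6507101 ∷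
      0x9607101 ∷ 0xa92000 ∷ 0x8409201 ∷ 0x7306201 ∷ 0x983000 ∷ 0xa408301 ∷ 0x984a001 ∷ 0x821000 ∷ 0x9408101 ∷
      0x750a201 ∷ 0xa46000 ∷ 0x850a201 ∷ 0x3a8046912705 ∷ 0xa108201 ∷ [])
        (coloured (plain (3 ∷ 4 ∷ 1 ∷ 2 ∷ 1 ∷ 2 ∷ 0 ∷ 0 ∷ 1 ∷ 4 ∷ [])) (br 0 (br 1 (br 2 (br 7 (br 8 (br 3 (br 4 (br 5
      (br 6 (paint 0) dead) dead) dead) (br 4 (br 5 dead (br 6 dead (br 9 (paint 1) (paint 1)))) (br 5 (br 6 dead (br
      9 (paint 3) dead)) (br 6 (br 9 (paint 3) (paint 3)) (paint 3))))) dead) dead) (br 3 (br 5 (br 6 (br 9 (br 4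
      (paint 2) (br 8 dead (paint 2))) dead) dead) dead) (br 7 (br 4 dead (br 8 dead (br 9 (paint 3) dead))) (br 9 (br
      8 (br 4 (br 5 dead (paint 4)) (paint 4)) dead) dead)))) (br 5 dead (br 8 dead (br 3 (br 6 (br 9 dead (br 7 (br 2
      (br 4 (paint 0) dead) (br 4 dead (paint 0))) dead)) dead) (br 7 (br 9 (br 2 (paint 3) (br 4 dead (br 6 (paint 3)
      dead))) dead) dead))))) (br 6 (br 1 dead (br 9 dead (br 2 (br 7 (br 3 (br 4 (paint 0) dead) (br 4 dead (br 5
      dead (br 8 (paint 0) dead)))) dead) (br 3 (br 4 (br 7 dead (br 8 (br 5 dead dead) dead)) (br 5 (br 7 (paint 0)
      dead) dead)) dead)))) (br 5 (br 3 (br 7 dead (br 1 (br 2 (br 4 (paint 2) dead) (br 4 (paint 2) (br 8 dead (paint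
      2)))) (br 4 (br 8 dead (br 9 (paint 2) dead)) dead))) (br 4 dead (br 1 (br 7 dead (br 8 (br 9 (paint 4) dead)
      dead)) (br 2 (br 7 (br 9 dead dead) dead) dead)))) (br 2 (br 4 (br 8 (br 1 (paint 1) (br 9 dead (br 3 (br 7 dead
      (paint 1)) (br 7 (paint 1) dead)))) dead) dead) dead))))) ∷
  step (120 ∷ 90 ∷ 60 ∷ 15 ∷ 13 ∷ 4 ∷ 3 ∷ 1 ∷ 0 ∷ [])
        (0x921000 ∷ 0xa71000 ∷ 0x941000 ∷ 0x981000 ∷ 0xa81000 ∷ 0x9873001 ∷ 0xa31000 ∷ 0xa41000 ∷ 0x725000 ∷ 0x657000
      ∷ 0x831000 ∷ 0x841000 ∷ 0x6509101 ∷ 0xa91000 ∷ 0x9738001 ∷ 0x8704301 ∷ 0x628000 ∷ 0x4a786923105 ∷ 0x5108601 ∷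
      0x8509101 ∷ 0x9837001 ∷ 0x876000 ∷ 0x9a4670851306 ∷ 0x594087a31605 ∷ 0x7516001 ∷ 0x49a167803206 ∷ 0x7602101 ∷
      0x6504101 ∷ 0x423000 ∷ 0x513000 ∷ 0x512000 ∷ 0x812000 ∷ 0x421000 ∷ 0x934000 ∷ 0x735000 ∷ 0x7408201 ∷ 0x9307601 ∷
      0x832000 ∷ 0x931000 ∷ 0x9805301 ∷ 0x8739001 ∷ 0x543000 ∷ 0x852000 ∷ 0x8504101 ∷ 0x8703101 ∷ 0x6405201 ∷
      0x8a4370951606 ∷ 0x498120a73606 ∷ 0x7315001 ∷ 0x6219001 ∷ [])
        (coloured (plain (0 ∷ 4 ∷ 2 ∷ 0 ∷ 2 ∷ 1 ∷ 1 ∷ 4 ∷ 0 ∷ [])) (br 0 (br 1 (br 2 (br 8 (br 3 (br 4 (br 5 (br 6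
      (paint 0) dead) (paint 0)) (paint 0)) dead) (br 4 (br 5 (br 6 (br 7 (paint 1) dead) dead) (br 6 (paint 2) (br 7
      (br 3 (paint 4) (paint 4)) dead))) (br 6 dead (br 7 (br 3 (br 5 (paint 4) (paint 4)) (paint 4)) dead)))) (br 3
      dead (br 4 dead (br 6 dead (br 7 (br 8 (br 5 (paint 3) (paint 4)) dead) dead))))) (br 4 dead (br 7 dead (br 2
      (br 6 dead (br 3 (br 8 (paint 0) dead) dead)) (br 8 (br 6 (br 3 (br 5 (paint 3) (paint 3)) (br 5 (paint 3)
      dead)) dead) dead))))) (br 1 (br 3 dead (br 8 dead (br 2 (br 4 (br 5 (br 6 (br 7 (paint 1) dead) dead) (br 6
      (paint 2) (br 7 (paint 4) dead))) (br 5 (br 6 dead (br 7 (paint 4) dead)) dead)) (br 4 (br 5 (br 6 (br 7 (paint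
      1) dead) dead) (br 6 (br 7 dead dead) dead)) (br 5 (br 6 dead (br 7 dead dead)) dead))))) (br 2 (br 7 dead (br 8
      dead (br 4 (br 6 (paint 2) dead) dead))) (br 4 (br 3 dead (br 7 dead (br 6 (br 8 (br 5 (paint 3) (paint 3))
      dead) dead))) (br 5 (br 6 (br 7 (br 3 (paint 1) (paint 1)) (br 3 (br 8 (paint 3) dead) dead)) (br 7 (br 8 (paint
      3) dead) dead)) (br 3 (br 7 (br 6 dead (br 8 (paint 3) dead)) dead) dead))))))) ∷
  step (63 ∷ 103 ∷ 101 ∷ 44 ∷ 23 ∷ 7 ∷ 6 ∷ 3 ∷ 1 ∷ 0 ∷ [])
        (0x421000 ∷ 0x321000 ∷ 0x531000 ∷ 0xa81000 ∷ 0x981000 ∷ 0xa91000 ∷ 0xba1000 ∷ 0x521000 ∷ 0x753000 ∷ 0x853000 ∷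
      0x7651001 ∷ 0x431000 ∷ 0x426000 ∷ 0x435000 ∷ 0x654000 ∷ 0x964000 ∷ 0x762000 ∷ 0xa72000 ∷ 0x871000 ∷
      0xa5914b38004 ∷ 0x541000 ∷ 0x961000 ∷ 0x741000 ∷ 0xb3a15946004 ∷ 0x761000 ∷ 0xb7918a64004 ∷ 0x21a000 ∷ 0x419000
      ∷ 0x4321001 ∷ 0x756a89140206 ∷ 0x857a64109205 ∷ 0x82394610a505 ∷ 0xa809401 ∷ 0x2438a9156006 ∷ 0x65198273007 ∷
      0x6517001 ∷ 0x327000 ∷ 0x6759a8132006 ∷ 0x23189645007 ∷ 0x61593278007 ∷ 0x21385649007 ∷ 0x6759a8130406 ∷
      0xa908301 ∷ 0x7516001 ∷ 0x4312001 ∷ 0x934a27108605 ∷ 0x56789a120306 ∷ 0x96587210a305 ∷ 0x980a201 ∷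
      0x56789a124006 ∷ 0x421a8537007 ∷ 0x7615001 ∷ 0x4213001 ∷ 0x3214001 ∷ 0x4321003 ∷ 0x827000 ∷ 0x61a000 ∷ 0x519000
      ∷ 0x718000 ∷ 0x3964a701807 ∷ 0x318000 ∷ 0x935000 ∷ 0xa46000 ∷ 0x851000 ∷ [])
        (coloured (plain (3 ∷ 0 ∷ 1 ∷ 2 ∷ 2 ∷ 0 ∷ 4 ∷ 1 ∷ 2 ∷ 0 ∷ [])) (br 0 (br 1 (br 9 (br 3 (paint 0) (br 5 (br 4
      dead (br 8 dead (br 2 (paint 0) (br 6 (paint 0) (br 7 dead (paint 0)))))) (br 2 (paint 1) (br 4 (br 6 dead (br 7
      dead (br 8 (paint 3) dead))) (br 6 (br 7 (br 8 (paint 3) dead) dead) dead))))) dead) (br 2 (br 7 (br 3 (paint 1)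
      (br 4 (paint 1) (br 8 dead (br 5 (paint 1) (br 6 (br 9 dead (paint 1)) dead))))) dead) (br 3 (br 8 (br 4 (br 6
      dead (br 7 dead (br 5 (paint 2) (br 9 dead (paint 2))))) (br 5 (br 6 dead (br 9 (paint 3) dead)) (br 6 (paint 4)
      dead))) dead) dead))) (br 1 (br 2 (br 6 (br 3 (br 4 (br 5 (br 7 (br 8 dead (br 9 dead (paint 1))) (br 8 (br 9
      dead (paint 2)) (br 9 (paint 0) (paint 4)))) dead) dead) (br 4 (br 5 dead (br 7 (br 8 dead (br 9 dead dead)) (br
      8 (br 9 dead dead) (br 9 dead dead)))) (br 5 (br 8 dead (br 7 (br 9 dead dead) dead)) dead))) dead) (br 3 (br 5
      (br 4 (br 6 dead (br 7 dead (br 8 (br 9 dead dead) dead))) (br 6 (br 7 (br 8 dead dead) (br 8 dead (br 9 dead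
      dead))) dead)) dead) dead)) (br 2 (br 3 (br 4 (br 5 (br 6 dead (br 7 (br 8 dead (br 9 dead dead)) (br 8 (br 9
      dead dead) (br 9 dead dead)))) (br 6 (br 9 dead (br 7 (br 8 dead dead) dead)) dead)) dead) dead) (br 3 dead
      dead))))) ∷
  step (180 ∷ 114 ∷ 58 ∷ 25 ∷ 13 ∷ 7 ∷ 3 ∷ 0 ∷ 0 ∷ [])
        (0x721000 ∷ 0xa51000 ∷ 0x821000 ∷ 0x931000 ∷ 0xa31000 ∷ 0xa71000 ∷ 0x941000 ∷ 0xa21000 ∷ 0x918000 ∷ 0xa81000 ∷
      0x831000 ∷ 0x9761001 ∷ 0x531000 ∷ 0x871000 ∷ 0x981000 ∷ 0x715000 ∷ 0x413000 ∷ 0x8504301 ∷ 0x9716001 ∷ 0x761000 ∷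
      0x867a4091204 ∷ 0x9803101 ∷ 0x5106201 ∷ 0x7619001 ∷ 0x547000 ∷ 0x734000 ∷ 0x96745812007 ∷ 0x7608101 ∷ 0x8706301
      ∷ 0x9617001 ∷ 0x764000 ∷ 0x652000 ∷ 0x851000 ∷ 0xa41000 ∷ 0x610a901 ∷ 0xa7856021907 ∷ 0x641000 ∷ 0x510a901 ∷
      0xa8751926007 ∷ 0x590a6712407 ∷ 0xa7850923107 ∷ 0x74a89160204 ∷ 0x9408101 ∷ 0x8a293071507 ∷ 0x982175a60305 ∷
      0x6789a1254005 ∷ 0x8a7469201506 ∷ 0x9308101 ∷ 0x8103201 ∷ 0x28a01375407 ∷ 0x613000 ∷ 0x612000 ∷ 0x725000 ∷
      0x426000 ∷ 0x423000 ∷ 0x532000 ∷ 0x97642815007 ∷ 0x8706201 ∷ 0x5409801 ∷ 0x5309801 ∷ 0x4209801 ∷ 0x9605101 ∷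
      0x8506301 ∷ 0x9402101 ∷ 0x48095621307 ∷ 0x8405201 ∷ 0x530a82691708 ∷ 0x6a8470219505 ∷ [])
        (coloured (plain (2 ∷ 0 ∷ 1 ∷ 1 ∷ 0 ∷ 1 ∷ 4 ∷ 2 ∷ 3 ∷ [])) (br 0 (br 1 (br 2 (br 5 (br 3 (br 4 (br 6 (br 7
      (paint 0) (br 8 dead (paint 4))) dead) (br 6 dead (br 7 (br 8 (paint 2) (paint 2)) (br 8 dead (paint 1))))) (br
      6 dead (br 7 (br 4 (br 8 (paint 2) (paint 2)) (br 8 (paint 2) (paint 2))) (br 8 dead (br 4 (paint 0) dead)))))
      (br 3 dead (br 6 dead (br 8 (br 7 (br 4 (paint 0) dead) dead) dead)))) (br 3 dead (br 5 dead (br 4 (br 6 (br 7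
      (br 8 (paint 2) (paint 4)) (br 8 dead (paint 0))) (br 7 (br 8 (paint 0) dead) dead)) (br 6 dead (br 7 (br 8 dead
      dead) dead)))))) (br 5 dead (br 4 (br 2 dead (br 3 dead (br 6 (br 7 (br 8 (paint 4) (paint 4)) (br 8 dead dead))
      (br 7 (br 8 dead dead) dead)))) (br 6 dead (br 7 (br 8 (br 2 (paint 2) (br 3 dead (paint 2))) dead) dead)))))
      (br 1 (br 7 dead (br 2 (br 4 dead (br 6 dead (br 5 (br 8 (br 3 (paint 1) (paint 3)) dead) dead))) (br 3 dead (br
      4 (br 5 (br 6 dead (br 8 (paint 0) dead)) (br 6 (br 8 (paint 0) dead) dead)) dead)))) (br 3 (br 4 (br 2 dead (br
      5 dead (br 6 (br 7 dead (br 8 (paint 3) dead)) dead))) (br 5 (br 2 (br 7 dead (br 6 (br 8 (paint 3) (paint 1))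
      (paint 1))) (br 8 (br 6 (paint 3) (paint 3)) (br 6 (br 7 (paint 4) dead) dead))) (br 8 (br 6 (br 2 (br 7 dead
      (paint 3)) (br 7 (paint 3) dead)) dead) dead))) (br 8 (br 2 (br 4 dead (br 7 dead dead)) (br 4 (br 5 dead (br 7
      dead dead)) (br 7 (br 5 (br 6 dead (paint 3)) (br 6 (paint 3) dead)) dead))) dead))))) ∷
  step (92 ∷ 54 ∷ 29 ∷ 9 ∷ 3 ∷ 3 ∷ 1 ∷ 0 ∷ [])
        (0x951000 ∷ 0x841000 ∷ 0x741000 ∷ 0x921000 ∷ 0x941000 ∷ 0x831000 ∷ 0x835000 ∷ 0x541000 ∷ 0x931000 ∷ 0x981000 ∷
      0x513000 ∷ 0x8763001 ∷ 0x721000 ∷ 0x4108501 ∷ 0x971000 ∷ 0x8736001 ∷ 0x621000 ∷ 0x871000 ∷ 0x75940612809 ∷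
      0x85940613709 ∷ 0x417000 ∷ 0x426000 ∷ 0x764000 ∷ 0x4208501 ∷ 0x7506201 ∷ 0x8637001 ∷ 0x7605301 ∷ 0x523000 ∷
      0x7638001 ∷ 0x6503101 ∷ 0x75941602809 ∷ 0x631000 ∷ 0x6502101 ∷ 0x85941603709 ∷ 0x90783512409 ∷ 0x894350761206 ∷
      0x90872513409 ∷ 0x794250861306 ∷ 0x947502836106 ∷ 0x520974361808 ∷ 0x612000 ∷ 0x87642531007 ∷ 0x85672401309 ∷
      0x632000 ∷ 0x731000 ∷ 0x85761402309 ∷ 0x86741532007 ∷ 0x8603101 ∷ 0x5402101 ∷ 0x8402101 ∷ 0x948503726106 ∷
      0x530984261708 ∷ 0x5103201 ∷ [])
        (coloured (plain (1 ∷ 4 ∷ 2 ∷ 0 ∷ 2 ∷ 0 ∷ 1 ∷ 3 ∷ [])) (br 0 (br 1 (br 3 (br 5 (br 6 (paint 0) dead) dead) (br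
      6 (br 5 dead (br 2 (br 4 (br 7 (paint 1) (paint 1)) (br 7 dead (paint 1))) (br 4 dead (br 7 (paint 1) dead))))
      (br 2 (br 7 (br 4 (br 5 (paint 2) (paint 2)) dead) (br 5 (br 4 (paint 4) (paint 4)) dead)) (br 4 dead (br 5 (br
      7 (paint 4) dead) dead))))) (br 5 dead (br 3 (br 6 (br 2 (br 7 (paint 1) (br 4 (paint 2) dead)) (br 4 dead (br 7
      (paint 3) dead))) dead) (br 2 (br 4 (br 6 (br 7 (paint 1) (paint 1)) (br 7 dead dead)) (br 7 dead dead)) (br 4
      dead (br 6 (br 7 (paint 1) dead) dead)))))) (br 1 (br 6 dead (br 3 (br 5 (br 2 (br 4 (br 7 (paint 2) (paint 2))
      (br 7 dead dead)) (br 4 dead (br 7 (paint 3) dead))) dead) (br 2 (br 4 (br 5 (br 7 (paint 4) (paint 4)) (br 7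
      dead dead)) (br 7 dead dead)) (br 4 dead (br 5 (br 7 (paint 4) dead) dead))))) (br 2 (br 5 dead (br 6 dead (br 4
      (br 7 (br 3 (paint 2) (paint 2)) dead) dead))) (br 3 (br 5 (br 6 (paint 0) (br 7 (br 4 (paint 3) (paint 3))
      dead)) (br 7 (br 6 (br 4 (paint 3) (paint 3)) dead) dead)) (br 4 (br 7 (br 5 (br 6 dead (paint 3)) (br 6 (paint
      3) dead)) dead) dead)))))) ∷
  step (88 ∷ 29 ∷ 26 ∷ 15 ∷ 4 ∷ 3 ∷ 1 ∷ 0 ∷ [])
        (0x721000 ∷ 0x921000 ∷ 0x871000 ∷ 0x961000 ∷ 0x831000 ∷ 0x751000 ∷ 0x731000 ∷ 0x517000 ∷ 0x8764001 ∷ 0x951000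
      ∷ 0x8105401 ∷ 0x765000 ∷ 0x641000 ∷ 0x613000 ∷ 0x536000 ∷ 0x7604201 ∷ 0x8746001 ∷ 0x8647001 ∷ 0x4318001 ∷
      0x621000 ∷ 0x851000 ∷ 0x957148600a ∷ 0x9107401 ∷ 0x8107401 ∷ 0x34856710a ∷ 0x589146702306 ∷ 0x6403101 ∷ 0x324000
      ∷ 0x812000 ∷ 0x321000 ∷ 0x784526300a ∷ 0x876254300a ∷ 0x8406501 ∷ 0x741000 ∷ 0x842000 ∷ 0x7308201 ∷ 0x8706301 ∷
      0x643000 ∷ 0x5308201 ∷ 0x87653041207 ∷ 0x8704301 ∷ 0x7648001 ∷ 0x3207501 ∷ 0x89534071607 ∷ 0x4306101 ∷ 0x6103201
      ∷ [])
        (coloured (plain (3 ∷ 2 ∷ 1 ∷ 1 ∷ 0 ∷ 0 ∷ 3 ∷ 2 ∷ [])) (br 0 (br 1 (br 2 (br 3 (br 4 (br 5 (br 6 (br 7 (paint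
      0) (paint 0)) dead) dead) (br 5 (br 6 dead (br 7 (paint 1) (paint 1))) (br 7 (paint 2) (br 6 (paint 3) dead))))
      dead) (br 5 dead (br 6 (br 7 (br 3 (paint 2) (br 4 (paint 2) (paint 3))) (paint 3)) (br 4 dead (br 7 (paint 2)
      dead))))) (br 7 dead (br 2 (br 4 (br 5 (br 6 (paint 0) dead) dead) (br 3 (br 5 (paint 1) (br 6 dead dead)) (br 5
      (br 6 dead dead) dead))) (br 4 (br 5 dead (br 6 (br 3 (paint 3) dead) dead)) dead)))) (br 1 (br 2 dead (br 6
      dead (br 3 (br 5 dead (br 7 (br 4 (paint 2) dead) dead)) (br 7 (br 5 (br 4 (paint 4) (paint 4)) dead) dead))))
      (br 3 (br 6 dead (br 7 dead (br 2 (br 5 (paint 1) dead) dead))) (br 2 (br 6 dead (br 5 (br 7 (br 4 (paint 0)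
      dead) dead) dead)) (br 4 (br 5 (br 6 (br 7 (paint 0) (paint 0)) (paint 4)) (br 6 (br 7 (paint 4) dead) dead))
      (br 6 (br 5 dead (paint 4)) dead))))))) ∷
  step (30 ∷ 23 ∷ 21 ∷ 12 ∷ 7 ∷ 3 ∷ 1 ∷ 0 ∷ [])
        (0x421000 ∷ 0x831000 ∷ 0x861000 ∷ 0x981000 ∷ 0x971000 ∷ 0x761000 ∷ 0x8765001 ∷ 0x8756001 ∷ 0x426000 ∷ 0x654000
      ∷ 0x753000 ∷ 0x8657001 ∷ 0x721000 ∷ 0x317000 ∷ 0x435000 ∷ 0x862000 ∷ 0x687415300a ∷ 0x4302101 ∷ 0x621000 ∷
      0x5409101 ∷ 0x612000 ∷ 0x687153400b ∷ 0x786325400a ∷ 0x8605301 ∷ 0x865473100b ∷ 0x7658001 ∷ 0x7506201 ∷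
      0x875364200b ∷ 0x6507101 ∷ 0x7205401 ∷ 0x871000 ∷ 0x865147300a ∷ 0x6105301 ∷ 0x875236400a ∷ 0x3106401 ∷
      0x675380210b ∷ [])
        (coloured (plain (2 ∷ 3 ∷ 1 ∷ 0 ∷ 0 ∷ 3 ∷ 1 ∷ 2 ∷ [])) (br 0 (br 1 (br 2 (br 6 (br 3 (br 4 (br 5 (paint 0)
      dead) dead) (br 4 (br 5 dead (br 7 (paint 1) (paint 1))) (br 5 (br 7 (paint 2) dead) (br 7 (paint 2) dead))))
      dead) (br 3 (br 5 (br 4 (paint 0) (br 6 (br 7 (paint 2) dead) (br 7 (paint 3) dead))) dead) (br 4 (br 5 dead (br
      6 dead (br 7 (paint 4) dead))) (br 5 (br 6 (br 7 (paint 2) (paint 4)) (br 7 (paint 3) dead)) (br 7 (br 6 (paint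
      2) dead) dead))))) (br 5 dead (br 4 (br 2 (br 6 (br 3 (br 7 (paint 1) (paint 1)) (paint 1)) dead) (br 6 dead (br
      7 dead dead))) (br 6 (br 7 (br 2 (paint 2) (paint 2)) dead) dead)))) (br 4 (br 5 (br 3 (br 1 (paint 0) (br 7
      dead (paint 0))) dead) (br 1 (br 3 dead (br 2 (br 6 dead (br 7 dead dead)) dead)) (br 2 (br 3 (br 6 (paint 1)
      (br 7 dead dead)) (br 6 (paint 1) (br 7 dead dead))) (br 3 (br 6 dead (br 7 dead dead)) dead)))) (br 1 (br 6
      dead (br 5 (br 7 (br 2 (paint 3) (paint 3)) dead) dead)) (br 2 (br 3 dead (br 6 (br 7 dead (br 5 dead dead))
      dead)) (br 3 (br 5 (br 7 dead (br 6 dead dead)) dead) dead)))))) ∷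
  step (60 ∷ 46 ∷ 27 ∷ 10 ∷ 6 ∷ 3 ∷ 1 ∷ 0 ∷ [])
        (0x641000 ∷ 0x941000 ∷ 0x531000 ∷ 0x931000 ∷ 0x971000 ∷ 0x871000 ∷ 0x8642001 ∷ 0x8753001 ∷ 0x961000 ∷ 0x536000
      ∷ 0x645000 ∷ 0x621000 ∷ 0x613000 ∷ 0x8426001 ∷ 0x427000 ∷ 0x754000 ∷ 0x496850120c ∷ 0x821000 ∷ 0x896047310b ∷
      0x795038410b ∷ 0x8702101 ∷ 0x597341600c ∷ 0x698043120b ∷ 0x984136700a ∷ 0x712000 ∷ 0x831000 ∷ 0x732000 ∷
      0x6402101 ∷ 0x486702310a ∷ 0x864520130b ∷ 0x623000 ∷ 0x875436100b ∷ 0x8624001 ∷ 0x286450310c ∷ 0x682147500b ∷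
      0x875143600a ∷ 0x8607201 ∷ 0x6428001 ∷ 0x7538001 ∷ 0x783156400b ∷ 0x8735001 ∷ 0x502914670b ∷ 0x698104320a ∷ [])
        (coloured (plain (4 ∷ 1 ∷ 4 ∷ 3 ∷ 3 ∷ 0 ∷ 1 ∷ 2 ∷ [])) (br 0 (br 1 (br 2 (br 4 (br 5 (br 3 (br 6 (paint 0)
      dead) (br 6 dead (br 7 (paint 0) (paint 0)))) dead) (br 3 (br 5 dead (paint 1)) (br 5 (br 6 (br 7 (paint 4)
      dead) (br 7 (paint 2) dead)) (br 7 (br 6 (paint 2) (paint 2)) dead)))) (br 5 dead (br 3 (paint 1) (br 7 (br 4
      (paint 2) (paint 2)) dead)))) (br 6 dead (br 2 (br 4 (br 5 (br 3 (br 7 (paint 0) (paint 0)) (br 7 (paint 0)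
      dead)) dead) (br 7 (br 3 (paint 4) (paint 4)) dead)) (br 5 dead (br 7 (br 3 (br 4 (paint 3) dead) dead)
      dead))))) (br 2 (br 7 dead (br 1 (br 3 (br 6 (br 4 (br 5 (paint 0) dead) (br 5 dead dead)) dead) (br 5 (br 4
      (paint 0) (br 6 dead dead)) dead)) (br 6 dead (br 4 (paint 0) dead)))) (br 1 (br 5 dead (br 7 dead (br 3 (paint
      1) dead))) (br 3 (br 5 (br 4 (br 6 (br 7 (paint 3) (paint 3)) (br 7 dead dead)) dead) (br 7 (br 4 (br 6 dead
      (paint 2)) dead) dead)) (br 5 (br 7 (br 6 (br 4 dead (paint 0)) dead) dead) dead)))))) ∷
  step (23 ∷ 21 ∷ 12 ∷ 7 ∷ 3 ∷ 1 ∷ 0 ∷ [])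
        (0x651000 ∷ 0x321000 ∷ 0x631000 ∷ 0x721000 ∷ 0x861000 ∷ 0x751000 ∷ 0x7654001 ∷ 0x7645001 ∷ 0x324000 ∷ 0x543000
      ∷ 0x7546001 ∷ 0x642000 ∷ 0x521000 ∷ 0x761000 ∷ 0x315000 ∷ 0x3106201 ∷ 0x871000 ∷ 0x784605130d ∷ 0x785640310c ∷
      0x765480120b ∷ 0x7516001 ∷ 0x7615001 ∷ 0x7105401 ∷ 0x841000 ∷ 0x6104301 ∷ 0x673514020d ∷ 0x675214300a ∷
      0x6405101 ∷ 0x674531200c ∷ 0x764253100b ∷ 0x763425010d ∷ 0x7205301 ∷ 0x765432100c ∷ 0x6547001 ∷ 0x675143200b ∷
      0x764125300a ∷ 0x3207101 ∷ 0x240375810c ∷ 0x4107301 ∷ [])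
        (coloured (plain (2 ∷ 1 ∷ 0 ∷ 0 ∷ 3 ∷ 1 ∷ 2 ∷ [])) (br 0 (br 1 (br 2 (br 3 (br 4 (br 5 (br 6 (paint 0) (paint
      0)) (paint 0)) dead) dead) (br 4 (br 3 dead (br 5 (br 6 (paint 3) (paint 3)) (br 6 (paint 3) dead))) (br 3 (br 5
      (paint 1) (br 6 (paint 2) dead)) (br 5 (br 6 (paint 2) dead) (paint 2))))) (br 4 (br 3 (br 2 (br 5 dead (br 6
      (paint 0) (paint 0))) dead) (br 5 (br 2 (br 6 (paint 3) dead) (br 6 (paint 3) dead)) (br 6 (br 2 (paint 4)
      (paint 2)) dead))) (br 2 dead (br 6 (br 3 (br 5 dead (paint 2)) (br 5 dead dead)) dead)))) (br 5 (br 1 (br 3 (br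
      4 (paint 0) (paint 1)) (br 2 dead (br 4 (paint 3) (br 6 dead dead)))) (br 3 dead (br 2 (br 4 (br 6 dead dead)
      (br 6 (paint 4) dead)) (br 6 (paint 4) dead)))) (br 1 (br 2 (br 3 (br 4 (paint 0) (br 6 dead dead)) dead) (br 3
      (br 4 dead (br 6 dead dead)) dead)) (br 2 (br 3 (br 4 (paint 0) (br 6 dead dead)) (br 4 (br 6 dead dead) dead))
      dead))))) ∷
  -- The house, which is the complement of the path 4, 0, 2, 1, 3, together with vertex 5 adjacent
  -- to all of it.
  step (21 ∷ 12 ∷ 7 ∷ 3 ∷ 1 ∷ 0 ∷ [])
        (0x721000 ∷ 0x651000 ∷ 0x731000 ∷ 0x641000 ∷ 0x6543001 ∷ 0x432000 ∷ 0x541000 ∷ 0x5106201 ∷ 0x531000 ∷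
      0x6403101 ∷ 0x5436001 ∷ 0x6503201 ∷ 0x631000 ∷ 0x761000 ∷ 0x36218400e ∷ 0x6213001 ∷ 0x213000 ∷ 0x6435001 ∷
      0x65432100e ∷ 0x64531200e ∷ 0x6534001 ∷ 0x56740210e ∷ [])
        (coloured (plain (3 ∷ 0 ∷ 0 ∷ 2 ∷ 1 ∷ 4 ∷ [])) (br 0 (br 1 (br 2 (br 3 (paint 0) (br 4 (paint 1) (br 5 (paint
      3) dead))) dead) (br 4 (br 2 (br 3 dead (br 5 (paint 1) (paint 1))) (br 3 (br 5 (paint 2) (paint 2)) (br 5
      (paint 3) dead))) (br 2 (br 3 dead (br 5 (paint 3) dead)) (br 5 (paint 3) dead)))) (br 1 (br 2 (br 4 dead (br 3
      (paint 0) (br 5 (paint 4) dead))) (br 3 (br 4 (paint 2) (br 5 (paint 4) dead)) (br 5 (br 4 (leaf (spl 1 4 1))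
      dead) dead))) (br 2 (br 3 dead (br 4 dead (br 5 (leaf (col 1 4)) dead))) (br 3 (br 4 (paint 2) (br 5 dead dead))
      (br 5 (br 4 dead dead) dead)))))) ∷
  step (7 ∷ 3 ∷ 1 ∷ 0 ∷ [])
        (0x321000 ∷ 0x421000 ∷ 0x541000 ∷ 0x431000 ∷ 0x531000 ∷ 0x521000 ∷ 0x5432100f ∷ 0x4321001 ∷ 0x4213001 ∷
      0x3214001 ∷ 0x4321003 ∷ 0x4312001 ∷ 0x2543100f ∷ [])
        (coloured (plain (0 ∷ 1 ∷ 2 ∷ 3 ∷ [])) (br 0 (br 3 (br 2 (br 1 (paint 0) (paint 2)) (paint 3)) (br 1 (br 2
      (paint 0) (paint 0)) (br 2 (paint 0) dead))) (br 1 (br 2 (br 3 (paint 1) (paint 1)) (br 3 (paint 1) dead)) (br 2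
      (br 3 (paint 2) dead) (br 3 dead dead))))) ∷
  []

2K2-diamond-K4-certificate : List Step
2K2-diamond-K4-certificate =
  step (3 ∷ 1 ∷ 0 ∷ [])
    (0x321000 ∷ 0x421000 ∷ 0x431000 ∷ 0x321002 ∷ 0x321001 ∷ 0x312001 ∷ 0x213001 ∷ [])
        (coloured (plain (0 ∷ 1 ∷ 2 ∷ [])) (br 0 (br 1 (paint 0) (br 2 (paint 2) dead)) (br 1 (br 2 (paint 1) dead)
      (br 2 dead dead)))) ∷
  step (1 ∷ 0 ∷ [])
    (0x21003 ∷ 0x321000 ∷ 0x31003 ∷ [])
    (coloured (plain (1 ∷ 0 ∷ [])) (br 0 (br 1 (paint 2) (paint 1)) (paint 0))) ∷
  step []
    (0x1004 ∷ [])
    (coloured [] (paint 0)) ∷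
  []

-- Certified bounds

Colourable-mono : ∀ {G : Graph (Fin N)} {k l} → k ≤ l → Colourable G k → Colourable G l
Colourable-mono k≤l (c , pr) = (λ x → inject≤ (c x) k≤l) , λ x y e q → pr x y e (inject≤-injective k≤l k≤l _ _ q)

2K2-diamond-K4 : (G : Graph (Fin N)) → NoMatching G 2 → NoNearClique G 2 → NoClique G 4 → Colourable G 3
2K2-diamond-K4 G nm nn nc =
  -- The first `tt` makes the type checker evaluate `stepsOK` on the certificate, the second one the
  -- membership of the entry point in its list of graphs.
  certified 3 (matchingPat 2 ∷ nearCliquePat 2 ∷ cliquePat 4 ∷ []) 2K2-diamond-K4-certificate tt [] tt (λ G _ → inj₂ ([] , tt))
    G (avoids-matching G nm ∷ avoids-nearClique G nn ∷ avoids-clique G nc ∷ [])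

3K2-K3 : (G : Graph (Fin N)) → NoMatching G 3 → NoClique G 3 → Colourable G 4
3K2-K3 G nm nc =
  certified 4 (matchingPat 3 ∷ cliquePat 3 ∷ []) 3K2-K3-certificate tt [] tt (λ G _ → inj₂ ([] , tt))
    G (avoids-matching G nm ∷ avoids-clique G nc ∷ [])

-- The matching hypothesis is stated with `Avoids`, since that is the form available where a
-- certificate asks for its entry point.
2K2-K4 : (G : Graph (Fin N)) → Avoids G (matchingPat 2) → NoClique G 4 → Colourable G 4
2K2-K4 G am nc =
  certified 4 (matchingPat 2 ∷ cliquePat 4 ∷ []) 2K2-K4-certificate tt [] tt (λ G _ → inj₂ ([] , tt))
    G (am ∷ avoids-clique G nc ∷ [])

2K2-K5-e-K6 : (G : Graph (Fin N)) → NoMatching G 2 → NoNearClique G 3 → NoClique G 6 → Colourable G 5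
2K2-K5-e-K6 G nm nn nc =
  -- The entry point (7, 3, 1, 0) is the numerical form of K4.
  certified 5 (matchingPat 2 ∷ nearCliquePat 3 ∷ cliquePat 6 ∷ []) 2K2-K5-e-K6-certificate tt (7 ∷ 3 ∷ 1 ∷ 0 ∷ []) tt start
    G (avoids-matching G nm ∷ avoids-nearClique G nn ∷ avoids-clique G nc ∷ [])
  where
  start : ∀ {N} (G : Graph (Fin N)) → All (Avoids G) (matchingPat 2 ∷ nearCliquePat 3 ∷ cliquePat 6 ∷ []) →
          Colourable G 5 ⊎ ∃ (Semantics.Sat G (cliquePat 4))
  start G (am ∷ _) with clique-or-not G 4
  ... | inj₁ (xs , e , cl) = inj₂ (xs , subst (λ m → Semantics.Sat G (cliquePat m) xs) e (clique⇒Sat G xs cl))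
  ... | inj₂ nc = inj₁ (Colourable-mono {G = G} (ℕₚ.n≤1+n 4) (2K2-K4 G am nc))

-- Colouring a part of the graph

record Sub {N} (S : Fin N → Bool) : Set where
  field
    {size} : ℕ
    ι      : Fin size → Fin N
    inj    : ∀ {x y} → ι x ≡ ι y → x ≡ y
    into   : ∀ i → T (S (ι i))
    onto   : ∀ x → T (S x) → ∃ λ i → ι i ≡ x

sub : ∀ {N} (S : Fin N → Bool) → Sub S
sub {zero} S = record { size = 0 ; ι = λ () ; inj = λ { {()} } ; into = λ () ; onto = λ () }
sub {suc N} S with S zero in eq
... | true = record
  { ι    = λ { zero → zero ; (suc i) → suc (ι i) }
  ; inj  = λ { {zero} {zero} _ → refl ; {suc _} {suc _} e → cong suc (inj (suc-injective e)) }
  ; into = λ { zero → subst T (≡-sym eq) tt ; (suc i) → into i }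
  ; onto = λ { zero _ → zero , refl ; (suc x) t → suc (proj₁ (onto x t)) , cong suc (proj₂ (onto x t)) } }
  where open Sub (sub (λ x → S (suc x)))
... | false = record
  { ι    = λ i → suc (ι i)
  ; inj  = λ e → inj (suc-injective e)
  ; into = into
  ; onto = λ { zero t → ⊥-elim (subst T eq t) ; (suc x) t → proj₁ (onto x t) , cong suc (proj₂ (onto x t)) } }
  where open Sub (sub (λ x → S (suc x)))

module _ (G : Graph (Fin N)) where

  open Semantics G

  -- Colours are numbers given to all vertices but constrained only on `S`; palettes can then be
  -- stacked by addition, without maps between finite types.
  ColourableOn : (Fin N → Bool) → ℕ → Set
  ColourableOn S k = Σ (Fin N → ℕ) λ c → (∀ x → T (S x) → c x < k) × (∀ x y → T (S x) → T (S y) → x ~ y → c x ≢ c y)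

  on-all : ∀ {S k} → (∀ x → T (S x)) → ColourableOn S k → Colourable G k
  on-all s (c , lt , pr) = (λ x → fromℕ< (lt x (s x))) ,
    λ x y e q → pr x y (s x) (s y) e (fromℕ<-injective _ _ (lt x (s x)) (lt y (s y)) q)

  -- The parts may overlap: a common vertex is coloured as a member of `S`. Hence a cover by parts
  -- is enough, and no partition has to be arranged.
  on-∪ : ∀ {S S′ k l} → ColourableOn S k → ColourableOn S′ l → ColourableOn (λ x → S x ∨ S′ x) (k + l)
  on-∪ {S} {S′} {k} {l} (c , c< , pr) (c′ , c′< , pr′) = d , d< , λ x y → dpr x y
    where
    d : Fin N → ℕ
    d x with S x
    ... | true  = c x
    ... | false = k + c′ x
    d< : ∀ x → T (S x ∨ S′ x) → d x < k + l
    d< x t with S x in sx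
    ... | true  = ≤-trans (c< x (subst T (≡-sym sx) tt)) (ℕₚ.m≤m+n k l)
    ... | false = ℕₚ.+-monoʳ-< k (c′< x t)
    dpr : ∀ x y → T (S x ∨ S′ x) → T (S y ∨ S′ y) → x ~ y → d x ≢ d y
    dpr x y tx ty e q with S x in sx | S y in sy
    ... | true  | true  = pr x y (subst T (≡-sym sx) tt) (subst T (≡-sym sy) tt) e q
    ... | true  | false = ℕₚ.<⇒≢ (≤-trans (c< x (subst T (≡-sym sx) tt)) (ℕₚ.m≤m+n k (c′ y))) q
    ... | false | true  = ℕₚ.<⇒≢ (≤-trans (c< y (subst T (≡-sym sy) tt)) (ℕₚ.m≤m+n k (c′ x))) (≡-sym q)
    ... | false | false = pr′ x y tx ty e (ℕₚ.+-cancelˡ-≡ k _ _ q)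

  on-sub : ∀ {S k} (s : Sub S) → Colourable (restrict G (Sub.ι s)) k → ColourableOn S k
  on-sub {S} {k} s (c , pr) = d , d< , dpr
    where
    open Sub s
    d : Fin N → ℕ
    d x with T? (S x)
    ... | yes t = toℕ (c (proj₁ (onto x t)))
    ... | no _  = 0
    d< : ∀ x → T (S x) → d x < k
    d< x t with T? (S x)
    ... | yes t′ = toℕ<n _
    ... | no ¬t  = ⊥-elim (¬t t)
    dpr : ∀ x y → T (S x) → T (S y) → x ~ y → d x ≢ d y
    dpr x y tx ty e q with T? (S x) | T? (S y)
    ... | no ¬t  | _      = ¬t tx
    ... | yes _  | no ¬t  = ¬t ty
    ... | yes tx | yes ty = pr _ _ (subst₂ _~_ (≡-sym (proj₂ (onto x tx))) (≡-sym (proj₂ (onto y ty))) e) (toℕ-injective q)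

  module _ {S : Fin N → Bool} (s : Sub S) where

    open Sub s

    private
      R : Graph (Fin size)
      R = restrict G ι

    all-into : ∀ xs → All (λ x → T (S x)) (map ι xs)
    all-into []       = []
    all-into (x ∷ xs) = into x ∷ all-into xs

    restrict-noClique : (∀ xs → All (λ x → T (S x)) xs → length xs ≡ m → ¬ Clique G xs) → NoClique R m
    restrict-noClique none xs e cl = none (map ι xs) (all-into xs) (trans (length-map ι xs) e) (AllPairs.map⁺ cl)

    restrict-noMatching : (∀ es → All (λ e → T (S (proj₁ e)) × T (S (proj₂ e))) es → length es ≡ p → ¬ Matching G es) → NoMatching R p
    restrict-noMatching none es e mt = none (map ι² es) (into² es) (trans (length-map ι² es) e) (matching es mt)
      where
      ι² : Fin size × Fin size → Fin N × Fin N
      ι² (u , v) = ι u , ι v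
      into² : ∀ es → All (λ e → T (S (proj₁ e)) × T (S (proj₂ e))) (map ι² es)
      into² []             = []
      into² ((u , v) ∷ es) = (into u , into v) ∷ into² es
      matching : ∀ es → Matching R es → Matching G (map ι² es)
      matching []             _            = tt
      matching ((u , v) ∷ es) (uv , a , m) = uv , All.map⁺ a , matching es m

    restrict-noNearClique : (∀ a b ys → T (S a) → T (S b) → All (λ x → T (S x)) ys → length ys ≡ m → Clique G ys →
      All (a ~_) ys → All (b ~_) ys → a ≢ b → _≁_ G a b → ⊥) → NoNearClique R m
    restrict-noNearClique none a b ys e cl a~ b~ a≢b a≁b =
      none (ι a) (ι b) (map ι ys) (into a) (into b) (all-into ys) (trans (length-map ι ys) e) (AllPairs.map⁺ cl)
        (All.map⁺ a~) (All.map⁺ b~) (λ q → a≢b (inj q)) a≁b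

    -- An edge with no neighbour in S turns a matching of p edges inside S into one of p + 1 edges.
    restrict-noMatching-edge : ∀ {u v} → u ~ v → (∀ x → T (S x) → _≁_ G u x × _≁_ G v x) → NoMatching G (suc p) → NoMatching R p
    restrict-noMatching-edge {u = u} {v} uv far none = restrict-noMatching λ es es∈S e mt →
      none ((u , v) ∷ es) (cong suc e) (uv , All.map (λ { (a∈ , b∈) →
        proj₁ (far _ a∈) , proj₁ (far _ b∈) , proj₂ (far _ a∈) , proj₂ (far _ b∈) }) es∈S , mt)

  filter-mono : ∀ {P Q : Fin N → Set} (P? : ∀ x → Dec (P x)) (Q? : ∀ x → Dec (Q x)) → (∀ x → P x → Q x) →
                ∀ xs → length (filter P? xs) ≤ length (filter Q? xs)
  filter-mono P? Q? P⇒Q []       = z≤n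
  filter-mono P? Q? P⇒Q (x ∷ xs) with P? x | Q? x
  ... | yes _ | yes _ = s≤s (filter-mono P? Q? P⇒Q xs)
  ... | yes p | no ¬q = ⊥-elim (¬q (P⇒Q x p))
  ... | no _  | yes _ = ℕₚ.m≤n⇒m≤1+n (filter-mono P? Q? P⇒Q xs)
  ... | no _  | no _  = filter-mono P? Q? P⇒Q xs

  filter-strict : ∀ {P Q : Fin N → Set} (P? : ∀ x → Dec (P x)) (Q? : ∀ x → Dec (Q x)) → (∀ x → P x → Q x) →
                  ∀ {y} → ¬ P y → Q y → ∀ {xs} → y ∈ xs → length (filter P? xs) < length (filter Q? xs)
  filter-strict P? Q? P⇒Q {y} ¬p q {x ∷ xs} (here refl) with P? x | Q? x
  ... | yes p | _     = ⊥-elim (¬p p)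
  ... | no _  | no ¬q = ⊥-elim (¬q q)
  ... | no _  | yes _ = s≤s (filter-mono P? Q? P⇒Q xs)
  filter-strict P? Q? P⇒Q ¬p q {x ∷ xs} (there y∈) with P? x | Q? x
  ... | yes _ | yes _ = s≤s (filter-strict P? Q? P⇒Q ¬p q y∈)
  ... | yes p | no ¬q = ⊥-elim (¬q (P⇒Q x p))
  ... | no _  | yes _ = ℕₚ.m≤n⇒m≤1+n (filter-strict P? Q? P⇒Q ¬p q y∈)
  ... | no _  | no _  = filter-strict P? Q? P⇒Q ¬p q y∈

  filter-length : ∀ {P : Fin N → Set} (P? : ∀ x → Dec (P x)) xs → length xs ≡ length (filter P? xs) + length (filter (λ x → ¬? (P? x)) xs)
  filter-length P? []       = refl
  filter-length P? (x ∷ xs) with P? x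
  ... | yes _ = cong suc (filter-length P? xs)
  ... | no _  = trans (cong suc (filter-length P? xs)) (≡-sym (ℕₚ.+-suc _ _))

  -- In a disjoint union of cliques a vertex is coloured by the number of smaller vertices of its clique.
  cluster-colouring : ∀ {S} → (∀ x y z → T (S x) → T (S y) → T (S z) → x ~ y → y ~ z → x ≢ z → x ~ z) →
    (∀ xs → All (λ x → T (S x)) xs → length xs ≡ suc k → ¬ Clique G xs) → ColourableOn S k
  cluster-colouring {k} {S} tr none = c , c< , cpr
    where
    Below : Fin N → Fin N → Set
    Below x y = (T (S y) × y Fin.< x) × x ~ y
    below? : ∀ x y → Dec (Below x y)
    below? x y = (T? (S y) ×-dec (y <? x)) ×-dec (adj G x y ≟ᵇ true)
    below : Fin N → List (Fin N)
    below x = filter (below? x) (allFin N)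
    c : Fin N → ℕ
    c x = length (below x)
    clique : ∀ {x} → T (S x) → ∀ {ys} → All (Below x) ys → AllPairs _≢_ ys → Clique G ys
    clique sx []       []        = []
    clique sx (((sy , _) , xy) ∷ bs) (ne ∷ nes) = go bs ne ∷ clique sx bs nes
      where
      go : ∀ {ys} → All (Below _) ys → All (_ ≢_) ys → All (_ ~_) ys
      go []                    []       = []
      -- Two smaller neighbours of x are joined through x by transitivity, so `below x` is a clique,
      -- and it stays one when x is added.
      go (((sz , _) , xz) ∷ bs) (ne ∷ nes) = tr _ _ _ sy sx sz (~-sym xy) xz ne ∷ go bs nes
    c< : ∀ x → T (S x) → c x < k
    c< x sx with suc (c x) ≤? k
    ... | yes lt = lt
    -- With k or more smaller neighbours, x and the first k of them form a clique of the excluded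
    -- size k + 1.
    ... | no ¬lt = ⊥-elim (none (take (suc k) (x ∷ below x))
        (All.take⁺ (suc k) (sx ∷ All.map (λ b → proj₁ (proj₁ b)) bs))
        (trans (length-take (suc k) (x ∷ below x)) (ℕₚ.m≤n⇒m⊓n≡m (ℕₚ.≰⇒> ¬lt)))
        (AllPairs.take⁺ (suc k) (All.map proj₂ bs ∷ clique sx bs (AllPairs.filter⁺ (below? x) (allFin⁺ N)))))
      where
      bs : All (Below x) (below x)
      bs = All.all-filter (below? x) (allFin N)
    lower : ∀ {x y} → T (S x) → T (S y) → x ~ y → x Fin.< y → c x < c y
    lower {x} {y} sx sy xy x<y = filter-strict (below? x) (below? y)
      -- All that lies below x also lies below y, and x itself is new there; hence the count
      -- strictly increases.
      (λ { z ((sz , z<x) , xz) → (sz , <-trans z<x x<y) , tr y x z sy sx sz (~-sym xy) xz (λ { refl → <-irrefl refl (<-trans z<x x<y) }) })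
      (λ { ((_ , x<x) , _) → <-irrefl refl x<x }) ((sx , x<y) , ~-sym xy) (∈-allFin x)
    cpr : ∀ x y → T (S x) → T (S y) → x ~ y → c x ≢ c y
    cpr x y sx sy xy q with <-cmp x y
    ... | tri< x<y _ _ = ℕₚ.<⇒≢ (lower sx sy xy x<y) q
    ... | tri≈ _ x≡y _ = ~⇒≢ xy x≡y
    ... | tri> _ _ y<x = ℕₚ.<⇒≢ (lower sy sx (~-sym xy) y<x) (≡-sym q)

  -- No vertex outside a clique K has more than t neighbours in K, so two adjacent outer vertices would both miss two vertices of K.
  large-clique-colouring : ∀ t → NoMatching G 2 → NoNearClique G (suc t) → ∀ K → Clique G K → 2 + (t + t) ≤ length K →
    NoClique G (suc (length K)) → Colourable G (length K)
  large-clique-colouring t nm nn K cl big nc = colour , proper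
    where

    adj? : ∀ x y → Dec (x ~ y)
    adj? x y = adj G x y ≟ᵇ true
    false⇐ : ∀ {x y} → ¬ (x ~ y) → _≁_ G x y
    false⇐ {x} {y} ne with ~? x y
    ... | inj₁ e = ⊥-elim (ne e)
    ... | inj₂ e = e
    -- Since K cannot be enlarged, x misses some d in K. With t + 1 common neighbours in K the pair
    -- x, d would be a forbidden near-clique. Allowing a sublist `L` of K permits a second count
    -- among the vertices that another outer vertex misses.
    few : ∀ x → x ∉ K → ∀ L → All (_∈ K) L → Clique G L → length (filter (adj? x) L) ≤ t
    few x x∉ L L⊆ clL with suc t ≤? length (filter (adj? x) L)
    ... | no ¬le = ℕₚ.≤-pred (ℕₚ.≰⇒> ¬le)
    ... | yes le with All.all? (adj? x) K
    ... | yes x~ = ⊥-elim (nc (x ∷ K) refl (x~ ∷ cl))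
    ... | no ¬x~ with find (All.¬All⇒Any¬ (adj? x) K ¬x~)
    ... | d , d∈ , x≁d = ⊥-elim (nn x d ys (trans (length-take (suc t) (filter (adj? x) L)) (ℕₚ.m≤n⇒m⊓n≡m le))
        (AllPairs.take⁺ (suc t) (AllPairs.filter⁺ (adj? x) clL))
        x~ys (All.zipWith (λ { (y∈ , xy) → clique-∈ G cl d∈ y∈ λ { refl → x≁d xy } }) (ys⊆ , x~ys))
        (λ { refl → x∉ d∈ }) (false⇐ x≁d))
      where
      ys : List (Fin N)
      ys = take (suc t) (filter (adj? x) L)
      x~ys : All (x ~_) ys
      x~ys = All.take⁺ (suc t) (All.all-filter (adj? x) L)
      ys⊆ : All (_∈ K) ys
      ys⊆ = All.take⁺ (suc t) (All.filter⁺ (adj? x) L⊆)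
    missing : Fin N → List (Fin N) → List (Fin N)
    missing x L = filter (λ y → ¬? (adj? x y)) L
    self : All (_∈ K) K
    self = All.tabulate λ y∈ → y∈
    missing-length : ∀ x → x ∉ K → ∀ L → All (_∈ K) L → Clique G L → ∀ {s} → s + t ≤ length L → s ≤ length (missing x L)
    missing-length x x∉ L L⊆ clL {s} le = ℕₚ.+-cancelʳ-≤ t _ _ (≤-trans le (≤-trans (≤-reflexive (filter-length (adj? x) L))
      (≤-trans (ℕₚ.+-monoˡ-≤ _ (few x x∉ L L⊆ clL)) (≤-reflexive (ℕₚ.+-comm t _)))))
    outer : ∀ x y → x ∉ K → y ∉ K → ¬ (x ~ y)
    outer x y x∉ y∉ xy = go (missing y (missing x K)) len
      (AllPairs.filter⁺ _ (AllPairs.filter⁺ _ cl))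
      (All.filter⁺ _ (All.all-filter _ K)) (All.all-filter _ (missing x K))
      where
      -- At least |K| - t vertices of K are missed by x, and all but t of these are missed by y too.
      -- This leaves |K| - 2t, which is at least 2, and two such vertices form a 2K2 with the edge
      -- xy.
      len : 2 ≤ length (missing y (missing x K))
      len = missing-length y y∉ _ (All.filter⁺ _ self) (AllPairs.filter⁺ _ cl)
              (missing-length x x∉ K self cl (≤-trans (≤-reflexive (ℕₚ.+-assoc 2 t t)) big))
      go : ∀ L → 2 ≤ length L → Clique G L → All (λ z → ¬ (x ~ z)) L → All (λ z → ¬ (y ~ z)) L → ⊥
      go (u ∷ v ∷ _) _ ((uv ∷ _) ∷ _) (xu ∷ xv ∷ _) (yu ∷ yv ∷ _) =
        nm ((x , y) ∷ (u , v) ∷ []) refl (xy , (false⇐ xu , false⇐ xv , false⇐ yu , false⇐ yv) ∷ [] , uv , [] , tt)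
      go (_ ∷ []) (s≤s ())
    Spot : Fin N → Set
    Spot x = x ∈ K ⊎ (x ∉ K × ∃ λ u → u ∈ K × ¬ (x ~ u))
    spot : ∀ x → Spot x
    spot x with _∈?_ _≟_ x K
    ... | yes x∈ = inj₁ x∈
    ... | no x∉ = inj₂ (x∉ , go (missing x K) (missing-length x x∉ K self cl {1} (≤-trans (s≤s (ℕₚ.m≤n+m t (suc t))) big)) (λ u∈ → ∈-filter⁻ (λ y → ¬? (adj? x y)) u∈))
      where
      go : ∀ L → 1 ≤ length L → (∀ {u} → u ∈ L → u ∈ K × ¬ (x ~ u)) → ∃ λ u → u ∈ K × ¬ (x ~ u)
      go (u ∷ _) _ f = u , f (here refl)
    place : ∀ {x} → Spot x → Fin (length K)
    place (inj₁ x∈)        = index x∈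
    -- An outer vertex borrows the colour of a vertex of K that it misses; as no two outer vertices
    -- are adjacent, these loans cannot conflict.
    place (inj₂ (_ , _ , u∈ , _)) = index u∈
    colour : Fin N → Fin (length K)
    colour x = place (spot x)
    same-index : ∀ {x y} (x∈ : x ∈ K) (y∈ : y ∈ K) → index x∈ ≡ index y∈ → x ≡ y
    same-index x∈ y∈ e = trans (lookup-index x∈) (trans (cong (lookup K) e) (≡-sym (lookup-index y∈)))
    proper : ∀ x y → x ~ y → colour x ≢ colour y
    proper x y xy q with spot x | spot y
    ... | inj₁ x∈ | inj₁ y∈ = ~⇒≢ xy (same-index x∈ y∈ q)
    ... | inj₁ x∈ | inj₂ (_ , u , u∈ , y≁u) = y≁u (subst (y ~_) (same-index x∈ u∈ q) (~-sym xy))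
    ... | inj₂ (_ , u , u∈ , x≁u) | inj₁ y∈ = x≁u (subst (x ~_) (≡-sym (same-index u∈ y∈ q)) xy)
    ... | inj₂ (x∉ , _) | inj₂ (y∉ , _) = outer x y x∉ y∉ xy

-- The case p = 2 for all clique numbers

NoClique-2⇒Colourable-1 : (G : Graph (Fin N)) → NoClique G 2 → Colourable G 1
NoClique-2⇒Colourable-1 G nc = (λ _ → zero) , λ x y e _ → nc (x ∷ y ∷ []) refl ((e ∷ []) ∷ [] ∷ [])

-- An outer vertex has at most one neighbour in K, so the clique argument works from 2 + 2 = 4
-- vertices on, and the certificate covers clique number at most 3.
2K2-diamond : (G : Graph (Fin N)) → NoMatching G 2 → NoNearClique G 2 → ∀ j → NoClique G (4 + j) → Colourable G (3 + j)
2K2-diamond G nm nn zero    nc = 2K2-diamond-K4 G nm nn nc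
2K2-diamond G nm nn (suc j) nc with clique-or-not G (4 + j)
... | inj₂ nc′ = Colourable-mono {G = G} (ℕₚ.n≤1+n _) (2K2-diamond G nm nn j nc′)
... | inj₁ (K , e , cl) = subst (Colourable G) e (large-clique-colouring G 1 nm nn K cl
    (subst (4 ≤_) (≡-sym e) (ℕₚ.m≤m+n 4 j)) (subst (λ m → NoClique G (suc m)) (≡-sym e) nc))

-- Two neighbours in K are possible here. The clique argument therefore starts with 2 + 4 = 6
-- vertices, and clique number at most 5 is left to the certificate.
2K2-K5-e : (G : Graph (Fin N)) → NoMatching G 2 → NoNearClique G 3 → ∀ j → NoClique G (6 + j) → Colourable G (5 + j)
2K2-K5-e G nm nn zero    nc = 2K2-K5-e-K6 G nm nn nc
2K2-K5-e G nm nn (suc j) nc with clique-or-not G (6 + j)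
... | inj₂ nc′ = Colourable-mono {G = G} (ℕₚ.n≤1+n _) (2K2-K5-e G nm nn j nc′)
... | inj₁ (K , e , cl) = subst (Colourable G) e (large-clique-colouring G 2 nm nn K cl
    (subst (6 ≤_) (≡-sym e) (ℕₚ.m≤m+n 6 j)) (subst (λ m → NoClique G (suc m)) (≡-sym e) nc))

-- Removing an edge and its neighbourhood

module _ (G : Graph (Fin N)) (u v : Fin N) where

  far : Fin N → Bool
  far x = not (adj G u x) ∧ not (adj G v x)

  far-apart : ∀ x → T (far x) → _≁_ G u x × _≁_ G v x
  far-apart x t with adj G u x | adj G v x
  ... | false | false = refl , refl

  -- For an edge uv the vertices u and v need no extra colours: each is a neighbour of the other.
  near-or-far : ∀ x → T ((adj G u x ∨ adj G v x) ∨ far x)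
  near-or-far x with adj G u x | adj G v x
  ... | true  | _     = tt
  ... | false | true  = tt
  ... | false | false = tt

neighbourhood-triangle-free : (G : Graph (Fin N)) → NoClique G 3 → ∀ u → ColourableOn G (adj G u) 1
neighbourhood-triangle-free G nc u = (λ _ → 0) , (λ _ _ → s≤s z≤n) , λ x y ux uy xy _ →
  nc (u ∷ x ∷ y ∷ []) refl ((T⇒≡ ux ∷ T⇒≡ uy ∷ []) ∷ (xy ∷ []) ∷ [] ∷ [])

-- The neighbourhoods of both ends of an edge are independent, so each step of p costs two colours.
-- The bound 2p - 2 is exactly of this slope, starting from the certified 4 at p = 3.
triangle-free : ∀ q (G : Graph (Fin N)) → NoMatching G (3 + q) → NoClique G 3 → Colourable G (2 * (2 + q))
triangle-free zero    G nm nc = 3K2-K3 G nm nc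
triangle-free (suc q) G nm nc with clique-or-not G 2
... | inj₂ nc₂ = Colourable-mono {G = G} (s≤s z≤n) (NoClique-2⇒Colourable-1 G nc₂)
... | inj₁ (u ∷ v ∷ [] , _ , ((uv ∷ []) ∷ _)) = subst (Colourable G) (≡-sym (ℕₚ.*-suc 2 (2 + q)))
  (on-all G (near-or-far G u v) (on-∪ G
    (on-∪ G (neighbourhood-triangle-free G nc u) (neighbourhood-triangle-free G nc v))
    (on-sub G R (triangle-free q (restrict G (Sub.ι R)) (restrict-noMatching-edge G R uv (far-apart G u v) nm)
      (restrict-noClique G R λ xs _ → nc xs)))))
  where R = sub (far G u v)

-- An induced path x, y, z inside the neighbourhood of u would form a diamond with u. The cliques
-- there have at most k vertices, because u extends them.
neighbourhood-diamond-free : (G : Graph (Fin N)) → NoNearClique G 2 → NoClique G (2 + k) → ∀ u → ColourableOn G (adj G u) k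
neighbourhood-diamond-free G nn nc u = cluster-colouring G transitive
  λ xs xs∈ e cl → nc (u ∷ xs) (cong suc e) (All.map T⇒≡ xs∈ ∷ cl)
  where
  open Semantics G
  transitive : ∀ x y z → T (adj G u x) → T (adj G u y) → T (adj G u z) → x ~ y → y ~ z → x ≢ z → x ~ z
  transitive x y z ux uy uz xy yz x≢z with ~? x z
  ... | inj₁ xz = xz
  ... | inj₂ xz = ⊥-elim (nn x z (y ∷ u ∷ []) refl ((~-sym (T⇒≡ uy) ∷ []) ∷ [] ∷ [])
      (xy ∷ ~-sym (T⇒≡ ux) ∷ []) (~-sym yz ∷ ~-sym (T⇒≡ uz) ∷ []) x≢z xz)

diamond-free : ∀ p m (G : Graph (Fin N)) → NoMatching G (2 + p) → NoNearClique G 2 → NoClique G (3 + m) → Colourable G (g (2 + p) (2 + m))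
-- Without a triangle the value g 2 2 = 3 coincides with the certified bound for clique number 3.
diamond-free zero    zero    G nm nn nc = 2K2-diamond-K4 G nm nn (NoClique-suc G nc)
diamond-free zero    (suc j) G nm nn nc = 2K2-diamond G nm nn j nc
diamond-free (suc p) zero    G nm nn nc = subst (Colourable G) (ℕₚ.*-distribˡ-∸ 2 (3 + p) 1) (triangle-free p G nm nc)
diamond-free (suc p) (suc j) G nm nn nc with clique-or-not G 2
... | inj₂ nc₂ = Colourable-mono {G = G} (≤-trans (s≤s z≤n) (ℕₚ.m≤n+m _ (g (2 + p) (3 + j)))) (NoClique-2⇒Colourable-1 G nc₂)
... | inj₁ (u ∷ v ∷ [] , _ , ((uv ∷ []) ∷ _)) = subst (Colourable G) (count (g (2 + p) (3 + j)))
  (on-all G (near-or-far G u v) (on-∪ G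
    (on-∪ G (neighbourhood-diamond-free G nn nc u) (neighbourhood-diamond-free G nn nc v))
    (on-sub G R (diamond-free p (suc j) (restrict G (Sub.ι R)) (restrict-noMatching-edge G R uv (far-apart G u v) nm)
      (restrict-noNearClique G R λ a b ys _ _ _ → nn a b ys) (restrict-noClique G R λ xs _ → nc xs)))))
  where
  R = sub (far G u v)
  count : ∀ r → 2 + j + (2 + j) + r ≡ r + (2 * (3 + j) ∸ 2)
  count r = trans (ℕₚ.+-comm _ r) (cong (r +_) (trans (cong (λ i → 2 + j + i) (≡-sym (ℕₚ.+-identityʳ (2 + j)))) (ℕₚ.*-distribˡ-∸ 2 (3 + j) 1)))

-- The recursion of f also holds at m = 3, where f is given in closed form.

f-at-3 : ∀ q → f (3 + q) 3 ≡ 13 + 9 * q + 2 * q * q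
f-at-3 q = trans (cong (_∸ 3 * (3 + q)) (solve 1 (λ q → con 2 :* (con 3 :+ q) :* (con 3 :+ q) :+ con 4
    := con 3 :* (con 3 :+ q) :+ (con 13 :+ con 9 :* q :+ con 2 :* q :* q)) refl q))
  (ℕₚ.m+n∸m≡n (3 * (3 + q)) _)
  where open +-*-Solver

f-rec : ∀ p k → f (2 + p) (3 + k) + 2 * g (2 + p) (2 + k) + 3 * (1 + k) ≡ f (3 + p) (3 + k)
f-rec p       (suc k) = cong (f (2 + p) (4 + k) + 2 * g (2 + p) (3 + k) +_) (ℕₚ.*-distribˡ-∸ 3 (4 + k) 2)
f-rec zero    zero    = refl
f-rec (suc q) zero    = trans (cong₂ (λ a b → a + 2 * b + 3) (f-at-3 q) (≡-sym (ℕₚ.*-distribˡ-∸ 2 (3 + q) 1)))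
  (trans (solve 1 (λ q → con 13 :+ con 9 :* q :+ con 2 :* q :* q :+ con 2 :* (con 2 :* (con 2 :+ q)) :+ con 3
    := con 13 :+ con 9 :* (con 1 :+ q) :+ con 2 :* (con 1 :+ q) :* (con 1 :+ q)) refl q) (≡-sym (f-at-3 (suc q))))
  where open +-*-Solver

-- Under a mere upper bound on the clique number the graph may be triangle-free, and then its 2p - 2
-- colours must not exceed `f`.
f-lower : ∀ p k → 2 * (1 + p) ≤ f (2 + p) (3 + k)
f-lower zero    zero                = s≤s (s≤s z≤n)
f-lower zero    (suc zero)          = s≤s (s≤s z≤n)
f-lower zero    (suc (suc k))       = s≤s (s≤s z≤n)
f-lower (suc p) k = subst (2 * (2 + p) ≤_) (f-rec p k) (begin
  2 * (2 + p)                                               ≡⟨ ℕₚ.*-suc 2 (1 + p) ⟩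
  2 + 2 * (1 + p)                                           ≡⟨ ℕₚ.+-comm 2 (2 * (1 + p)) ⟩
  2 * (1 + p) + 2                                           ≤⟨ ℕₚ.+-mono-≤ (f-lower p k) (≤-trans (ℕₚ.n≤1+n 2) (ℕₚ.m≤m*n 3 (1 + k))) ⟩
  f (2 + p) (3 + k) + 3 * (1 + k)                           ≤⟨ ℕₚ.+-monoˡ-≤ (3 * (1 + k)) (ℕₚ.m≤m+n (f (2 + p) (3 + k)) _) ⟩
  f (2 + p) (3 + k) + 2 * g (2 + p) (2 + k) + 3 * (1 + k)   ∎)
  where open ℕₚ.≤-Reasoning

-- Removing a triangle and its neighbourhood

module _ (G : Graph (Fin N)) (nn : NoNearClique G 3) where

  open Semantics G

  -- An induced path x, y, z in the common neighbourhood would give K5-e, with the triangle y, u, v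
  -- as the clique and x, z as the non-adjacent pair.
  common-neighbourhood : NoClique G (3 + k) → ∀ {u v} → u ~ v → ColourableOn G (λ x → adj G u x ∧ adj G v x) k
  common-neighbourhood nc {u} {v} uv = cluster-colouring G transitive
    λ xs xs∈ e cl → nc (u ∷ v ∷ xs) (cong (2 +_) e)
      ((uv ∷ All.map (λ {x} t → proj₁ (both x t)) xs∈) ∷ All.map (λ {x} t → proj₂ (both x t)) xs∈ ∷ cl)
    where
    both : ∀ x → T (adj G u x ∧ adj G v x) → u ~ x × v ~ x
    both x t with ∧-split {adj G u x} t
    ... | t₁ , t₂ = T⇒≡ t₁ , T⇒≡ t₂
    transitive : ∀ x y z → T (adj G u x ∧ adj G v x) → T (adj G u y ∧ adj G v y) → T (adj G u z ∧ adj G v z) →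
                 x ~ y → y ~ z → x ≢ z → x ~ z
    transitive x y z tx ty tz xy yz x≢z with ~? x z | both x tx | both y ty | both z tz
    ... | inj₁ xz | _ | _ | _ = xz
    ... | inj₂ xz | ux , vx | uy , vy | uz , vz = ⊥-elim (nn x z (y ∷ u ∷ v ∷ []) refl
        ((~-sym uy ∷ ~-sym vy ∷ []) ∷ (uv ∷ []) ∷ [] ∷ [])
        (xy ∷ ~-sym ux ∷ ~-sym vx ∷ []) (~-sym yz ∷ ~-sym uz ∷ ~-sym vz ∷ []) x≢z xz)

  -- Adding a turns a diamond into K5-e and enlarges every clique by one, while the edge uv enlarges
  -- every induced matching. All three parameters of the restriction drop by one.
  private-neighbourhood : ∀ p k → NoMatching G (3 + p) → NoClique G (4 + k) → ∀ a {u v} → u ~ v →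
    ColourableOn G (λ x → adj G a x ∧ far G u v x) (g (2 + p) (2 + k))
  private-neighbourhood p k nm nc a {u} {v} uv = on-sub G S (diamond-free p k (restrict G (Sub.ι S))
    (restrict-noMatching-edge G S uv (λ x t → far-apart G u v x (proj₂ (∧-split {adj G a x} t))) nm)
    (restrict-noNearClique G S λ x y ys x∈ y∈ ys∈ e cl x~ y~ →
      nn x y (a ∷ ys) (cong suc e) (All.map (λ {z} → a~ z) ys∈ ∷ cl) (~-sym (a~ x x∈) ∷ x~) (~-sym (a~ y y∈) ∷ y~))
    (restrict-noClique G S λ xs xs∈ e cl → nc (a ∷ xs) (cong suc e) (All.map (λ {z} → a~ z) xs∈ ∷ cl)))
    where
    S = sub (λ x → adj G a x ∧ far G u v x)
    a~ : ∀ x → T (adj G a x ∧ far G u v x) → a ~ x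
    a~ x t = T⇒≡ (proj₁ (∧-split {adj G a x} t))

K5-e-free : ∀ p m (G : Graph (Fin N)) → NoMatching G (2 + p) → NoNearClique G 3 → NoClique G (suc m) → Colourable G (f (2 + p) m)
K5-e-free p 0 G nm nn nc = (λ x → ⊥-elim (nc (x ∷ []) refl ([] ∷ []))) , λ x → ⊥-elim (nc (x ∷ []) refl ([] ∷ []))
K5-e-free p 1 G nm nn nc = NoClique-2⇒Colourable-1 G nc
K5-e-free zero 2 G nm nn nc = 2K2-diamond-K4 G nm (NoClique⇒NoNearClique G nc) (NoClique-suc G nc)
K5-e-free zero 3 G nm nn nc = 2K2-K4 G (avoids-matching G nm) nc
-- Five colours suffice already for clique number 5, while f 2 4 = 6.
K5-e-free zero 4 G nm nn nc = Colourable-mono {G = G} (ℕₚ.n≤1+n 5) (2K2-K5-e-K6 G nm nn (NoClique-suc G nc))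
K5-e-free zero (suc (suc (suc (suc (suc j))))) G nm nn nc = 2K2-K5-e G nm nn j nc
K5-e-free (suc p) 2 G nm nn nc = subst (Colourable G) (ℕₚ.*-distribˡ-∸ 2 (3 + p) 1) (triangle-free p G nm nc)
K5-e-free {N} (suc p) (suc (suc (suc k))) G nm nn nc with clique-or-not G 3
... | inj₂ nc₃ = Colourable-mono {G = G} (f-lower (suc p) k) (triangle-free p G nm nc₃)
... | inj₁ (a ∷ b ∷ c ∷ [] , _ , ((ab ∷ ac ∷ []) ∷ (bc ∷ []) ∷ _)) = subst (Colourable G) count
  (on-all G cover (on-∪ G (on-∪ G
    (on-sub G R (K5-e-free p (3 + k) (restrict G (Sub.ι R)) (restrict-noMatching-edge G R ab (far-apart G a b) nm)
      (restrict-noNearClique G R λ x y ys _ _ _ → nn x y ys) (restrict-noClique G R λ xs _ → nc xs)))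
    (on-∪ G (private-neighbourhood G nn p k nm nc a bc) (private-neighbourhood G nn p k nm nc b ac)))
    (on-∪ G (common-neighbourhood G nn nc ab) (on-∪ G (common-neighbourhood G nn nc ac) (common-neighbourhood G nn nc bc)))))
  where
  R = sub (far G a b)
  -- The pattern of adjacency to a, b, c decides. A vertex adjacent to c alone is far from ab, and
  -- each vertex of the triangle lies in the common neighbourhood of the other two.
  cover : ∀ x → T ((far G a b x ∨ (adj G a x ∧ far G b c x ∨ adj G b x ∧ far G a c x)) ∨
                   (adj G a x ∧ adj G b x ∨ (adj G a x ∧ adj G c x ∨ adj G b x ∧ adj G c x)))
  cover x with adj G a x | adj G b x | adj G c x
  ... | false | false | _     = tt
  ... | false | true  | false = tt
  ... | false | true  | true  = tt
  ... | true  | false | false = tt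
  ... | true  | false | true  = tt
  ... | true  | true  | _     = tt
  g′ = g (2 + p) (2 + k)
  f′ = f (2 + p) (3 + k)
  count : f′ + (g′ + g′) + (suc k + (suc k + suc k)) ≡ f (3 + p) (3 + k)
  count = trans (solve 3 (λ x y z → x :+ (y :+ y) :+ (z :+ (z :+ z)) := x :+ con 2 :* y :+ con 3 :* z) refl f′ g′ (suc k)) (f-rec p k)
    where open +-*-Solver

-- The forbidden induced subgraphs of the theorem

noMatching : ∀ p (G : Graph (Fin N)) → Free (pK2 p) G → NoMatching G p
noMatching {N} p G free-p es e mt = free-p (φ , inj , pres)
  where
  open Semantics G
  end : Fin N × Fin N → Fin 2 → Fin N
  end (u , v) zero       = u
  end (u , v) (suc zero) = v
  edge : Fin p → Fin N × Fin N
  edge i = lookup es (Fin.cast (≡-sym e) i)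
  φ : Fin p × Fin 2 → Fin N
  φ (i , x) = end (edge i) x
  edge~ : ∀ es i → Matching G es → proj₁ (lookup es i) ~ proj₂ (lookup es i)
  edge~ (_ ∷ es) zero    (uv , _)     = uv
  edge~ (_ ∷ es) (suc i) (_ , _ , mt) = edge~ es i mt
  apart-sym : ∀ {d d′} → Apart G d d′ → Apart G d′ d
  apart-sym (ua , ub , va , vb) = flip ua , flip va , flip ub , flip vb
    where
    flip : ∀ {x y} → _≁_ G x y → _≁_ G y x
    flip {x} {y} q = trans (sym G y x) q
  apart : ∀ es i j → Matching G es → i ≢ j → Apart G (lookup es i) (lookup es j)
  apart (_ ∷ es) zero    zero    _            i≢j = ⊥-elim (i≢j refl)
  apart (_ ∷ es) zero    (suc j) (_ , al , _) i≢j = All.lookup al (∈-lookup j)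
  apart (_ ∷ es) (suc i) zero    (_ , al , _) i≢j = apart-sym {lookup (_ ∷ es) zero} (All.lookup al (∈-lookup i))
  apart (_ ∷ es) (suc i) (suc j) (_ , _ , mt) i≢j = apart es i j mt (λ q → i≢j (cong suc q))
  ends-apart : ∀ d d′ x y → Apart G d d′ → _≁_ G (end d x) (end d′ y)
  ends-apart _ _ zero       zero       (q , _ , _ , _) = q
  ends-apart _ _ zero       (suc zero) (_ , q , _ , _) = q
  ends-apart _ _ (suc zero) zero       (_ , _ , q , _) = q
  ends-apart _ _ (suc zero) (suc zero) (_ , _ , _ , q) = q
  edges-apart : ∀ i j → i ≢ j → Apart G (edge i) (edge j)
  edges-apart i j i≢j = apart es _ _ mt (λ q → i≢j (toℕ-injective
    (trans (≡-sym (toℕ-cast _ i)) (trans (cong toℕ q) (toℕ-cast _ j)))))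
  pres : ∀ s t → adj (pK2 p) s t ≡ adj G (φ s) (φ t)
  pres (i , x) (j , y) with i ≟ j
  ... | no i≢j = ≡-sym (ends-apart (edge i) (edge j) x y (edges-apart i j i≢j))
  ... | yes refl = same-edge x y
    where
    same-edge : ∀ x y → not ⌊ x ≟ y ⌋ ≡ adj G (end (edge i) x) (end (edge i) y)
    same-edge zero       zero       = ≡-sym (irrefl G _)
    same-edge zero       (suc zero) = ≡-sym (edge~ es _ mt)
    same-edge (suc zero) zero       = ≡-sym (~-sym (edge~ es _ mt))
    same-edge (suc zero) (suc zero) = ≡-sym (irrefl G _)
  partner : ∀ i x → φ (i , x) ~ φ (i , Fin.opposite x)
  partner i zero       = edge~ es _ mt
  partner i (suc zero) = ~-sym (edge~ es _ mt)
  inj : Injective _≡_ _≡_ φ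
  inj {i , x} {j , y} q with i ≟ j
  -- If ends of two different edges coincided, the partner of this vertex on edge i would be
  -- adjacent to an end of edge j.
  ... | no i≢j = ⊥-elim (¬~ (subst (_~ φ (i , Fin.opposite x)) q (partner i x))
                   (ends-apart (edge j) (edge i) y (Fin.opposite x) (edges-apart j i (λ r → i≢j (≡-sym r)))))
  ... | yes refl = cong (i ,_) (same-end x y q)
    where
    same-end : ∀ x y → φ (i , x) ≡ φ (i , y) → x ≡ y
    same-end zero       zero       _ = refl
    same-end (suc zero) (suc zero) _ = refl
    same-end zero       (suc zero) q = ⊥-elim (~⇒≢ (partner i zero) q)
    same-end (suc zero) zero       q = ⊥-elim (~⇒≢ (partner i (suc zero)) q)

lookup-injective : ∀ {A : Set} {xs : List A} → AllPairs _≢_ xs → ∀ i j → lookup xs i ≡ lookup xs j → i ≡ j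
lookup-injective (_ ∷ _)  zero    zero    _ = refl
lookup-injective (ne ∷ _) zero    (suc j) e = ⊥-elim (All.lookup ne (∈-lookup j) e)
lookup-injective (ne ∷ _) (suc i) zero    e = ⊥-elim (All.lookup ne (∈-lookup i) (≡-sym e))
lookup-injective (_ ∷ d)  (suc i) (suc j) e = cong suc (lookup-injective d i j e)

noK5-e : (G : Graph (Fin N)) → Free K5-e G → NoNearClique G 3
noK5-e G free-K a b (x ∷ y ∷ z ∷ []) refl ((xy ∷ xz ∷ []) ∷ (yz ∷ []) ∷ [] ∷ []) (ax ∷ ay ∷ az ∷ []) (bx ∷ by ∷ bz ∷ []) a≢b ab =
  free-K (φ , (λ {i} {j} → inj i j) , pres)
  where
  open Semantics G
  vs : List (Fin _)
  -- The non-adjacent pair comes first, since 0 and 1 are the non-adjacent vertices of `K5-e`.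
  vs = a ∷ b ∷ x ∷ y ∷ z ∷ []
  φ : Fin 5 → Fin _
  φ = lookup vs
  distinct : AllPairs _≢_ vs
  distinct = (a≢b ∷ ~⇒≢ ax ∷ ~⇒≢ ay ∷ ~⇒≢ az ∷ []) ∷ (~⇒≢ bx ∷ ~⇒≢ by ∷ ~⇒≢ bz ∷ []) ∷
             (~⇒≢ xy ∷ ~⇒≢ xz ∷ []) ∷ (~⇒≢ yz ∷ []) ∷ [] ∷ []
  inj : ∀ i j → φ i ≡ φ j → i ≡ j
  inj = lookup-injective distinct
  upper : ∀ i j → i Fin.< j → K5-e-adj i j ≡ adj G (φ i) (φ j)
  upper zero (suc zero) _ = ≡-sym ab
  upper zero (suc (suc zero)) _ = ≡-sym ax
  upper zero (suc (suc (suc zero))) _ = ≡-sym ay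
  upper zero (suc (suc (suc (suc zero)))) _ = ≡-sym az
  upper (suc zero) (suc (suc zero)) _ = ≡-sym bx
  upper (suc zero) (suc (suc (suc zero))) _ = ≡-sym by
  upper (suc zero) (suc (suc (suc (suc zero)))) _ = ≡-sym bz
  upper (suc (suc zero)) (suc (suc (suc zero))) _ = ≡-sym xy
  upper (suc (suc zero)) (suc (suc (suc (suc zero)))) _ = ≡-sym xz
  upper (suc (suc (suc zero))) (suc (suc (suc (suc zero)))) _ = ≡-sym yz
  upper zero zero ()
  upper (suc zero) zero ()
  upper (suc zero) (suc zero) (s≤s ())
  upper (suc (suc zero)) zero ()
  upper (suc (suc zero)) (suc zero) (s≤s ())
  upper (suc (suc zero)) (suc (suc zero)) (s≤s (s≤s ()))
  upper (suc (suc (suc zero))) zero ()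
  upper (suc (suc (suc zero))) (suc zero) (s≤s ())
  upper (suc (suc (suc zero))) (suc (suc zero)) (s≤s (s≤s ()))
  upper (suc (suc (suc zero))) (suc (suc (suc zero))) (s≤s (s≤s (s≤s ())))
  upper (suc (suc (suc (suc zero)))) zero ()
  upper (suc (suc (suc (suc zero)))) (suc zero) (s≤s ())
  upper (suc (suc (suc (suc zero)))) (suc (suc zero)) (s≤s (s≤s ()))
  upper (suc (suc (suc (suc zero)))) (suc (suc (suc zero))) (s≤s (s≤s (s≤s ())))
  upper (suc (suc (suc (suc zero)))) (suc (suc (suc (suc zero)))) (s≤s (s≤s (s≤s (s≤s ()))))
  pres : ∀ i j → adj K5-e i j ≡ adj G (φ i) (φ j)
  pres i j with <-cmp i j
  ... | tri< i<j _ _    = upper i j i<j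
  ... | tri≈ _ refl _   = trans (irrefl K5-e i) (≡-sym (irrefl G _))
  ... | tri> _ _ j<i    = trans (sym K5-e i j) (trans (upper j i j<i) (sym G _ _))

noClique : (G : Graph (Fin N)) → ∀ m → ¬ HasClique G m → NoClique G m
noClique G .(length xs) none xs refl cl = none (lookup xs , (λ {i} {j} → lookup-injective (AllPairs.map ~⇒≢ cl) i j) , pres)
  where
  open Semantics G
  pres : ∀ i j → i ≢ j → lookup xs i ~ lookup xs j
  pres i j i≢j = clique-∈ G cl (∈-lookup i) (∈-lookup j) (λ q → i≢j (lookup-injective (AllPairs.map ~⇒≢ cl) i j q))

theorem3p7 : (p : ℕ) → 2 ≤ p → (n : ℕ) (G : Graph (Fin n)) →
    Free (pK2 p) G → Free K5-e G →
    (w : ℕ) → IsCliqueNumber G w → Colourable G (f p w)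
theorem3p7 (suc (suc p)) (s≤s (s≤s z≤n)) n G fm fk w (_ , nc) =
  K5-e-free p w G (noMatching (2 + p) G fm) (noK5-e G fk) (noClique G (suc w) nc)
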